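{- There exists a normal binary sequence $S$ such that (1) $R_{\mathrm{PPM}^*}(S) = 0$ and (2) $\rho_{\mathrm{LZ}}(S) = 1$.
   Context: $S\upharpoonright m$ is the length-$m$ prefix of a sequence $S$; $\mathrm{occ}(w,x)$ is the number of positions at which $w$ occurs as a substring of $x$ (for $w$ empty, $|x|+1$). $S$ is normal if $\lim_{n\to\infty}\mathrm{occ}(w,S\upharpoonright n)/n = 2^{ -|w|}$ for every $w\in\{0,1\}^*$. For a compressor $T$, $R_T(S)=\limsup_{m\to\infty}|T(S\upharpoonright m)|/m$ and $\rho_T(S)=\liminf_{m\to\infty}|T(S\upharpoonright m)|/m$. PPM* (escape Method C, no exclusion). If $x$ is the input read so far, the model consists of $\lambda$ and every nonempty string $c$ such that $\mathrm{occ}(cb,x)\ge1$ for some bit $b$ and $c$ with its last bit removed occurs at least twice in $x$. For context $c$: count of bit $b$ is $\mathrm{occ}(cb,x)$; escape count $e(c)$ = number of bits with positive count; with $T$ = sum of the two counts and $e(c)$, bit $b$ gets probability $\mathrm{occ}(cb,x)/T$ and escape gets $e(c)/T$; $c$ is deterministic if $e(c)=1$. Relevant contexts are model contexts that are suffixes of $x$. To encode the next bit $b$: the current context is the shortest deterministic relevant context if one exists, else the longest relevant context. While the current context $c$ has count $0$ for $b$: an escape is emitted with probability $e(c)/T$ (if $c$ has any prediction) and the current context becomes the longest relevant context shorter than $c$; if $c=\lambda$, $b$ is emitted with probability $1/2$ and encoding of $b$ ends. When the current context has positive count for $b$, $b$ is emitted with its probability; then the model is updated. For finite $y$, with $P(y)$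 the product of all emitted probabilities, $\mathrm{PPM}^*(y)$ is an arithmetic code of length between $-\log_2 P(y)$ and $-\log_2 P(y)+2$. Lempel–Ziv 78 ($\mathrm{LZ}$): an input $x$ is parsed as $x = x_1x_2\cdots x_n$ where each phrase $x_i$ is the shortest prefix of the remaining input not among $x_1,\dots,x_{i-1}$ (the last phrase may repeat an earlier one); thus $x_i = x_{l(i)} b_i$ with $l(i)<i$, $b_i\in\{0,1\}$, $x_0=\lambda$. The output is $\mathrm{LZ}(x) = c_{l(1)}b_1 c_{l(2)}b_2\cdots c_{l(n)}b_n$, where $c_{l(i)}$ is the standard Lempel–Ziv encoding of the dictionary pointer $l(i)$ (written with about $\log_2 i$ bits). -}

module Defs where

open import Data.Bool using (Bool; true; false; if_then_else_; _∧_; _∨_; not)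
open import Data.Nat using (ℕ; zero; suc; _∸_; _^_; _≡ᵇ_; _<ᵇ_; _/_; _%_)
import Data.Nat
open import Data.Nat.Logarithm using (⌈log₂_⌉)
open import Data.List using (List; []; _∷_; _++_; _∷ʳ_; length; drop; reverse; upTo; foldr)
open import Data.List.Properties using (≡-dec)
import Data.Bool.Properties as BP
open import Data.Integer using (+_)
open import Data.Rational using (ℚ; 0ℚ; 1ℚ; _≤_; _<_; _*_; _+_; _-_; ∣_∣)
import Data.Rational
open import Data.Product using (Σ; _×_; _,_)

open import Relation.Nullary.Decidable using (⌊_⌋)


Bits : Set
Bits = List Bool

Seq : Set
Seq = ℕ → Bool

_↾_ : Seq → ℕ → Bits
S ↾ zero = []
S ↾ suc m = (S ↾ m) ∷ʳ S m

-- a / b as a rational (with a / 0 := 0, never used in a relevant way).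
frac : ℕ → ℕ → ℚ
frac a zero = 0ℚ
frac a (suc b) = Data.Rational._/_ (+ a) (suc b)

_==_ : Bits → Bits → Bool
u == v = ⌊ ≡-dec BP._≟_ u v ⌋

isPrefix : Bits → Bits → Bool
isPrefix [] x = true
isPrefix (a ∷ w) [] = false
isPrefix (a ∷ w) (b ∷ x) = ⌊ a BP.≟ b ⌋ ∧ isPrefix w x

-- occ w x : number of positions i ∈ {0,…,|x|} at which w occurs in x
-- (for w empty this is |x|+1).
occ : Bits → Bits → ℕ
occ w [] = if isPrefix w [] then 1 else 0
occ w (a ∷ x) = (if isPrefix w (a ∷ x) then 1 else 0) Data.Nat.+ occ w x

Limit : (ℕ → ℚ) → ℚ → Set
Limit f q = (ε : ℚ) → 0ℚ < ε → Σ ℕ λ N → (n : ℕ) → N Data.Nat.≤ n → ∣ f n - q ∣ ≤ ε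

LimsupEq : (ℕ → ℚ) → ℚ → Set
LimsupEq f q =
  ((ε : ℚ) → 0ℚ < ε → Σ ℕ λ N → (n : ℕ) → N Data.Nat.≤ n → f n ≤ q + ε) ×
  ((ε : ℚ) → 0ℚ < ε → (N : ℕ) → Σ ℕ λ n → N Data.Nat.≤ n × q - ε ≤ f n)

LiminfEq : (ℕ → ℚ) → ℚ → Set
LiminfEq f q =
  ((ε : ℚ) → 0ℚ < ε → Σ ℕ λ N → (n : ℕ) → N Data.Nat.≤ n → q - ε ≤ f n) ×
  ((ε : ℚ) → 0ℚ < ε → (N : ℕ) → Σ ℕ λ n → N Data.Nat.≤ n × f n ≤ q + ε)

Normal : Seq → Set
Normal S = (w : Bits) → Limit (λ n → frac (occ w (S ↾ n)) n) (frac 1 (2 ^ length w))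

-- R_T(S) and ρ_T(S) for a compressor given by its output length function
R-eq : (Bits → ℕ) → Seq → ℚ → Set
R-eq T S q = LimsupEq (λ m → frac (T (S ↾ m)) m) q

ρ-eq : (Bits → ℕ) → Seq → ℚ → Set
ρ-eq T S q = LiminfEq (λ m → frac (T (S ↾ m)) m) q

-- PPM* (escape method C, no exclusion)

dropLast : Bits → Bits
dropLast [] = []
dropLast (a ∷ []) = []
dropLast (a ∷ b ∷ r) = a ∷ dropLast (b ∷ r)

suffix : ℕ → Bits → Bits
suffix k x = drop (length x ∸ k) x

cnt : Bits → Bool → Bits → ℕ
cnt c b x = occ (c ∷ʳ b) x

pos : ℕ → ℕ
pos zero = 0
pos (suc _) = 1

esc : Bits → Bits → ℕ
esc c x = pos (cnt c false x) Data.Nat.+ pos (cnt c true x)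

tot : Bits → Bits → ℕ
tot c x = cnt c false x Data.Nat.+ cnt c true x Data.Nat.+ esc c x

inModel : Bits → Bits → Bool
inModel [] x = true
inModel (a ∷ c) x =
  (1 <ᵇ suc (cnt (a ∷ c) false x Data.Nat.+ cnt (a ∷ c) true x))
  ∧ (1 <ᵇ occ (dropLast (a ∷ c)) x)

filterᵇ : (ℕ → Bool) → List ℕ → List ℕ
filterᵇ p [] = []
filterᵇ p (k ∷ ks) = if p k then k ∷ filterᵇ p ks else filterᵇ p ks

-- lengths k (ascending, 0 … |x|) such that the suffix of length k of x
-- is a model context, i.e. the relevant contexts (identified by length)
relevant : Bits → List ℕ
relevant x = filterᵇ (λ k → inModel (suffix k x) x) (upTo (suc (length x)))

lastOr : ℕ → List ℕ → ℕ
lastOr d [] = d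
lastOr d (k ∷ ks) = lastOr k ks

-- length of the starting context: the shortest deterministic relevant
-- context if one exists, else the longest relevant context
startLen : Bits → ℕ
startLen x with filterᵇ (λ k → esc (suffix k x) x ≡ᵇ 1) (relevant x)
... | k ∷ _ = k
... | [] = lastOr 0 (relevant x)

-- probabilities emitted while encoding bit b after input x, walking the
-- chain of contexts (given by their lengths, in decreasing order)
emitChain : Bits → Bool → List ℕ → List ℚ
emitChain x b [] = []
emitChain x b (j ∷ rest) =
  let c = suffix j x in
  if 0 <ᵇ cnt c b x
  then frac (cnt c b x) (tot c x) ∷ []
  else ((if 0 <ᵇ esc c x then frac (esc c x) (tot c x) ∷ [] else [])
        ++ (if j ≡ᵇ 0 then frac 1 2 ∷ [] else emitChain x b rest))

emitted : Bits → Bool → List ℚ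
emitted x b =
  let k = startLen x in
  emitChain x b (k ∷ reverse (filterᵇ (λ j → j <ᵇ k) (relevant x)))

prodℚ : List ℚ → ℚ
prodℚ = foldr _*_ 1ℚ

ppmAux : Bits → Bits → ℚ
ppmAux x [] = 1ℚ
ppmAux x (b ∷ ys) = prodℚ (emitted x b) * ppmAux (x ∷ʳ b) ys

ppmP : Bits → ℚ
ppmP y = ppmAux [] y

-- T is (the length function of) a PPM* arithmetic code:
-- -log₂ P(y) ≤ |T(y)| ≤ -log₂ P(y) + 2, i.e. 2^{-|T y|} ≤ P(y) ≤ 2^{2-|T y|}
IsPPMStarCode : (Bits → ℕ) → Set
IsPPMStarCode T = (y : Bits) →
  (1ℚ ≤ ppmP y * frac (2 ^ T y) 1) × (ppmP y * frac (2 ^ T y) 1 ≤ frac 4 1)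

elemᵇ : Bits → List Bits → Bool
elemᵇ w [] = false
elemᵇ w (v ∷ vs) = (w == v) ∨ elemᵇ w vs

-- LZ78 parsing: each phrase is returned as (x_{l(i)}, b_i), i.e. the
-- phrase with its last bit split off.  D = phrases so far, w = current
-- partial phrase.  A trailing incomplete phrase (repeating an earlier
-- one) is returned as the last phrase.
lzParse : List Bits → Bits → Bits → List (Bits × Bool)
lzParse D [] [] = []
lzParse D (a ∷ w) [] = (dropLast (a ∷ w) , lastBit a w) ∷ []
  where
  lastBit : Bool → Bits → Bool
  lastBit a [] = a
  lastBit a (c ∷ r) = lastBit c r
lzParse D w (b ∷ xs) =
  if elemᵇ (w ∷ʳ b) D
  then lzParse D (w ∷ʳ b) xs
  else (w , b) ∷ lzParse (D ∷ʳ (w ∷ʳ b)) [] xs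

-- index j of u among x_0 = λ, x_1, …, x_{i-1} (D lists x_1, …, x_{i-1})
ptrAux : ℕ → Bits → List Bits → ℕ
ptrAux i u [] = 0
ptrAux i u (v ∷ vs) = if u == v then i else ptrAux (suc i) u vs

ptr : Bits → List Bits → ℕ
ptr [] D = 0
ptr (a ∷ u) D = ptrAux 1 (a ∷ u) D

binary : ℕ → ℕ → Bits
binary zero n = []
binary (suc k) n = binary k (n / 2) ∷ʳ (n % 2 ≡ᵇ 1)

-- output: c_{l(i)} b_i for each phrase i = 1,2,…; the pointer
-- l(i) ∈ {0,…,i-1} is written with ⌈log₂ i⌉ bits
lzEncode : List Bits → ℕ → List (Bits × Bool) → Bits
lzEncode D i [] = []
lzEncode D i ((u , b) ∷ ps) =
  binary ⌈log₂ i ⌉ (ptr u D) ++ (b ∷ lzEncode (D ∷ʳ (u ∷ʳ b)) (suc i) ps)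

LZ : Bits → Bits
LZ x = lzEncode [] 1 (lzParse [] [] x)

{-# OPTIONS --safe #-}

-- The sequence S is a concatenation of blocks; the block of order n lists all 2ⁿ words of length n, so that the
-- LZ78 phrases of S are exactly these words, and a phrase of length n costs between n and n + 2 bits.
--
-- The words are read off a cyclic sequence d of period N ∈ {2ⁿ, 2ⁿ - 1} whose windows of length n are distinct:
-- a de Bruijn sequence, or a de Bruijn sequence with one digit of the run 0ⁿ left out (0ⁿ is then appended to the
-- block).  Reading d in steps of n returns to its starting place after m = n / g turns, g = gcd n N; at that
-- moment one digit is skipped.  A block thus consists of g segments, each of which is periodic over m turns.
-- Since gcd n 2ⁿ and gcd n (2ⁿ - 1) are coprime divisors of n, one of them is at most √n, so the first few turns
-- of all segments together are a negligible part of the block.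
--
-- Normality: during a turn a word w occurs at most 2^(n - |w|) times, and these upper bounds are asymptotically
-- sharp because the occurrences of the words of one length add up.
--
-- PPM*: after K + 2 turns of a segment, the last 2N bits form a context that has been followed K times by the
-- correct bit and never by the other one: it contains 1ⁿ, which does not occur in the earlier blocks, and within
-- the block the last n bits determine the next one unless a skipped digit interferes.  So the shortest
-- deterministic context predicts correctly with probability at least K / (K + 1).  All other bits cost O(log n),
-- because every context that is used has length at least n - 2 and hence occurs O(n³) times.

module Submission where

open import Algebra.Bundles using (CommutativeMonoid)
open import Data.Bool using (Bool; true; false; if_then_else_; _∧_; not; _xor_)
import Data.Bool.Properties as BP
open import Data.Empty using (⊥; ⊥-elim)
open import Data.Fin using (Fin; toℕ; fromℕ<)
open import Data.Fin.Properties using (pigeonhole; fromℕ<-injective; toℕ<n)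
import Data.Integer as ℤ
import Data.Integer.Properties as ℤP
open import Data.List using (List; []; _∷_; _++_; _∷ʳ_; length; reverse; upTo; drop; take; initLast; _∷ʳ′_)
open import Data.List.Membership.Propositional using (_∈_)
open import Data.List.Membership.Propositional.Properties using (∈-++⁺ˡ; ∈-++⁺ʳ; ∈-++⁻; ∈-upTo⁺; ∈-upTo⁻)
open import Data.List.Properties
  using (++-assoc; ++-identityʳ; length-++; ≡-dec; ∷-injective; ∷ʳ-injective; drop-drop; take++drop≡id; reverse-++; length-drop)
import Data.List.Relation.Unary.All as All
open All using (All; []; _∷_)
open import Data.List.Relation.Unary.AllPairs using (AllPairs; []; _∷_)
import Data.List.Relation.Unary.AllPairs.Properties as AllPairsP
open import Data.List.Relation.Unary.Any using (here; there)
open import Data.Nat hiding (parity)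
open import Data.Nat.Coprimality using (Coprime; coprime-divisor; coprime-/gcd)
open import Data.Nat.Divisibility hiding (>⇒∤)
open import Data.Nat.DivMod
open import Data.Nat.GCD using (gcd; gcd[m,n]∣m; gcd[m,n]∣n; gcd[m,n]≢0)
open import Data.Nat.Logarithm using (⌈log₂_⌉; ⌈log₂⌉-mono-≤; ⌈log₂2^n⌉≡n)
open import Data.Nat.Properties
open import Data.Nat.Tactic.RingSolver using (solve-∀)
open import Data.Product using (Σ; _×_; _,_; proj₁; proj₂; ∃)
open import Data.Rational using (ℚ; 0ℚ; 1ℚ; mkℚ; toℚᵘ)
import Data.Rational as ℚ
import Data.Rational.Properties as ℚP
open import Data.Rational.Unnormalised using (mkℚᵘ)
import Data.Rational.Unnormalised as ℚᵘ
import Data.Rational.Unnormalised.Properties as ℚᵘP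
open import Data.Sum using (_⊎_; inj₁; inj₂)
open import Function using (_∘_; case_of_)
open import Relation.Binary.PropositionalEquality
open import Relation.Nullary using (¬_; Dec; yes; no)
open import Relation.Nullary.Decidable using (from-yes; _→-dec_; ⌊_⌋)
open import Algebra.Properties.Group ℚP.+-0-group using (⁻¹-involutive)
open import Algebra.Properties.CommutativeSemigroup (CommutativeMonoid.commutativeSemigroup ℚP.*-1-commutativeMonoid)
  using (interchange)
open import Defs

-- Congruences

-- The two compressors pull in opposite directions: LZ78 gains nothing only if each phrase is new
-- and no longer than the dictionary forces, while PPM* needs long literal repetitions. Reading one
-- cycle in steps of n serves both: each turn cuts it at new places, so the words differ, yet the
-- bit stream repeats the same turn m times. With N = 2ⁿ alone this fails when n is a power of two:
-- then n divides N, m = 1 and nothing is repeated. Hence the second candidate 2ⁿ - 1. The skip is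
-- forced as well: steps of n reach only one residue class modulo g, and each skipped digit opens
-- the next class. For a target ratio 1/(E + 1) the number K is a constant proportional to E + 1. A
-- predicted bit costs at most 1/h bits, where K + 1 = 2h. Of the n 2ⁿ bits of a block about √n (K +
-- 2) 2ⁿ are not predicted, at O(log n) each; so it is √n log n against n that decides. The block is
-- marked by 1ⁿ and not by 0ⁿ because the shortened cycle lacks 0ⁿ, and because segments starting
-- with 0 keep a run of 1s from straddling two of them.

slack : ∀ {a b} k → a + k ≡ b → a ≤ b
slack {a} k eq = ≤-trans (m≤m+n a k) (≤-reflexive eq)

infix 4 _≈_[_]
-- Shifts are allowed on both sides, so that no subtraction occurs and symmetry is a swap.
record _≈_[_] (i j N : ℕ) : Set where
  constructor shifts
  field
    a b   : ℕ
    agree : i + a * N ≡ j + b * N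

≈-sym : ∀ {i j N} → i ≈ j [ N ] → j ≈ i [ N ]
≈-sym (shifts a b eq) = shifts b a (sym eq)

≈-trans : ∀ {i j k N} → i ≈ j [ N ] → j ≈ k [ N ] → i ≈ k [ N ]
≈-trans {i} {j} {k} {N} (shifts a b eq) (shifts c e eq′) = shifts (a + c) (e + b) (begin
  i + (a + c) * N      ≡⟨ split i a c N ⟩
  (i + a * N) + c * N  ≡⟨ cong (_+ c * N) eq ⟩
  (j + b * N) + c * N  ≡⟨ swap j b c N ⟩
  (j + c * N) + b * N  ≡⟨ cong (_+ b * N) eq′ ⟩
  (k + e * N) + b * N  ≡⟨ split k e b N ⟨
  k + (e + b) * N      ∎)
  where
  open ≡-Reasoning
  split : ∀ i a c N → i + (a + c) * N ≡ (i + a * N) + c * N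
  split = solve-∀
  swap : ∀ i a c N → (i + a * N) + c * N ≡ (i + c * N) + a * N
  swap = solve-∀

≈-reflexive : ∀ {i j N} → i ≡ j → i ≈ j [ N ]
≈-reflexive {N = N} eq = shifts 0 0 (cong (_+ 0) eq)

≈-+* : ∀ i a N → i ≈ i + a * N [ N ]
≈-+* i a N = shifts a 0 (sym (+-identityʳ _))

≈-cancel-+ : ∀ k {i j N} → k + i ≈ k + j [ N ] → i ≈ j [ N ]
≈-cancel-+ k {i} {j} {N} (shifts a b eq) =
  shifts a b (+-cancelˡ-≡ k _ _ (trans (sym (+-assoc k i _)) (trans eq (+-assoc k j _))))

≈-+ : ∀ k {i j N} → i ≈ j [ N ] → k + i ≈ k + j [ N ]
≈-+ k {i} {j} {N} (shifts a b eq) =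
  shifts a b (trans (+-assoc k i _) (trans (cong (k +_) eq) (sym (+-assoc k j _))))

≈-% : ∀ i N .{{_ : NonZero N}} → i ≈ i % N [ N ]
≈-% i N = shifts 0 (i / N) (trans (+-identityʳ i) (m≡m%n+[m/n]*n i N))

≈-∣ : ∀ {i j N g} k → N ≡ g * k → i ≈ j [ N ] → i ≈ j [ g ]
≈-∣ {i} {j} {g = g} k refl (shifts a b eq) = shifts (a * k) (b * k) (trans (lem i a k g) (trans eq (sym (lem j b k g))))
  where
  lem : ∀ i a k g → i + (a * k) * g ≡ i + a * (g * k)
  lem = solve-∀

≈⇒%≡ : ∀ {i j} N .{{_ : NonZero N}} → i ≈ j [ N ] → i % N ≡ j % N
≈⇒%≡ {i} {j} N (shifts a b eq) =
  trans (sym ([m+kn]%n≡m%n i a N)) (trans (cong (_% N) eq) ([m+kn]%n≡m%n j b N))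

≈⇒≡ : ∀ {i j N} → i < N → j < N → i ≈ j [ N ] → i ≡ j
≈⇒≡ {N = suc N} i<N j<N c =
  trans (sym (m<n⇒m%n≡m i<N)) (trans (≈⇒%≡ (suc N) c) (m<n⇒m%n≡m j<N))

≈-cancel-* : ∀ g {x y k} .{{_ : NonZero g}} → g * x ≈ g * y [ g * k ] → x ≈ y [ k ]
≈-cancel-* g {x} {y} {k} (shifts a b eq) =
  shifts a b (*-cancelˡ-≡ _ _ g (trans (lem g x a k) (trans eq (sym (lem g y b k)))))
  where
  lem : ∀ g x a k → g * (x + a * k) ≡ g * x + a * (g * k)
  lem = solve-∀

≈⇒∣ : ∀ {x k N} → x + k ≈ x [ N ] → N ∣ k
≈⇒∣ {x} {k} {N} c with ≈-cancel-+ x {k} {0} (≈-trans c (≈-reflexive (sym (+-identityʳ x))))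
... | shifts a b eq = ∣m+n∣m⇒∣n (subst (N ∣_) (sym (trans (+-comm _ k) eq)) (n∣m*n b)) (n∣m*n a)

∣⇒≈ : ∀ {x k N} → N ∣ k → x + k ≈ x [ N ]
∣⇒≈ {x} (divides q refl) = ≈-sym (≈-+* x q _)

-- Euclid's lemma, applied to the difference of the larger and the smaller argument.
≈-coprime : ∀ {m N x y} → Coprime m N → m * x ≈ m * y [ N ] → x ≈ y [ N ]
≈-coprime {m} {N} {x} {y} cop c with ≤-total x y
... | inj₁ x≤y = ≈-sym (below x≤y (≈-sym c))
  where
  below : ∀ {x y} → x ≤ y → m * y ≈ m * x [ N ] → y ≈ x [ N ]
  below {x} {y} x≤y c = subst (_≈ x [ N ]) (m+[n∸m]≡n x≤y) (∣⇒≈ (coprime-divisor (λ (p , q) → cop (q , p))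
    (≈⇒∣ (≈-trans (≈-reflexive (trans (sym (*-distribˡ-+ m x (y ∸ x))) (cong (m *_) (m+[n∸m]≡n x≤y)))) c))))
... | inj₂ y≤x = subst (_≈ y [ N ]) (m+[n∸m]≡n y≤x) (∣⇒≈ (coprime-divisor (λ (p , q) → cop (q , p))
    (≈⇒∣ (≈-trans (≈-reflexive (trans (sym (*-distribˡ-+ m y (x ∸ y))) (cong (m *_) (m+[n∸m]≡n y≤x)))) c))))

-- De Bruijn sequences

Agree : ℕ → (ℕ → Bool) → (ℕ → Bool) → Set
Agree n u v = ∀ e → e < n → u e ≡ v e

from : (ℕ → Bool) → ℕ → ℕ → Bool
from f i e = f (i + e)

bit : Bool → ℕ
bit true  = 1
bit false = 0

-- Binary value of the first n digits. It turns agreement of windows into an equation between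
-- numbers below 2ⁿ, which is decidable and open to the pigeonhole principle.
code : ℕ → (ℕ → Bool) → ℕ
code zero    w = 0
code (suc n) w = bit (w n) + code n w * 2

bit<2 : ∀ b → bit b < 2
bit<2 true  = s≤s (s≤s z≤n)
bit<2 false = s≤s z≤n

bit-injective : ∀ a b → bit a ≡ bit b → a ≡ b
bit-injective true  true  _ = refl
bit-injective false false _ = refl

code< : ∀ n w → code n w < 2 ^ n
code< zero    w = s≤s z≤n
code< (suc n) w = begin-strict
  bit (w n) + code n w * 2  <⟨ +-monoˡ-< _ (bit<2 (w n)) ⟩
  suc (code n w) * 2        ≤⟨ *-monoˡ-≤ 2 (code< n w) ⟩
  2 ^ n * 2                 ≡⟨ *-comm (2 ^ n) 2 ⟩
  2 ^ suc n                 ∎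
  where open ≤-Reasoning

code-injective : ∀ n u v → code n u ≡ code n v → Agree n u v
code-injective (suc n) u v eq e e≤n with m≤n⇒m<n∨m≡n (s≤s⁻¹ e≤n)
... | inj₁ e<n = code-injective n u v (*-cancelʳ-≡ _ _ 2 (+-cancelˡ-≡ (bit (u n)) _ _
      (trans eq (cong (_+ code n v * 2) (sym bits))))) e e<n
  where
  bits : bit (u n) ≡ bit (v n)
  bits = ≈⇒≡ (bit<2 (u n)) (bit<2 (v n)) (shifts (code n u) (code n v) eq)
... | inj₂ refl = bit-injective _ _ (≈⇒≡ (bit<2 (u n)) (bit<2 (v n)) (shifts (code n u) (code n v) eq))

code-cong : ∀ n {u v} → Agree n u v → code n u ≡ code n v
code-cong zero    ag = refl
code-cong (suc n) ag = cong₂ (λ b c → bit b + c * 2) (ag n ≤-refl)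
  (code-cong n (λ e e<n → ag e (m<n⇒m<1+n e<n)))

-- Pigeonhole on `w` together with the 2ⁿ words `h i`: a collision must involve `w`, as the others
-- are distinct.
every-word-occurs : ∀ n (h : ℕ → ℕ → Bool) →
  (∀ i j → i < 2 ^ n → j < 2 ^ n → Agree n (h i) (h j) → i ≡ j) →
  ∀ w → Σ ℕ λ i → i < 2 ^ n × Agree n (h i) w
every-word-occurs n h inj w with anyUpTo? (λ i → code n (h i) ≟ code n w) (2 ^ n)
... | yes (i , i< , eq) = i , i< , code-injective n _ _ eq
... | no none = ⊥-elim (clash (pigeonhole ≤-refl (λ i → fromℕ< (code< n (h′ (toℕ i))))))
  where
  h′ : ℕ → ℕ → Bool
  h′ zero    = w
  h′ (suc i) = h i
  bound : (i : Fin (2 ^ n)) → toℕ i < 2 ^ n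
  bound = toℕ<n
  clash : (∃ λ i → ∃ λ j → i Data.Fin.< j ×
    fromℕ< (code< n (h′ (toℕ i))) ≡ fromℕ< (code< n (h′ (toℕ j)))) → ⊥
  clash (Fin.zero , Fin.suc j , _ , eq) = none (toℕ j , bound j , sym (fromℕ<-injective _ _ _ _ eq))
  clash (Fin.suc i , Fin.suc j , s≤s i<j , eq) =
    <⇒≢ i<j (inj _ _ (bound i) (bound j) (code-injective n _ _ (fromℕ<-injective _ _ _ _ eq)))

-- `inj` concludes modulo `N`, so places need not be reduced; `N` is a parameter because cycles of
-- period 2ⁿ - 1 are needed too.
record Cycle (n N : ℕ) : Set where
  field
    d   : ℕ → Bool
    per : ∀ i → d (i + N) ≡ d i
    inj : ∀ i j → Agree n (from d i) (from d j) → i ≈ j [ N ]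

per-* : ∀ {d : ℕ → Bool} {N} → (∀ i → d (i + N) ≡ d i) → ∀ a i → d (i + a * N) ≡ d i
per-* {d} {N} per zero    i = cong d (+-identityʳ i)
per-* {d} {N} per (suc a) i = trans (cong d (trans (cong (i +_) (+-comm N (a * N))) (sym (+-assoc i (a * N) N))))
  (trans (per (i + a * N)) (per-* per a i))

per-≈ : ∀ {d : ℕ → Bool} {N} → (∀ i → d (i + N) ≡ d i) → ∀ {i j} → i ≈ j [ N ] → d i ≡ d j
per-≈ {d} per {i} {j} (shifts a b eq) = trans (sym (per-* per a i)) (trans (cong d eq) (per-* per b j))

from-≈ : ∀ {d : ℕ → Bool} {N} → (∀ i → d (i + N) ≡ d i) → ∀ {i j} → i ≈ j [ N ] → ∀ e → from d i e ≡ from d j e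
from-≈ {N = N} per {i} {j} c e = per-≈ per (subst₂ (λ x y → x ≈ y [ N ]) (+-comm e i) (+-comm e j) (≈-+ e c))

inj-from-range : ∀ {n N} {d : ℕ → Bool} .{{_ : NonZero N}} → (∀ i → d (i + N) ≡ d i) →
  (∀ i j → i < N → j < N → Agree n (from d i) (from d j) → i ≈ j [ N ]) →
  ∀ i j → Agree n (from d i) (from d j) → i ≈ j [ N ]
inj-from-range {N = N} per inj i j ag =
  ≈-trans (≈-% i N) (≈-trans (inj (i % N) (j % N) (m%n<n i N) (m%n<n j N)
    (λ e e<n → trans (sym (from-≈ per (≈-% i N) e)) (trans (ag e e<n) (from-≈ per (≈-% j N) e))))
    (≈-sym (≈-% j N)))

rotate : ∀ {n N} → ℕ → Cycle n N → Cycle n N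
rotate {n} {N} a c = record
  { d   = from d a
  ; per = λ i → trans (cong d (sym (+-assoc a i N))) (per (a + i))
  ; inj = λ i j ag → ≈-cancel-+ a (inj _ _ (λ e e<n →
      trans (cong d (+-assoc a i e)) (trans (ag e e<n) (cong d (sym (+-assoc a j e))))))
  }
  where open Cycle c

DeBruijn : ℕ → Set
DeBruijn n = Cycle n (2 ^ n)

occursIn : ∀ {n} (c : DeBruijn n) (w : ℕ → Bool) → Σ ℕ λ i → i < 2 ^ n × Agree n (from (Cycle.d c) i) w
occursIn {n} c = every-word-occurs n (from d) (λ i j i< j< ag → ≈⇒≡ i< j< (inj i j ag))
  where open Cycle c

n<2^n : ∀ n → n < 2 ^ n
n<2^n zero    = s≤s z≤n
n<2^n (suc n) = begin-strict
  suc n          <⟨ s≤s (n<2^n n) ⟩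
  suc (2 ^ n)    ≤⟨ +-monoˡ-≤ (2 ^ n) (m^n>0 2 n) ⟩
  2 ^ n + 2 ^ n  ≡⟨ cong (2 ^ n +_) (+-identityʳ (2 ^ n)) ⟨
  2 ^ suc n      ∎
  where open ≤-Reasoning

-- Parity over a period, and Lempel's lift

parity : (ℕ → Bool) → ℕ → Bool
parity f zero    = false
parity f (suc k) = parity f k xor f k

parity-cong : ∀ {f g} k → Agree k f g → parity f k ≡ parity g k
parity-cong zero    ag = refl
parity-cong (suc k) ag = cong₂ _xor_ (parity-cong k (λ e e<k → ag e (m<n⇒m<1+n e<k))) (ag k ≤-refl)

parity-+ : ∀ f a b → parity f (a + b) ≡ parity f a xor parity (from f a) b
parity-+ f a zero    = trans (cong (parity f) (+-identityʳ a)) (sym (BP.xor-identityʳ _))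
parity-+ f a (suc b) = trans (cong (parity f) (+-suc a b))
  (trans (cong (_xor f (a + b)) (parity-+ f a b)) (BP.xor-assoc (parity f a) _ _))

-- Moving the window by one place trades `f 0` for the equal digit `f k`; so rotations of a cycle
-- preserve evenness.
parity-shift : ∀ f k → f k ≡ f 0 → parity (from f 1) k ≡ parity f k
parity-shift f k eq = begin
  parity (from f 1) k                        ≡⟨ cancel (f 0) (parity (from f 1) k) ⟨
  f 0 xor (f 0 xor parity (from f 1) k)      ≡⟨ cong (f 0 xor_) (parity-+ f 1 k) ⟨
  f 0 xor (parity f k xor f k)               ≡⟨ cong (f 0 xor_) (cong (parity f k xor_) eq) ⟩
  f 0 xor (parity f k xor f 0)               ≡⟨ cong (f 0 xor_) (BP.xor-comm (parity f k) (f 0)) ⟩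
  f 0 xor (f 0 xor parity f k)               ≡⟨ cancel (f 0) (parity f k) ⟩
  parity f k                                 ∎
  where
  open ≡-Reasoning
  cancel : ∀ a b → a xor (a xor b) ≡ b
  cancel true  true  = refl
  cancel true  false = refl
  cancel false b     = refl

parity-not-even : ∀ f k → parity (not ∘ f) (k + k) ≡ parity f (k + k)
parity-not-even f zero = refl
parity-not-even f (suc k) rewrite +-suc k k =
  trans (cong (λ p → (p xor not (f (k + k))) xor not (f (suc (k + k)))) (parity-not-even f k))
    (cancel (parity f (k + k)) (f (k + k)) (f (suc (k + k))))
  where
  cancel : ∀ p a b → (p xor not a) xor not b ≡ (p xor a) xor b
  cancel true  true  true  = refl
  cancel true  true  false = refl
  cancel true  false true  = refl
  cancel true  false false = refl
  cancel false true  true  = refl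
  cancel false true  false = refl
  cancel false false true  = refl
  cancel false false false = refl

-- Lempel's lift: the two sequences t and ¬ t whose differences are s are joined along 1ⁿ, which
-- occurs at position 0 of s.
module Lift {n} (c : DeBruijn (suc n)) (even : parity (Cycle.d c) (2 ^ suc n) ≡ false)
            (ones : ∀ e → e < suc n → Cycle.d c e ≡ true) where
  open Cycle c renaming (d to s; per to s-per; inj to s-inj)

  N : ℕ
  N = 2 ^ suc n

  instance
    N≢0 : NonZero N
    N≢0 = m^n≢0 2 (suc n)
    2N≢0 : NonZero (N + N)
    2N≢0 = >-nonZero (≤-trans (m^n>0 2 (suc n)) (m≤m+n N N))

  n<N : suc n < N
  n<N = n<2^n (suc n)

  -- Running sum of `s`, so that `s` is its sequence of differences. Even parity of `s` makes it
  -- close up after `N` digits; with odd parity it would return complemented.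
  t : ℕ → Bool
  t = parity s

  t-per : ∀ i → t (i + N) ≡ t i
  t-per zero    = even
  t-per (suc i) = cong₂ _xor_ (t-per i) (s-per i)

  -- Along a run of 1s the running sum alternates, so there its complement coincides with `t` moved
  -- by one place: this is where the two cycles can be spliced.
  t-ones : ∀ x → x < suc n → t (suc x) ≡ not (t x)
  t-ones x x≤n rewrite ones x x≤n = BP.xor-comm (t x) true

  u₀ : ℕ → Bool
  u₀ j = if j <ᵇ N then t (suc j) else not (t (j ∸ N))

  u : ℕ → Bool
  u j = u₀ (j % (N + N))

  u-per : ∀ j → u (j + (N + N)) ≡ u j
  u-per j = cong u₀ ([m+n]%n≡m%n j (N + N))

  u₀-low : ∀ j → j < N → u₀ j ≡ t (suc j)
  u₀-low j j<N with j <ᵇ N | <⇒<ᵇ j<N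
  ... | true | _ = refl

  u₀-high : ∀ j → u₀ (N + j) ≡ not (t j)
  u₀-high j with N + j <ᵇ N | <ᵇ⇒< (N + j) N
  ... | true  | lt = ⊥-elim (m+n≮m N j (lt _))
  ... | false | _  = cong (not ∘ t) (m+n∸m≡n N j)

  u≡u₀ : ∀ j → j < N + N → u j ≡ u₀ j
  u≡u₀ j j< = cong u₀ (m<n⇒m%n≡m j<)

  below : ∀ {j} → j < N → j < N + N
  below j<N = ≤-trans j<N (m≤m+n N N)

  -- A window of length n + 2 starting in the first half reaches at most n + 1 digits into the
  -- second, and on these the splice continues `t`.
  low : ∀ j → j < N + suc n → u j ≡ t (suc j)
  low j j< with j <? N
  ... | yes j<N = trans (u≡u₀ j (below j<N)) (u₀-low j j<N)
  ... | no j≮N with m≤n⇒∃[o]m+o≡n (≮⇒≥ j≮N)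
  ...   | x , refl = begin
    u (N + x)        ≡⟨ u≡u₀ (N + x) (+-monoʳ-< N (<-trans x< n<N)) ⟩
    u₀ (N + x)       ≡⟨ u₀-high x ⟩
    not (t x)        ≡⟨ t-ones x x< ⟨
    t (suc x)        ≡⟨ t-per (suc x) ⟨
    t (suc (x + N))  ≡⟨ cong (t ∘ suc) (+-comm x N) ⟩
    t (suc (N + x))  ∎
    where
    open ≡-Reasoning
    x< : x < suc n
    x< = +-cancelˡ-< N x (suc n) j<

  high : ∀ j → j < N + suc n → u (N + j) ≡ not (t j)
  high j j< with j <? N
  ... | yes j<N = trans (u≡u₀ (N + j) (+-monoʳ-< N j<N)) (u₀-high j)
  ... | no j≮N with m≤n⇒∃[o]m+o≡n (≮⇒≥ j≮N)
  ...   | x , refl = begin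
    u (N + (N + x))  ≡⟨ cong u (trans (sym (+-assoc N N x)) (+-comm (N + N) x)) ⟩
    u (x + (N + N))  ≡⟨ u-per x ⟩
    u x              ≡⟨ u≡u₀ x (below (<-trans x< n<N)) ⟩
    u₀ x             ≡⟨ u₀-low x (<-trans x< n<N) ⟩
    t (suc x)        ≡⟨ t-ones x x< ⟩
    not (t x)        ≡⟨ cong not (t-per x) ⟨
    not (t (x + N))  ≡⟨ cong (not ∘ t) (+-comm x N) ⟩
    not (t (N + x))  ∎
    where
    open ≡-Reasoning
    x< : x < suc n
    x< = +-cancelˡ-< N x (suc n) j<

  -- Tells from which of the two cycles a window of `u` stems: `b` is the complementation that
  -- differences cannot see.
  record Source (i j : ℕ) (b : Bool) : Set where
    constructor source
    field
      reads : ∀ e → e < suc (suc n) → u (i + e) ≡ b xor t (j + e)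

  origin : ∀ i → i < N + N → (i < N × Source i (suc i) false) ⊎ (Σ ℕ λ j → i ≡ N + j × j < N × Source i j true)
  origin i i< with i <? N
  ... | yes i<N = inj₁ (i<N , source (λ e e< → low (i + e) (fits i<N (s≤s⁻¹ e<))))
    where
    fits : ∀ {i e} → i < N → e ≤ suc n → i + e < N + suc n
    fits i<N e≤ = +-mono-≤ i<N e≤
  ... | no i≮N with m≤n⇒∃[o]m+o≡n (≮⇒≥ i≮N)
  ...   | j , refl = inj₂ (j , refl , j<N , source (λ e e< → trans (cong u (+-assoc N j e))
      (high (j + e) (+-mono-≤ j<N (s≤s⁻¹ e<)))))
    where
    j<N : j < N
    j<N = +-cancelˡ-< N j N i<

  source-diff : ∀ {i j b} → Source i j b → ∀ e → e < suc n → s (j + e) ≡ u (i + e) xor u (i + suc e)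
  source-diff {i} {j} {b} (source src) e e< = begin
    s (j + e)                                        ≡⟨ cancel b (t (j + e)) (s (j + e)) ⟨
    (b xor t (j + e)) xor (b xor t (suc (j + e)))    ≡⟨ cong (λ k → (b xor t (j + e)) xor (b xor t k)) (+-suc j e) ⟨
    (b xor t (j + e)) xor (b xor t (j + suc e))      ≡⟨ cong₂ _xor_ (src e (m<n⇒m<1+n e<)) (src (suc e) (s≤s e<)) ⟨
    u (i + e) xor u (i + suc e)                      ∎
    where
    open ≡-Reasoning
    cancel : ∀ b x y → (b xor x) xor (b xor (x xor y)) ≡ y
    cancel true  true  true  = refl
    cancel true  true  false = refl
    cancel true  false true  = refl
    cancel true  false false = refl
    cancel false true  true  = refl
    cancel false true  false = refl
    cancel false false y     = refl

  sources-meet : ∀ {i i′ j j′ b b′} → Source i j b → Source i′ j′ b′ →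
    Agree (suc (suc n)) (from u i) (from u i′) → j ≈ j′ [ N ]
  sources-meet {i} {i′} {j} {j′} src src′ ag = s-inj j j′ (λ e e< → trans (source-diff src e e<)
    (trans (cong₂ _xor_ (ag e (m<n⇒m<1+n e<)) (ag (suc e) (s≤s e<))) (sym (source-diff src′ e e<))))

  -- Equal differences force the same place of `s`, but there the two cycles carry opposite digits.
  sources-differ : ∀ {i i′ j j′} → Source i j false → Source i′ j′ true →
    ¬ Agree (suc (suc n)) (from u i) (from u i′)
  sources-differ {i} {i′} {j} {j′} src@(source reads) src′@(source reads′) ag = BP.not-¬ refl (begin
    t (j′ + 0)           ≡⟨ from-≈ t-per (sources-meet src src′ ag) 0 ⟨
    t (j + 0)            ≡⟨ reads 0 (s≤s z≤n) ⟨
    u (i + 0)            ≡⟨ ag 0 (s≤s z≤n) ⟩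
    u (i′ + 0)           ≡⟨ reads′ 0 (s≤s z≤n) ⟩
    not (t (j′ + 0))     ∎)
    where open ≡-Reasoning

  u-inj : ∀ i j → i < N + N → j < N + N → Agree (suc (suc n)) (from u i) (from u j) → i ≈ j [ N + N ]
  u-inj i j i< j< ag with origin i i< | origin j j<
  ... | inj₁ (i<N , src) | inj₁ (j<N , src′) =
    ≈-reflexive (≈⇒≡ i<N j<N (≈-cancel-+ 1 (sources-meet src src′ ag)))
  ... | inj₂ (_ , refl , i<N , src) | inj₂ (_ , refl , j<N , src′) =
    ≈-reflexive (cong (N +_) (≈⇒≡ i<N j<N (sources-meet src src′ ag)))
  ... | inj₁ (_ , src) | inj₂ (_ , _ , _ , src′) = ⊥-elim (sources-differ src src′ ag)
  ... | inj₂ (_ , _ , _ , src) | inj₁ (_ , src′) = ⊥-elim (sources-differ src′ src (λ e e< → sym (ag e e<)))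

  -- Complementing an even number of digits keeps their parity, so the two halves cancel; this is
  -- what allows the lift to be iterated.
  u-even : parity u (N + N) ≡ false
  u-even = begin
    parity u (N + N)                       ≡⟨ parity-+ u N N ⟩
    parity u N xor parity (from u N) N
      ≡⟨ cong₂ _xor_ (parity-cong N (λ e e<N → low e (≤-trans e<N (m≤m+n N _))))
                     (parity-cong N (λ e e<N → high e (≤-trans e<N (m≤m+n N _)))) ⟩
    parity (from t 1) N xor parity (not ∘ t) N
      ≡⟨ cong₂ _xor_ (parity-shift t N (t-per 0)) flip ⟩
    parity t N xor parity t N              ≡⟨ BP.xor-same (parity t N) ⟩
    false                                  ∎
    where
    open ≡-Reasoning
    flip : parity (not ∘ t) N ≡ parity t N
    flip = subst (λ k → parity (not ∘ t) k ≡ parity t k) (cong (2 ^ n +_) (sym (+-identityʳ (2 ^ n))))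
      (parity-not-even t (2 ^ n))

  double : N + N ≡ 2 ^ suc (suc n)
  double = cong (N +_) (sym (+-identityʳ N))

  lift : Cycle (suc (suc n)) (N + N)
  lift = record { d = u ; per = u-per ; inj = inj-from-range u-per u-inj }

record EvenDeBruijn (n : ℕ) : Set where
  constructor _evenly_
  field
    cycle : DeBruijn n
    even  : parity (Cycle.d cycle) (2 ^ n) ≡ false

rotate-even : ∀ {n} (a : ℕ) → EvenDeBruijn n → EvenDeBruijn n
rotate-even zero c = c
rotate-even {n} (suc a) e with rotate-even a e
... | c evenly even = rotate 1 c evenly trans (parity-shift (Cycle.d c) (2 ^ n) (Cycle.per c 0)) even

rotate-even-from : ∀ {n} (a : ℕ) (c : EvenDeBruijn n) i →
  Cycle.d (EvenDeBruijn.cycle (rotate-even a c)) i ≡ Cycle.d (EvenDeBruijn.cycle c) (a + i)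
rotate-even-from zero    c i = refl
rotate-even-from (suc a) c i = trans (rotate-even-from a c (suc i)) (cong (Cycle.d (EvenDeBruijn.cycle c)) (+-suc a i))

lift-even : ∀ {n} → EvenDeBruijn (suc n) → EvenDeBruijn (suc (suc n))
lift-even {n} e with occursIn (EvenDeBruijn.cycle e) (λ _ → true)
... | i , _ , ones = cast double lift u-even
  where
  e′ : EvenDeBruijn (suc n)
  e′ = rotate-even i e
  ones′ : ∀ k → k < suc n → Cycle.d (EvenDeBruijn.cycle e′) k ≡ true
  ones′ k k< = trans (rotate-even-from i e k) (ones k k<)
  open Lift (EvenDeBruijn.cycle e′) (EvenDeBruijn.even e′) ones′
  cast : ∀ {N} → N ≡ 2 ^ suc (suc n) → (c : Cycle (suc (suc n)) N) → parity (Cycle.d c) N ≡ false →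
    EvenDeBruijn (suc (suc n))
  cast refl c p = c evenly p

inj-by-codes : ∀ n N (d : ℕ → Bool) →
  (∀ {i} → i < N → ∀ {j} → j < N → code n (from d i) ≡ code n (from d j) → i ≡ j) →
  ∀ i j → i < N → j < N → Agree n (from d i) (from d j) → i ≈ j [ N ]
inj-by-codes n N d codes i j i< j< ag = ≈-reflexive (codes i< j< (code-cong n ag))

distinct-codes? : ∀ n N (d : ℕ → Bool) →
  Dec (∀ {i} → i < N → ∀ {j} → j < N → code n (from d i) ≡ code n (from d j) → i ≡ j)
distinct-codes? n N d =
  allUpTo? (λ i → allUpTo? (λ j → (code n (from d i) ≟ code n (from d j)) →-dec (i ≟ j)) N) N

-- Starts at order 2 with the cycle 0011. Order 1 offers only 01, whose odd parity `Lift` does not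
-- accept, so `deBruijn` treats it separately.
evenDeBruijn : ∀ n → EvenDeBruijn (suc (suc n))
evenDeBruijn (suc n) = lift-even (evenDeBruijn n)
evenDeBruijn zero    =
  record { d = d ; per = per ; inj = inj-from-range {n = 2} per (inj-by-codes 2 4 d codes) } evenly refl
  where
  d : ℕ → Bool
  d i = 1 <ᵇ i % 4
  per : ∀ i → d (i + 4) ≡ d i
  per i = cong (1 <ᵇ_) ([m+n]%n≡m%n i 4)
  codes : ∀ {i} → i < 4 → ∀ {j} → j < 4 → code 2 (from d i) ≡ code 2 (from d j) → i ≡ j
  codes = from-yes (distinct-codes? 2 4 d)

deBruijn : ∀ n → DeBruijn (suc n)
deBruijn (suc n) = EvenDeBruijn.cycle (evenDeBruijn n)
deBruijn zero    =
  record { d = d ; per = per ; inj = inj-from-range {n = 1} per (inj-by-codes 1 2 d codes) }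
  where
  d : ℕ → Bool
  d i = 0 <ᵇ i % 2
  per : ∀ i → d (i + 2) ≡ d i
  per i = cong (0 <ᵇ_) ([m+n]%n≡m%n i 2)
  codes : ∀ {i} → i < 2 → ∀ {j} → j < 2 → code 1 (from d i) ≡ code 1 (from d j) → i ≡ j
  codes = from-yes (distinct-codes? 1 2 d)

-- The cycles used for the blocks

-- `zeros` makes every segment begin with 0, since segment r begins at digit `d r`. `coprime` makes
-- the words read in steps of n distinct. The second case of `size` records that 0ⁿ is missing and
-- may be appended as a new word.
record Level (n : ℕ) : Set where
  field
    N g m N₁ : ℕ
    cycle    : Cycle n N
    n≡gm     : n ≡ g * m
    N≡gN₁    : N ≡ g * N₁
    coprime  : Coprime m N₁
    g²≤n     : g * g ≤ n
    2≤N      : 2 ≤ N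
  open Cycle cycle public
  field
    zeros    : ∀ r → r < g → d r ≡ false
    ones     : Σ ℕ λ i → Agree n (from d i) (λ _ → true)
    size     : (N ≡ 2 ^ n) ⊎ (suc N ≡ 2 ^ n × (∀ i → ¬ Agree n (from d i) (λ _ → false)))

-- Short cycles: the digit at position 0 of a de Bruijn sequence starting with 0ⁿ is left out.
module Shorten {k} (c : DeBruijn (suc (suc k))) {N} (sN : suc N ≡ 2 ^ suc (suc k))
               (zeros : ∀ e → e < suc (suc k) → Cycle.d c e ≡ false) where
  open Cycle c renaming (d to f; per to f-per; inj to f-inj)

  k<N : suc k < N
  k<N = +-cancelˡ-< 1 (suc k) N (subst (suc (suc k) <_) (sym sN) (n<2^n (suc (suc k))))

  instance
    N≢0 : NonZero N
    N≢0 = >-nonZero (≤-trans (s≤s z≤n) k<N)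

  d : ℕ → Bool
  d j = f (suc (j % N))

  per : ∀ j → d (j + N) ≡ d j
  per j = cong (f ∘ suc) ([m+n]%n≡m%n j N)

  d-low : ∀ j → j < N → d j ≡ f (suc j)
  d-low j j<N = cong (f ∘ suc) (m<n⇒m%n≡m j<N)

  -- A window that wraps around reads one 0 less of the run 0ⁿ at position 0, but only its zeros are affected.
  d-wrap : ∀ j → j < N + suc k → d j ≡ f (suc j)
  d-wrap j j< with j <? N
  ... | yes j<N = d-low j j<N
  ... | no j≮N with m≤n⇒∃[o]m+o≡n (≮⇒≥ j≮N)
  ...   | x , refl = begin
    d (N + x)            ≡⟨ cong d (+-comm N x) ⟩
    d (x + N)            ≡⟨ per x ⟩
    d x                  ≡⟨ d-low x (<-trans x< k<N) ⟩
    f (suc x)            ≡⟨ zeros (suc x) (s≤s x<) ⟩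
    false                ≡⟨ zeros x (m<n⇒m<1+n x<) ⟨
    f x                  ≡⟨ f-per x ⟨
    f (x + 2 ^ suc (suc k)) ≡⟨ cong (λ M → f (x + M)) sN ⟨
    f (x + suc N)        ≡⟨ cong f (+-comm x (suc N)) ⟩
    f (suc N + x)        ∎
    where
    open ≡-Reasoning
    x< : x < suc k
    x< = +-cancelˡ-< N x (suc k) j<

  window : ∀ i → i < N → Agree (suc (suc k)) (from d i) (from f (suc i))
  window i i<N e e< = d-wrap (i + e) (+-mono-≤ i<N (s≤s⁻¹ e<))

  no-clash : ∀ i j → suc i < suc N → j < suc N → Agree (suc (suc k)) (from f (suc i)) (from f j) → suc i ≡ j
  no-clash i j i< j< ag = ≈⇒≡ i< j< (subst (suc i ≈ j [_]) (sym sN) (f-inj (suc i) j ag))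

  inj : ∀ i j → Agree (suc (suc k)) (from d i) (from d j) → i ≈ j [ N ]
  inj = inj-from-range per (λ i j i< j< ag → ≈-reflexive (suc-injective (no-clash i (suc j) (s≤s i<) (s≤s j<)
    (λ e e< → trans (sym (window i i< e e<)) (trans (ag e e<) (window j j< e e<))))))

  no-zeros : ∀ i → ¬ Agree (suc (suc k)) (from d i) (λ _ → false)
  no-zeros i ag = 1+n≢0 (no-clash (i % N) 0 (s≤s (m%n<n i N)) (s≤s z≤n) (λ e e< → begin
    f (suc (i % N) + e)  ≡⟨ window (i % N) (m%n<n i N) e e< ⟨
    d (i % N + e)        ≡⟨ from-≈ per (≈-% i N) e ⟨
    d (i + e)            ≡⟨ ag e e< ⟩
    false                ≡⟨ zeros e e< ⟨
    f e                  ∎))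
    where open ≡-Reasoning

  -- The run 1ⁿ of `f` cannot sit at position 0, where 0ⁿ starts, so it survives the removal of that
  -- digit.
  ones : Σ ℕ λ i → Agree (suc (suc k)) (from d i) (λ _ → true)
  ones with occursIn c (λ _ → true)
  ... | zero , _ , ag = ⊥-elim (BP.not-¬ refl (trans (sym (zeros 0 (s≤s z≤n))) (ag 0 (s≤s z≤n))))
  ... | suc i , i< , ag = i , λ e e< → trans (window i (s≤s⁻¹ (subst (suc i <_) (sym sN) i<)) e e<) (ag e e<)

  cycle : Cycle (suc (suc k)) N
  cycle = record { d = d ; per = per ; inj = inj }

module _ (n N : ℕ) .{{_ : NonZero n}} where
  gcd≢0 : NonZero (gcd n N)
  gcd≢0 = ≢-nonZero (gcd[m,n]≢0 n N (inj₁ (≢-nonZero⁻¹ n)))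

  n/gcd : n ≡ gcd n N * (_/_ n (gcd n N) {{gcd≢0}})
  n/gcd = sym (m*[n/m]≡n {{gcd≢0}} (gcd[m,n]∣m n N))

  N/gcd : N ≡ gcd n N * (_/_ N (gcd n N) {{gcd≢0}})
  N/gcd = sym (m*[n/m]≡n {{gcd≢0}} (gcd[m,n]∣n n N))

-- The two gcds divide consecutive numbers, so they are coprime divisors of n.
gcd-product : ∀ n M N .{{_ : NonZero n}} → suc N ≡ M → gcd n M * gcd n N ≤ n
gcd-product n M N sN = subst (gcd n M * gcd n N ≤_) (sym (n/gcd n M))
  (*-monoʳ-≤ (gcd n M) (∣⇒≤ {{≢-nonZero q≢0}} (coprime-divisor {n = gcd n M} disjoint
    (subst (gcd n N ∣_) (n/gcd n M) (gcd[m,n]∣m n N)))))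
  where
  q≢0 : _/_ n (gcd n M) {{gcd≢0 n M}} ≢ 0
  q≢0 q≡0 = ≢-nonZero⁻¹ n (trans (n/gcd n M) (trans (cong (gcd n M *_) q≡0) (*-zeroʳ (gcd n M))))
  disjoint : Coprime (gcd n N) (gcd n M)
  disjoint (p , q) = ∣1⇒≡1 (∣m+n∣m⇒∣n (subst (_ ∣_) (trans (sym sN) (+-comm 1 N)) (∣-trans q (gcd[m,n]∣n n M)))
    (∣-trans p (gcd[m,n]∣n n N)))

-- The smaller of the two gcds has a square at most their product, and by hypothesis it cannot be
-- the first.
gcd-small : ∀ n M N .{{_ : NonZero n}} → suc N ≡ M → ¬ (gcd n M * gcd n M ≤ n) → gcd n N * gcd n N ≤ n
gcd-small n M N sN big with ≤-total (gcd n M) (gcd n N)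
... | inj₁ le = ⊥-elim (big (≤-trans (*-monoʳ-≤ (gcd n M) le) (gcd-product n M N sN)))
... | inj₂ ge = ≤-trans (*-monoˡ-≤ (gcd n N) ge) (gcd-product n M N sN)

m≤m² : ∀ m → m ≤ m * m
m≤m² zero    = z≤n
m≤m² (suc m) = m≤m+n (suc m) _

makeLevel : ∀ k → Level (suc k)
makeLevel k with occursIn (deBruijn k) (λ _ → false) | gcd (suc k) (2 ^ suc k) * gcd (suc k) (2 ^ suc k) ≤? suc k
... | i , _ , zeros | yes small = record
  { N = 2 ^ suc k ; g = gcd (suc k) (2 ^ suc k) ; m = _ ; N₁ = _
  ; cycle = c ; n≡gm = n/gcd (suc k) (2 ^ suc k) ; N≡gN₁ = N/gcd (suc k) (2 ^ suc k)
  ; coprime = coprime-/gcd (suc k) (2 ^ suc k) {{gcd≢0 (suc k) (2 ^ suc k)}}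
  ; g²≤n = small
  ; 2≤N = ≤-trans (*-monoʳ-≤ 2 (m^n>0 2 k)) ≤-refl
  ; zeros = λ r r< → zeros r (≤-trans r< (≤-trans (m≤m² _) small))
  ; ones = let (j , _ , ag) = occursIn c (λ _ → true) in j , ag
  ; size = inj₁ refl }
  where
  c : DeBruijn (suc k)
  c = rotate i (deBruijn k)
makeLevel zero | _ | no big = ⊥-elim (big (s≤s z≤n))
makeLevel (suc k) | i , _ , zeros | no big = record
  { N = N ; g = gcd (suc (suc k)) N ; m = _ ; N₁ = _
  ; cycle = S.cycle ; n≡gm = n/gcd (suc (suc k)) N ; N≡gN₁ = N/gcd (suc (suc k)) N
  ; coprime = coprime-/gcd (suc (suc k)) N {{gcd≢0 (suc (suc k)) N}}
  ; g²≤n = small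
  ; 2≤N = ≤-trans (s≤s (s≤s z≤n)) S.k<N
  ; zeros = λ r r< → trans (S.d-low r (<-trans (≤-trans r< g≤) S.k<N)) (zeros (suc r) (s≤s (≤-trans r< g≤)))
  ; ones = S.ones
  ; size = inj₂ (sN , S.no-zeros) }
  where
  N : ℕ
  N = pred (2 ^ suc (suc k))
  sN : suc N ≡ 2 ^ suc (suc k)
  sN = suc-pred (2 ^ suc (suc k)) {{m^n≢0 2 (suc (suc k))}}
  module S = Shorten (rotate i (deBruijn (suc k))) sN zeros
  small : gcd (suc (suc k)) N * gcd (suc (suc k)) N ≤ suc (suc k)
  small = gcd-small (suc (suc k)) (2 ^ suc (suc k)) N sN big
  -- Only n - 1 zeros of the run are left in the shortened cycle, so g < n is needed; it follows
  -- from g² ≤ n because n ≥ 2.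
  g≤ : gcd (suc (suc k)) N ≤ suc k
  g≤ = bound (gcd (suc (suc k)) N) small
    where
    bound : ∀ g → g * g ≤ suc (suc k) → g ≤ suc k
    bound zero          _  = z≤n
    bound (suc zero)    _  = s≤s z≤n
    bound (suc (suc g)) le = s≤s⁻¹ (≤-trans (s≤s (s≤s (s≤s (≤-trans (m≤n+m g (suc g)) (≤-reflexive refl))))) (≤-trans lem le))
      where
      lem : suc (suc (suc (suc g + g))) ≤ suc (suc g) * suc (suc g)
      lem = slack (g * g + 2 * g) (eq g)
        where
        eq : ∀ g → suc (suc (suc (suc g + g))) + (g * g + 2 * g) ≡ suc (suc g) * suc (suc g)
        eq = solve-∀

-- Block k consists of the words of length k + 1.
abstract
  level : ∀ k → Level (suc k)
  level = makeLevel

module Lv (k : ℕ) = Level (level k)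

-- The sequence

len : ℕ → ℕ
len k = suc k * 2 ^ suc k

st : ℕ → ℕ
st zero    = 0
st (suc k) = st k + len k

len>0 : ∀ k → 0 < len k
len>0 k = *-mono-≤ {1} {suc k} {1} (s≤s z≤n) (m^n>0 2 (suc k))

-- Length of a segment: `m` turns of the cycle.
Z : ℕ → ℕ
Z k = Lv.m k * Lv.N k

N>0 : ∀ k → 0 < Lv.N k
N>0 k = ≤-trans (s≤s z≤n) (Lv.2≤N k)

m>0 : ∀ k → 0 < Lv.m k
m>0 k = n≢0⇒n>0 λ m≡0 → 1+n≢0 (trans (Lv.n≡gm k) (trans (cong (Lv.g k *_) m≡0) (*-zeroʳ (Lv.g k))))

g>0 : ∀ k → 0 < Lv.g k
g>0 k = n≢0⇒n>0 λ g≡0 → 1+n≢0 (trans (Lv.n≡gm k) (cong (_* Lv.m k) g≡0))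

N₁>0 : ∀ k → 0 < Lv.N₁ k
N₁>0 k = n≢0⇒n>0 λ z → <⇒≢ (N>0 k) (sym (trans (Lv.N≡gN₁ k) (trans (cong (Lv.g k *_) z) (*-zeroʳ (Lv.g k)))))

instance
  N≢0 : ∀ {k} → NonZero (Lv.N k)
  N≢0 {k} = >-nonZero (N>0 k)
  N₁≢0 : ∀ {k} → NonZero (Lv.N₁ k)
  N₁≢0 {k} = >-nonZero (N₁>0 k)
  g≢0 : ∀ {k} → NonZero (Lv.g k)
  g≢0 {k} = >-nonZero (g>0 k)
  Z≢0 : ∀ {k} → NonZero (Z k)
  Z≢0 {k} = >-nonZero (*-mono-≤ {1} {Lv.m k} {1} (m>0 k) (N>0 k))

N≤Z : ∀ k → Lv.N k ≤ Z k
N≤Z k = m≤n*m (Lv.N k) (Lv.m k) {{>-nonZero (m>0 k)}}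

gZ≡nN : ∀ k → Lv.g k * Z k ≡ suc k * Lv.N k
gZ≡nN k = trans (sym (*-assoc (Lv.g k) (Lv.m k) (Lv.N k))) (cong (_* Lv.N k) (sym (Lv.n≡gm k)))

len-cases : ∀ k → len k ≡ Lv.g k * Z k ⊎ len k ≡ Lv.g k * Z k + suc k
len-cases k with Lv.size k
... | inj₁ N≡     = inj₁ (trans (cong (suc k *_) (sym N≡)) (sym (gZ≡nN k)))
... | inj₂ (sN , _) = inj₂ (trans (cong (suc k *_) (sym sN)) (trans (*-suc (suc k) (Lv.N k))
      (trans (+-comm (suc k) _) (cong (_+ suc k) (sym (gZ≡nN k))))))

gZ≤len : ∀ k → Lv.g k * Z k ≤ len k
gZ≤len k with len-cases k
... | inj₁ eq = ≤-reflexive (sym eq)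
... | inj₂ eq = ≤-trans (m≤m+n _ _) (≤-reflexive (sym eq))

-- `Z k` is a multiple of `N`, so after `q / Z k` segments the cycle is back at its start except for
-- one skipped digit per segment. The `false` branch is the appended 0ⁿ.
block : ℕ → ℕ → Bool
block k q = if q <ᵇ Lv.g k * Z k then Lv.d k (q % Z k + q / Z k) else false

-- loc p = (k , q) means that p is position q of block k.
advance : ℕ × ℕ → ℕ × ℕ
advance (k , q) = if suc q <ᵇ len k then (k , suc q) else (suc k , 0)

loc : ℕ → ℕ × ℕ
loc zero    = 0 , 0
loc (suc p) = advance (loc p)

S : Seq
S p = block (proj₁ (loc p)) (proj₂ (loc p))

advance-stay : ∀ k q → suc q < len k → advance (k , q) ≡ (k , suc q)
advance-stay k q lt with suc q <ᵇ len k | <⇒<ᵇ lt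
... | true | _ = refl

advance-next : ∀ k q → suc q ≡ len k → advance (k , q) ≡ (suc k , 0)
advance-next k q eq with suc q <ᵇ len k | <ᵇ⇒< (suc q) (len k)
... | true  | lt = ⊥-elim (<-irrefl eq (lt _))
... | false | _  = refl

loc-st : ∀ k q → q < len k → loc (st k + q) ≡ (k , q)
loc-st zero    zero    _ = refl
loc-st (suc k) zero    _ = begin
  loc (st k + len k + 0)                 ≡⟨ cong loc (+-identityʳ (st k + len k)) ⟩
  loc (st k + len k)                     ≡⟨ cong (λ l → loc (st k + l)) (sym suc-pred-len) ⟩
  loc (st k + suc (pred (len k)))        ≡⟨ cong loc (+-suc (st k) (pred (len k))) ⟩
  advance (loc (st k + pred (len k)))    ≡⟨ cong advance (loc-st k (pred (len k)) (≤-reflexive suc-pred-len)) ⟩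
  advance (k , pred (len k))             ≡⟨ advance-next k (pred (len k)) suc-pred-len ⟩
  (suc k , 0)                            ∎
  where
  open ≡-Reasoning
  suc-pred-len : suc (pred (len k)) ≡ len k
  suc-pred-len = suc-pred (len k) {{>-nonZero (len>0 k)}}
loc-st k (suc q) q<    = trans (cong loc (+-suc (st k) q))
  (trans (cong advance (loc-st k q (<-trans (n<1+n q) q<))) (advance-stay k q q<))

S-block : ∀ k q → q < len k → S (st k + q) ≡ block k q
S-block k q q< = cong (λ (j , r) → block j r) (loc-st k q q<)

record Position (p : ℕ) : Set where
  constructor position
  field
    k q : ℕ
    q<  : q < len k
    at  : p ≡ st k + q

locate : ∀ p → Position p
locate zero    = position 0 0 (len>0 0) refl
locate (suc p) with locate p
... | position k q q< refl with m≤n⇒m<n∨m≡n q<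
...   | inj₁ lt = position k (suc q) lt (sym (+-suc (st k) q))
...   | inj₂ eq = position (suc k) 0 (len>0 (suc k)) (trans (sym (+-suc (st k) q))
          (trans (cong (st k +_) eq) (sym (+-identityʳ _))))

divide : ∀ q M .{{_ : NonZero M}} → Σ ℕ λ r → Σ ℕ λ o → o < M × q ≡ r * M + o
divide q M = q / M , q % M , m%n<n q M , trans (m≡m%n+[m/n]*n q M) (+-comm (q % M) _)

*+< : ∀ {r g o M} → r < g → o < M → r * M + o < g * M
*+< {r} {g} {o} {M} r<g o<M = ≤-trans (+-monoʳ-< (r * M) o<M) (≤-trans (≤-reflexive (+-comm (r * M) M)) (*-monoˡ-≤ M r<g))

*+<⁻¹ : ∀ {r g o M} → r * M + o < g * M → r < g
*+<⁻¹ {r} {g} {o} {M} lt = *-cancelʳ-< M r g (≤-<-trans (m≤m+n (r * M) o) lt)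

block-segment : ∀ k r o → r < Lv.g k → o < Z k → block k (r * Z k + o) ≡ Lv.d k (o + r)
block-segment k r o r<g o<Z with r * Z k + o <ᵇ Lv.g k * Z k | <⇒<ᵇ (*+< r<g o<Z)
... | true | _ = cong (Lv.d k) (cong₂ _+_
  (trans (cong (_% Z k) (+-comm (r * Z k) o)) (trans ([m+kn]%n≡m%n o r (Z k)) (m<n⇒m%n≡m o<Z)))
  (trans (+-distrib-/-∣ˡ o (n∣m*n r)) (trans (cong₂ _+_ (m*n/n≡m r (Z k)) (m<n⇒m/n≡0 o<Z)) (+-identityʳ r))))

block-tail : ∀ k q → Lv.g k * Z k ≤ q → block k q ≡ false
block-tail k q le with q <ᵇ Lv.g k * Z k | <ᵇ⇒< q (Lv.g k * Z k)
... | true  | lt = ⊥-elim (<⇒≱ (lt _) le)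
... | false | _  = refl

S-segment : ∀ k r o → r < Lv.g k → o < Z k → S (st k + (r * Z k + o)) ≡ Lv.d k (o + r)
S-segment k r o r<g o<Z = trans (S-block k _ (≤-trans (*+< r<g o<Z) (gZ≤len k))) (block-segment k r o r<g o<Z)

-- The end r = g is included: there begins either the appended 0ⁿ or the next block, and both start
-- with 0.
S-segment-start : ∀ k r → r ≤ Lv.g k → S (st k + r * Z k) ≡ false
S-segment-start k r r≤g with m≤n⇒m<n∨m≡n r≤g
... | inj₁ r<g = trans (cong (λ q → S (st k + q)) (sym (+-identityʳ _)))
      (trans (S-segment k r 0 r<g (>-nonZero⁻¹ (Z k))) (Lv.zeros k r r<g))
... | inj₂ refl with len-cases k
...   | inj₂ eq = trans (S-block k _ (≤-trans (m<m+n _ (s≤s z≤n)) (≤-reflexive (sym eq)))) (block-tail k _ ≤-refl)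
...   | inj₁ eq = trans (cong S (trans (cong (st k +_) (sym eq)) (sym (+-identityʳ _))))
      (trans (S-segment (suc k) 0 0 (g>0 (suc k)) (>-nonZero⁻¹ (Z (suc k)))) (Lv.zeros (suc k) 0 (g>0 (suc k))))

st-mono : ∀ {j k} → j ≤ k → st j ≤ st k
st-mono {j} {k} j≤k with m≤n⇒∃[o]m+o≡n j≤k
... | o , refl = go j o
  where
  go : ∀ j o → st j ≤ st (j + o)
  go j zero    = ≤-reflexive (cong st (sym (+-identityʳ j)))
  go j (suc o) = ≤-trans (go j o) (≤-trans (m≤m+n _ _) (≤-reflexive (cong st (sym (+-suc j o)))))

position-< : ∀ {j k q} → st j + q < st k → j < k
position-< {j} {k} {q} lt = ≰⇒> λ k≤j → <⇒≱ (≤-<-trans (m≤m+n (st j) q) lt) (st-mono k≤j)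

¬N∣1 : ∀ k i → ¬ i + 1 ≈ i [ Lv.N k ]
¬N∣1 k i c = <⇒≢ (Lv.2≤N k) (sym (∣1⇒≡1 (≈⇒∣ c)))

-- Each segment and each block starts with the digit 0, so a run of 1s lies inside a single segment of
-- some block j; there it is too long to fit before st k.
no-early-ones : ∀ k p → p < st k → ¬ Agree (suc k) (from S p) (λ _ → true)
no-early-ones k p p<st run with locate p
... | position j q q< refl with divide q (Z j)
... | r , o , o<Z , refl with r <? Lv.g j
... | no r≮g = BP.not-¬ refl (trans (sym (trans (S-block j _ q<) (block-tail j _
      (≤-trans (*-monoˡ-≤ (Z j) (≮⇒≥ r≮g)) (m≤m+n _ o))))) (trans (cong S (sym (+-identityʳ (st j + (r * Z j + o))))) (run 0 (s≤s z≤n))))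
... | yes r<g with o + suc (suc j) ≤? Z j
-- Here j + 2 ones lie inside the segment, so two windows one digit apart both consist of j + 1
-- ones, and injectivity would make N divide 1.
... | yes inside = ¬N∣1 j (o + r) (≈-sym (Lv.inj j (o + r) (o + r + 1)
      (λ e e< → trans (ones e (m<n⇒m<1+n e<))
        (sym (trans (cong (Lv.d j) (trans (+-assoc (o + r) 1 e) refl)) (ones (suc e) (s≤s e<)))))))
  where
  j<k : j < k
  j<k = position-< p<st
  ones : ∀ e → e < suc (suc j) → Lv.d j (o + r + e) ≡ true
  ones e e< = begin
    Lv.d j (o + r + e)                    ≡⟨ cong (Lv.d j) (shuffle o r e) ⟩
    Lv.d j (o + e + r)                    ≡⟨ S-segment j r (o + e) r<g (≤-trans (+-monoʳ-< o e<) inside) ⟨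
    S (st j + (r * Z j + (o + e)))        ≡⟨ cong S (reassoc (st j) (r * Z j) o e) ⟩
    S (st j + (r * Z j + o) + e)          ≡⟨ run e (≤-trans e< (s≤s j<k)) ⟩
    true                                  ∎
    where
    open ≡-Reasoning
    shuffle : ∀ o r e → o + r + e ≡ o + e + r
    shuffle = solve-∀
    reassoc : ∀ s z o e → s + (z + (o + e)) ≡ s + (z + o) + e
    reassoc = solve-∀
... | no outside = BP.not-¬ refl (trans (sym (S-segment-start j (suc r) r<g))
      (trans (cong S next-start) (run (Z j ∸ o) e<)))
  where
  e< : Z j ∸ o < suc k
  e< = ≤-trans (+-cancelˡ-< o _ _ (subst (_< o + suc (suc j)) (sym (m+[n∸m]≡n (<⇒≤ o<Z))) (≰⇒> outside)))
    (s≤s (position-< p<st))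
  next-start : st j + suc r * Z j ≡ st j + (r * Z j + o) + (Z j ∸ o)
  next-start = trans (cong (st j +_) (trans (+-comm (Z j) (r * Z j)) (trans (cong (r * Z j +_) (sym (m+[n∸m]≡n (<⇒≤ o<Z))))
    (sym (+-assoc (r * Z j) o _))))) (sym (+-assoc (st j) _ _))

-- The consecutive words of length n that make up a block

N₁n≡Z : ∀ k → Lv.N₁ k * suc k ≡ Z k
N₁n≡Z k = begin
  Lv.N₁ k * suc k              ≡⟨ cong (Lv.N₁ k *_) (Lv.n≡gm k) ⟩
  Lv.N₁ k * (Lv.g k * Lv.m k)  ≡⟨ rearrange (Lv.N₁ k) (Lv.g k) (Lv.m k) ⟩
  Lv.m k * (Lv.g k * Lv.N₁ k)  ≡⟨ cong (Lv.m k *_) (Lv.N≡gN₁ k) ⟨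
  Z k                          ∎
  where
  open ≡-Reasoning
  rearrange : ∀ a b c → a * (b * c) ≡ c * (b * a)
  rearrange = solve-∀

chunk : ℕ → ℕ → ℕ → Bool
chunk k q = from (block k) (q * suc k)

chunk-window : ∀ k r i → r < Lv.g k → i < Lv.N₁ k →
  Agree (suc k) (chunk k (r * Lv.N₁ k + i)) (from (Lv.d k) (i * suc k + r))
chunk-window k r i r<g i<N₁ e e< = begin
  block k ((r * Lv.N₁ k + i) * suc k + e)      ≡⟨ cong (block k) (expand r (Lv.N₁ k) i (suc k) e) ⟩
  block k (r * (Lv.N₁ k * suc k) + (i * suc k + e))
                                               ≡⟨ cong (λ z → block k (r * z + (i * suc k + e))) (N₁n≡Z k) ⟩
  block k (r * Z k + (i * suc k + e))          ≡⟨ block-segment k r _ r<g (subst (i * suc k + e <_) (N₁n≡Z k) (*+< i<N₁ e<)) ⟩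
  Lv.d k (i * suc k + e + r)                   ≡⟨ cong (Lv.d k) (shuffle (i * suc k) e r) ⟩
  Lv.d k (i * suc k + r + e)                   ∎
  where
  open ≡-Reasoning
  expand : ∀ r N i n e → (r * N + i) * n + e ≡ r * (N * n) + (i * n + e)
  expand = solve-∀
  shuffle : ∀ o r e → o + r + e ≡ o + e + r
  shuffle = solve-∀

-- The start i n + r determines r modulo g, because g divides n and N. Cancelling r and the factor g
-- leaves m i modulo N₁, which determines i because m and N₁ are coprime.
offsets-distinct : ∀ k r i r′ i′ → r < Lv.g k → i < Lv.N₁ k → r′ < Lv.g k → i′ < Lv.N₁ k →
  i * suc k + r ≈ i′ * suc k + r′ [ Lv.N k ] → r * Lv.N₁ k + i ≡ r′ * Lv.N₁ k + i′
offsets-distinct k r i r′ i′ r<g i< r′<g i′< c = cong₂ (λ r i → r * Lv.N₁ k + i) r≡r′ (≈⇒≡ i< i′<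
  (≈-coprime (Lv.coprime k) (≈-cancel-* (Lv.g k) (subst (Lv.g k * (Lv.m k * i) ≈ Lv.g k * (Lv.m k * i′) [_]) (Lv.N≡gN₁ k)
    (subst₂ (_≈_[ Lv.N k ]) (factor i) (factor i′) (≈-cancel-+ r
      (subst₂ (_≈_[ Lv.N k ]) (+-comm _ r) (trans (+-comm _ r′) (cong (_+ i′ * suc k) (sym r≡r′))) c)))))))
  where
  factor : ∀ i → i * suc k ≡ Lv.g k * (Lv.m k * i)
  factor i = trans (cong (i *_) (Lv.n≡gm k)) (rearrange i (Lv.g k) (Lv.m k))
    where
    rearrange : ∀ i g m → i * (g * m) ≡ g * (m * i)
    rearrange = solve-∀
  absorb : ∀ i r → r ≈ i * suc k + r [ Lv.g k ]
  absorb i r = shifts (i * Lv.m k) 0 (trans (cong (r +_) (trans (rearrange i (Lv.m k) (Lv.g k)) (sym (factor i))))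
    (trans (+-comm r _) (sym (+-identityʳ _))))
    where
    rearrange : ∀ i m g → i * m * g ≡ g * (m * i)
    rearrange = solve-∀
  r≡r′ : r ≡ r′
  r≡r′ = ≈⇒≡ r<g r′<g (≈-trans (absorb i r) (≈-trans (≈-∣ (Lv.N₁ k) (Lv.N≡gN₁ k) c) (≈-sym (absorb i′ r′))))

private
  split-index : ∀ k q → q < Lv.N k → Σ ℕ λ r → Σ ℕ λ i → r < Lv.g k × i < Lv.N₁ k × q ≡ r * Lv.N₁ k + i
  split-index k q q<N with divide q (Lv.N₁ k)
  ... | r , i , i< , refl = r , i , *+<⁻¹ {o = i} (subst (r * Lv.N₁ k + i <_) (Lv.N≡gN₁ k) q<N) , i< , refl

chunk-last : ∀ k e → chunk k (Lv.N k) e ≡ false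
chunk-last k e = block-tail k _ (≤-trans (≤-reflexive (trans (gZ≡nN k) (*-comm (suc k) _))) (m≤m+n _ e))

-- The only index left for j is `N` itself, the appended 0ⁿ, and this is not a window of the
-- shortened cycle.
chunk-last-new : ∀ k i j → i < Lv.N k → ¬ j < Lv.N k → j < 2 ^ suc k → ¬ Agree (suc k) (chunk k i) (chunk k j)
chunk-last-new k i j i<N j≮N j< ag with Lv.size k | split-index k i i<N
... | inj₁ N≡ | _ = j≮N (subst (j <_) (sym N≡) j<)
... | inj₂ (sN , nz) | r , a , r< , a< , refl = nz (a * suc k + r) (λ e e< →
  trans (sym (chunk-window k r a r< a< e e<)) (trans (ag e e<)
    (trans (cong (λ j → chunk k j e) (≤-antisym (s≤s⁻¹ (subst (j <_) (sym sN) j<)) (≮⇒≥ j≮N))) (chunk-last k e))))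

chunk-injective : ∀ k i j → i < 2 ^ suc k → j < 2 ^ suc k → Agree (suc k) (chunk k i) (chunk k j) → i ≡ j
chunk-injective k i j i< j< ag with i <? Lv.N k | j <? Lv.N k
... | yes i<N | yes j<N = inside (split-index k i i<N) (split-index k j j<N)
  where
  inside : _ → _ → i ≡ j
  inside (r , a , r< , a< , refl) (r′ , b , r′< , b< , refl) = offsets-distinct k r a r′ b r< a< r′< b<
    (Lv.inj k _ _ (λ e e< → trans (sym (chunk-window k r a r< a< e e<)) (trans (ag e e<) (chunk-window k r′ b r′< b< e e<))))
... | no i≮N | no j≮N = trans (last i≮N i<) (sym (last j≮N j<))
  where
  last : ∀ {i} → ¬ i < Lv.N k → i < 2 ^ suc k → i ≡ Lv.N k
  last {i} i≮N i< with Lv.size k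
  ... | inj₁ N≡ = ⊥-elim (i≮N (subst (i <_) (sym N≡) i<))
  ... | inj₂ (sN , _) = ≤-antisym (s≤s⁻¹ (subst (i <_) (sym sN) i<)) (≮⇒≥ i≮N)
... | yes i<N | no j≮N = ⊥-elim (chunk-last-new k i j i<N j≮N j< ag)
... | no i≮N | yes j<N = ⊥-elim (chunk-last-new k j i j<N i≮N i< (λ e e< → sym (ag e e<)))

chunk-surjective : ∀ k w → Σ ℕ λ q → q < 2 ^ suc k × Agree (suc k) (chunk k q) w
chunk-surjective k = every-word-occurs (suc k) (chunk k) (chunk-injective k)

-- Lempel–Ziv 78

win : (ℕ → Bool) → ℕ → ℕ → Bits
win f a zero    = []
win f a (suc k) = f a ∷ win f (suc a) k

length-win : ∀ f a k → length (win f a k) ≡ k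
length-win f a zero    = refl
length-win f a (suc k) = cong suc (length-win f (suc a) k)

win-cong : ∀ {f g} a b k → Agree k (from f a) (from g b) → win f a k ≡ win g b k
win-cong a b zero    ag = refl
win-cong {f} {g} a b (suc k) ag = cong₂ _∷_
  (subst₂ (λ x y → f x ≡ g y) (+-identityʳ a) (+-identityʳ b) (ag 0 (s≤s z≤n)))
  (win-cong (suc a) (suc b) k (λ e e< → subst₂ (λ x y → f x ≡ g y) (+-suc a e) (+-suc b e) (ag (suc e) (s≤s e<))))

win-agree : ∀ {f g} a b k → win f a k ≡ win g b k → Agree k (from f a) (from g b)
win-agree {f} {g} a b (suc k) eq zero    _  =
  subst₂ (λ x y → f x ≡ g y) (sym (+-identityʳ a)) (sym (+-identityʳ b)) (proj₁ (∷-injective eq))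
win-agree {f} {g} a b (suc k) eq (suc e) e< = subst₂ (λ x y → f x ≡ g y) (sym (+-suc a e)) (sym (+-suc b e))
  (win-agree (suc a) (suc b) k (proj₂ (∷-injective eq)) e (s≤s⁻¹ e<))

win-++ : ∀ f a j k → win f a (j + k) ≡ win f a j ++ win f (a + j) k
win-++ f a zero    k = cong (λ b → win f b k) (sym (+-identityʳ a))
win-++ f a (suc j) k = cong (f a ∷_) (trans (win-++ f (suc a) j k)
  (cong (λ b → win f (suc a) j ++ win f b k) (sym (+-suc a j))))

win-∷ʳ : ∀ f a k → win f a (suc k) ≡ win f a k ∷ʳ f (a + k)
win-∷ʳ f a k = trans (cong (win f a) (+-comm 1 k)) (win-++ f a k 1)

↾-win : ∀ f m → f ↾ m ≡ win f 0 m
↾-win f zero    = refl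
↾-win f (suc m) = trans (cong (_∷ʳ f m) (↾-win f m)) (sym (win-∷ʳ f 0 m))

↾-+ : ∀ f m k → f ↾ (m + k) ≡ f ↾ m ++ win f m k
↾-+ f m k = trans (↾-win f (m + k)) (trans (win-++ f 0 m k) (cong (_++ win f m k) (sym (↾-win f m))))

digit : Bits → ℕ → Bool
digit []      _       = false
digit (a ∷ w) zero    = a
digit (a ∷ w) (suc e) = digit w e

win-shift : ∀ f a k → win f (suc a) k ≡ win (f ∘ suc) a k
win-shift f a zero    = refl
win-shift f a (suc k) = cong (f (suc a) ∷_) (win-shift f (suc a) k)

win-digit : ∀ w → win (digit w) 0 (length w) ≡ w
win-digit []      = refl
win-digit (a ∷ w) = cong (a ∷_) (trans (win-shift (digit (a ∷ w)) 0 (length w)) (win-digit w))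

==-refl : ∀ w → (w == w) ≡ true
==-refl w with ≡-dec BP._≟_ w w
... | yes _ = refl
... | no ≢ = ⊥-elim (≢ refl)

elemᵇ⇒∈ : ∀ w D → elemᵇ w D ≡ true → w ∈ D
elemᵇ⇒∈ w (v ∷ D) eq with ≡-dec BP._≟_ w v
... | yes refl = here refl
... | no _     = there (elemᵇ⇒∈ w D eq)

∈⇒elemᵇ : ∀ {w D} → w ∈ D → elemᵇ w D ≡ true
∈⇒elemᵇ {w} (here refl) rewrite ==-refl w = refl
∈⇒elemᵇ {w} {v ∷ D} (there w∈D) rewrite ∈⇒elemᵇ w∈D = BP.∨-zeroʳ (w == v)

∉⇒elemᵇ : ∀ {w D} → ¬ w ∈ D → elemᵇ w D ≡ false
∉⇒elemᵇ {w} {D} w∉D = BP.¬-not (λ eq → w∉D (elemᵇ⇒∈ w D eq))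

phrases : List Bits → Bits → Bits → ℕ
phrases D u x = length (lzParse D u x)

phrases-known : ∀ D u b x → (u ∷ʳ b) ∈ D → phrases D u (b ∷ x) ≡ phrases D (u ∷ʳ b) x
phrases-known D []      b x ∈D rewrite ∈⇒elemᵇ ∈D = refl
phrases-known D (a ∷ u) b x ∈D rewrite ∈⇒elemᵇ ∈D = refl

phrases-new : ∀ D u b x → ¬ (u ∷ʳ b) ∈ D → phrases D u (b ∷ x) ≡ suc (phrases (D ∷ʳ (u ∷ʳ b)) [] x)
phrases-new D []      b x ∉D rewrite ∉⇒elemᵇ ∉D = refl
phrases-new D (a ∷ u) b x ∉D rewrite ∉⇒elemᵇ ∉D = refl

-- All nonempty proper prefixes are phrases already and the word itself is not, so the parser takes
-- exactly this word; `u` is the part read so far.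
phrases-chunk : ∀ D n u v x → length (u ++ v) ≡ n → 0 < length v →
  (∀ w → 0 < length w → length w < n → w ∈ D) → ¬ (u ++ v) ∈ D →
  phrases D u (v ++ x) ≡ suc (phrases (D ∷ʳ (u ++ v)) [] x)
phrases-chunk D n u (b ∷ [])    x len _ known new = phrases-new D u b x new
phrases-chunk D n u (b ∷ c ∷ v) x len _ known new = begin
  phrases D u (b ∷ c ∷ v ++ x)                        ≡⟨ phrases-known D u b _ (known _ nonempty short) ⟩
  phrases D (u ∷ʳ b) (c ∷ v ++ x)                     ≡⟨ phrases-chunk D n (u ∷ʳ b) (c ∷ v) x
                                                           (trans (cong length assoc) len) (s≤s z≤n) known (new ∘ subst (_∈ D) assoc) ⟩
  suc (phrases (D ∷ʳ ((u ∷ʳ b) ++ c ∷ v)) [] x)       ≡⟨ cong (λ w → suc (phrases (D ∷ʳ w) [] x)) assoc ⟩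
  suc (phrases (D ∷ʳ (u ++ b ∷ c ∷ v)) [] x)          ∎
  where
  open ≡-Reasoning
  assoc : (u ∷ʳ b) ++ c ∷ v ≡ u ++ b ∷ c ∷ v
  assoc = ++-assoc u (b ∷ []) (c ∷ v)
  length-∷ʳ : length (u ∷ʳ b) ≡ suc (length u)
  length-∷ʳ = trans (length-++ u) (+-comm (length u) 1)
  nonempty : 0 < length (u ∷ʳ b)
  nonempty = ≤-trans (s≤s z≤n) (≤-reflexive (sym length-∷ʳ))
  short : length (u ∷ʳ b) < n
  short = ≤-trans (s≤s (≤-trans (≤-reflexive length-∷ʳ) (≤-trans (s≤s (m≤m+n (length u) (length v)))
    (≤-reflexive (sym (+-suc (length u) (length v))))))) (≤-reflexive (trans (sym (+-suc (length u) (suc (length v))))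
    (trans (sym (length-++ u)) len)))

phrases-partial : ∀ D n u v → length (u ++ v) < n → (∀ w → 0 < length w → length w < n → w ∈ D) →
  phrases D u v ≡ pos (length (u ++ v))
phrases-partial D n []      []      _  _     = refl
phrases-partial D n (a ∷ u) []      _  _     = refl
phrases-partial D n u       (b ∷ v) le known = trans
  (phrases-known D u b v (known _ (≤-trans (s≤s z≤n) (≤-reflexive (sym (trans (length-++ u) (+-comm (length u) 1)))))
    (≤-<-trans (≤-trans (m≤m+n _ (length v)) (≤-reflexive (sym (length-++ (u ∷ʳ b))))) (subst (_< n) (cong length (sym assoc)) le))))
  (trans (phrases-partial D n (u ∷ʳ b) v (subst (_< n) (cong length (sym assoc)) le) known) (cong (pos ∘ length) assoc))
  where
  assoc : (u ∷ʳ b) ++ v ≡ u ++ b ∷ v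
  assoc = ++-assoc u (b ∷ []) v

chunkWord : ℕ → ℕ → Bits
chunkWord k q = win (block k) (q * suc k) (suc k)

-- The dictionary after q words of block k. A block starts with what the previous one left, hence
-- the clause that passes from `suc k` to the full dictionary of `k`.
dict : ℕ → ℕ → List Bits
dict zero    zero    = []
dict (suc k) zero    = dict k (2 ^ suc k)
dict k       (suc q) = dict k q ∷ʳ chunkWord k q

dict-suc : ∀ k q → dict k (suc q) ≡ dict k q ∷ʳ chunkWord k q
dict-suc zero    q = refl
dict-suc (suc k) q = refl

∈-dict : ∀ k q {w} → w ∈ dict k q → length w ≤ k ⊎ (Σ ℕ λ q′ → q′ < q × w ≡ chunkWord k q′)
∈-dict (suc k) zero w∈ with ∈-dict k (2 ^ suc k) w∈
... | inj₁ le           = inj₁ (m≤n⇒m≤1+n le)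
... | inj₂ (q , _ , eq) = inj₁ (≤-reflexive (trans (cong length eq) (length-win _ _ (suc k))))
∈-dict k (suc q) {w} w∈ with ∈-++⁻ (dict k q) (subst (w ∈_) (dict-suc k q) w∈)
... | inj₂ (here eq) = inj₂ (q , ≤-refl , eq)
... | inj₁ w∈′ with ∈-dict k q w∈′
...   | inj₁ le             = inj₁ le
...   | inj₂ (q′ , q′< , eq) = inj₂ (q′ , m<n⇒m<1+n q′< , eq)

chunk∈dict : ∀ k q q′ → q′ < q → chunkWord k q′ ∈ dict k q
chunk∈dict k (suc q) q′ q′< with m≤n⇒m<n∨m≡n (s≤s⁻¹ q′<)
... | inj₁ lt   = subst (chunkWord k q′ ∈_) (sym (dict-suc k q)) (∈-++⁺ˡ (chunk∈dict k q q′ lt))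
... | inj₂ refl = subst (chunkWord k q ∈_) (sym (dict-suc k q)) (∈-++⁺ʳ (dict k q) (here refl))

word-is-chunk : ∀ k w → length w ≡ suc k → Σ ℕ λ q → q < 2 ^ suc k × w ≡ chunkWord k q
word-is-chunk k w len with chunk-surjective k (digit w)
... | q , q< , ag = q , q< , (begin
  w                          ≡⟨ win-digit w ⟨
  win (digit w) 0 (length w) ≡⟨ cong (win (digit w) 0) len ⟩
  win (digit w) 0 (suc k)    ≡⟨ win-cong 0 (q * suc k) (suc k) (λ e e< → sym (ag e e<)) ⟩
  chunkWord k q              ∎)
  where open ≡-Reasoning

dict-complete : ∀ k q w → 0 < length w → length w ≤ k → w ∈ dict k q
dict-complete (suc k) zero w 0< le with m≤n⇒m<n∨m≡n le
... | inj₁ lt = dict-complete k (2 ^ suc k) w 0< (s≤s⁻¹ lt)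
... | inj₂ eq with word-is-chunk k w eq
...   | q , q< , refl = chunk∈dict k (2 ^ suc k) q q<
dict-complete zero zero w 0< le = ⊥-elim (<⇒≱ 0< le)
dict-complete k (suc q) w 0< le = subst (w ∈_) (sym (dict-suc k q)) (∈-++⁺ˡ (dict-complete k q w 0< le))

chunk∉dict : ∀ k q → q < 2 ^ suc k → ¬ chunkWord k q ∈ dict k q
chunk∉dict k q q< ∈D with ∈-dict k q ∈D
... | inj₁ le = 1+n≰n (subst (_≤ k) (length-win _ _ (suc k)) le)
... | inj₂ (q′ , q′< , eq) = <⇒≢ q′< (chunk-injective k q′ q (<-trans q′< q<) q<
      (λ e e< → sym (win-agree (q * suc k) (q′ * suc k) (suc k) eq e e<)))

chunk-fits : ∀ k q e → q < 2 ^ suc k → e < suc k → q * suc k + e < len k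
chunk-fits k q e q< e< = ≤-trans (*+< q< e<) (≤-reflexive (*-comm (2 ^ suc k) (suc k)))

S-chunk : ∀ k q j → q < 2 ^ suc k → j ≤ suc k → win S (st k + q * suc k) j ≡ win (block k) (q * suc k) j
S-chunk k q j q< j≤ = win-cong _ _ j (λ e e< → trans (cong S (+-assoc (st k) _ e))
  (S-block k _ (chunk-fits k q e q< (≤-trans e< j≤))))

ph : ℕ → ℕ
ph zero    = 0
ph (suc k) = ph k + 2 ^ suc k

ph-2^ : ∀ k → 2 + ph k ≡ 2 ^ suc k
ph-2^ zero    = refl
ph-2^ (suc k) = trans (cong (_+ 2 ^ suc k) (ph-2^ k)) (cong (2 ^ suc k +_) (sym (+-identityʳ (2 ^ suc k))))

boundary : ℕ → ℕ → ℕ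
boundary k q = st k + q * suc k

next-chunk : ∀ k q → boundary k (suc q) ≡ boundary k q + suc k
next-chunk k q = trans (cong (st k +_) (+-comm (suc k) (q * suc k))) (sym (+-assoc (st k) _ _))

next-block : ∀ k → boundary (suc k) 0 ≡ boundary k (2 ^ suc k)
next-block k = trans (+-identityʳ _) (cong (st k +_) (*-comm (suc k) (2 ^ suc k)))

phrases-boundary : ∀ k q x → q ≤ 2 ^ suc k →
  phrases [] [] (S ↾ boundary k q ++ x) ≡ ph k + q + phrases (dict k q) [] x
phrases-boundary zero    zero    x _ = refl
phrases-boundary (suc k) zero    x _ = begin
  phrases [] [] (S ↾ boundary (suc k) 0 ++ x)         ≡⟨ cong (λ m → phrases [] [] (S ↾ m ++ x)) (next-block k) ⟩
  phrases [] [] (S ↾ boundary k (2 ^ suc k) ++ x)     ≡⟨ phrases-boundary k (2 ^ suc k) x ≤-refl ⟩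
  ph (suc k) + phrases (dict (suc k) 0) [] x          ≡⟨ cong (_+ phrases (dict (suc k) 0) [] x) (+-identityʳ (ph (suc k))) ⟨
  ph (suc k) + 0 + phrases (dict (suc k) 0) [] x      ∎
  where open ≡-Reasoning
phrases-boundary k (suc q) x q< = begin
  phrases [] [] (S ↾ boundary k (suc q) ++ x)
    ≡⟨ cong (λ m → phrases [] [] (S ↾ m ++ x)) (next-chunk k q) ⟩
  phrases [] [] (S ↾ (boundary k q + suc k) ++ x)
    ≡⟨ cong (λ y → phrases [] [] (y ++ x)) (trans (↾-+ S (boundary k q) (suc k))
         (cong (S ↾ boundary k q ++_) (S-chunk k q (suc k) q< ≤-refl))) ⟩
  phrases [] [] ((S ↾ boundary k q ++ chunkWord k q) ++ x)
    ≡⟨ cong (phrases [] []) (++-assoc (S ↾ boundary k q) _ x) ⟩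
  phrases [] [] (S ↾ boundary k q ++ (chunkWord k q ++ x))
    ≡⟨ phrases-boundary k q (chunkWord k q ++ x) (<⇒≤ q<) ⟩
  ph k + q + phrases (dict k q) [] (chunkWord k q ++ x)
    ≡⟨ cong (ph k + q +_) (phrases-chunk (dict k q) (suc k) [] (chunkWord k q) x (length-win _ _ (suc k)) (s≤s z≤n)
         (λ w 0< lt → dict-complete k q w 0< (s≤s⁻¹ lt)) (chunk∉dict k q q<)) ⟩
  ph k + q + suc (phrases (dict k q ∷ʳ chunkWord k q) [] x)
    ≡⟨ cong (λ D → ph k + q + suc (phrases D [] x)) (dict-suc k q) ⟨
  ph k + q + suc (phrases (dict k (suc q)) [] x)
    ≡⟨ shift (ph k) q (phrases (dict k (suc q)) [] x) ⟩
  ph k + suc q + phrases (dict k (suc q)) [] x  ∎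
  where
  open ≡-Reasoning
  shift : ∀ p q r → p + q + suc r ≡ p + suc q + r
  shift = solve-∀

-- Recursion at the last phrase, since the estimates append one phrase at a time; the encoder
-- recurses at the first, and `codeLength-suc` mediates.
codeLength : ℕ → ℕ → ℕ
codeLength i zero    = 0
codeLength i (suc c) = codeLength i c + suc ⌈log₂ (i + c) ⌉

codeLength-suc : ∀ i c → codeLength i (suc c) ≡ suc ⌈log₂ i ⌉ + codeLength (suc i) c
codeLength-suc i zero    = trans (cong (λ j → suc ⌈log₂ j ⌉) (+-identityʳ i)) (sym (+-identityʳ _))
codeLength-suc i (suc c) = begin
  codeLength i (suc c) + suc ⌈log₂ (i + suc c) ⌉
    ≡⟨ cong₂ _+_ (codeLength-suc i c) (cong (λ j → suc ⌈log₂ j ⌉) (+-suc i c)) ⟩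
  suc ⌈log₂ i ⌉ + codeLength (suc i) c + suc ⌈log₂ (suc i + c) ⌉
    ≡⟨ +-assoc (suc ⌈log₂ i ⌉) _ _ ⟩
  suc ⌈log₂ i ⌉ + codeLength (suc i) (suc c)  ∎
  where open ≡-Reasoning

length-binary : ∀ k n → length (binary k n) ≡ k
length-binary zero    n = refl
length-binary (suc k) n = trans (length-++ (binary k (n / 2))) (trans (+-comm _ 1) (cong suc (length-binary k (n / 2))))

length-lzEncode : ∀ D i ps → length (lzEncode D i ps) ≡ codeLength i (length ps)
length-lzEncode D i []             = refl
length-lzEncode D i ((u , b) ∷ ps) = begin
  length (binary ⌈log₂ i ⌉ (ptr u D) ++ b ∷ lzEncode (D ∷ʳ (u ∷ʳ b)) (suc i) ps)
    ≡⟨ length-++ (binary ⌈log₂ i ⌉ (ptr u D)) ⟩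
  length (binary ⌈log₂ i ⌉ (ptr u D)) + suc (length (lzEncode (D ∷ʳ (u ∷ʳ b)) (suc i) ps))
    ≡⟨ cong₂ (λ x y → x + suc y) (length-binary ⌈log₂ i ⌉ (ptr u D)) (length-lzEncode (D ∷ʳ (u ∷ʳ b)) (suc i) ps) ⟩
  ⌈log₂ i ⌉ + suc (codeLength (suc i) (length ps))
    ≡⟨ +-suc ⌈log₂ i ⌉ _ ⟩
  suc ⌈log₂ i ⌉ + codeLength (suc i) (length ps)
    ≡⟨ codeLength-suc i (length ps) ⟨
  codeLength i (suc (length ps))  ∎
  where open ≡-Reasoning

lzLength : Bits → ℕ
lzLength x = length (LZ x)

lzLength-phrases : ∀ x → lzLength x ≡ codeLength 1 (phrases [] [] x)
lzLength-phrases x = length-lzEncode [] 1 (lzParse [] [] x)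

-- When the words of block k are parsed the phrase number is at least 2ᵏ, so pointer and new digit
-- together are as long as the word itself.
codeword-lower : ∀ k q → suc k ≤ suc ⌈log₂ suc (ph k + q) ⌉
codeword-lower k q = s≤s (≤-trans (≤-reflexive (sym (⌈log₂2^n⌉≡n k))) (⌈log₂⌉-mono-≤ 2^k≤))
  where
  open ≤-Reasoning
  2^k≤ : 2 ^ k ≤ suc (ph k + q)
  2^k≤ = ≤-trans (s≤s⁻¹ (begin
    suc (2 ^ k)       ≤⟨ +-monoˡ-≤ (2 ^ k) (m^n>0 2 k) ⟩
    2 ^ k + 2 ^ k     ≡⟨ cong (2 ^ k +_) (+-identityʳ (2 ^ k)) ⟨
    2 ^ suc k         ≡⟨ ph-2^ k ⟨
    2 + ph k          ∎)) (s≤s (m≤m+n (ph k) q))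

codeword-upper : ∀ k q → q < 2 ^ suc k → suc ⌈log₂ suc (ph k + q) ⌉ ≤ suc k + 2
codeword-upper k q q< = ≤-trans (s≤s (≤-trans (⌈log₂⌉-mono-≤ ≤2^) (≤-reflexive (⌈log₂2^n⌉≡n (suc (suc k))))))
  (≤-reflexive (+-comm 2 (suc k)))
  where
  open ≤-Reasoning
  ≤2^ : suc (ph k + q) ≤ 2 ^ suc (suc k)
  ≤2^ = begin
    suc (ph k + q)          ≡⟨ +-suc (ph k) q ⟨
    ph k + suc q            ≤⟨ +-mono-≤ (≤-trans (m≤n+m (ph k) 2) (≤-reflexive (ph-2^ k))) q< ⟩
    2 ^ suc k + 2 ^ suc k   ≡⟨ cong (2 ^ suc k +_) (+-identityʳ (2 ^ suc k)) ⟨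
    2 ^ suc (suc k)         ∎

codeLength-lower : ∀ k q → boundary k q ≤ codeLength 1 (ph k + q)
codeLength-lower zero    zero    = z≤n
codeLength-lower (suc k) zero    = subst₂ _≤_ (sym (next-block k)) (cong (codeLength 1) (sym (+-identityʳ (ph (suc k)))))
  (codeLength-lower k (2 ^ suc k))
codeLength-lower k       (suc q) = subst₂ _≤_ (sym (next-chunk k q)) (cong (codeLength 1) (sym (+-suc (ph k) q)))
  (+-mono-≤ (codeLength-lower k q) (codeword-lower k q))

codeLength-upper : ∀ k q → q ≤ 2 ^ suc k → codeLength 1 (ph k + q) ≤ boundary k q + (ph k + q) * 2
codeLength-upper zero    zero    _  = z≤n
codeLength-upper (suc k) zero    _  = subst₂ (λ c b → codeLength 1 c ≤ b + c * 2)
  (sym (+-identityʳ (ph (suc k)))) (sym (next-block k)) (codeLength-upper k (2 ^ suc k) ≤-refl)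
codeLength-upper k       (suc q) q< = subst₂ (λ c b → codeLength 1 c ≤ b + c * 2)
  (sym (+-suc (ph k) q)) (sym (next-chunk k q))
  (≤-trans (+-mono-≤ (codeLength-upper k q (<⇒≤ q<)) (codeword-upper k q q<))
    (≤-reflexive (rearrange (boundary k q) (ph k + q) (suc k))))
  where
  rearrange : ∀ b c n → b + c * 2 + (n + 2) ≡ b + n + suc c * 2
  rearrange = solve-∀

lz-upper : ∀ k → lzLength (S ↾ st k) ≤ st k + ph k * 2
lz-upper k = subst₂ _≤_ (sym (trans (lzLength-phrases (S ↾ st k)) (cong (codeLength 1) count)))
  (cong₂ (λ b c → b + c * 2) (+-identityʳ (st k)) (+-identityʳ (ph k))) (codeLength-upper k 0 z≤n)
  where
  count : phrases [] [] (S ↾ st k) ≡ ph k + 0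
  count = trans (cong (phrases [] []) (trans (cong (S ↾_) (sym (+-identityʳ (st k)))) (sym (++-identityʳ _))))
    (trans (phrases-boundary k 0 [] z≤n) (+-identityʳ _))

-- Holds at every m and not only at ends of words: an unfinished phrase has fewer than n digits but
-- still costs a whole codeword of at least n bits.
lz-lower : ∀ m → m ≤ lzLength (S ↾ m)
lz-lower m with locate m
... | position k Q Q< refl with divide Q (suc k)
... | q , e , e< , refl = subst₂ _≤_ (+-assoc (st k) _ e) (sym (trans (lzLength-phrases (S ↾ (st k + (q * suc k + e))))
      (cong (codeLength 1) count))) (bound e e<)
  where
  q< : q < 2 ^ suc k
  q< = *+<⁻¹ {o = e} (subst (q * suc k + e <_) (*-comm (suc k) (2 ^ suc k)) Q<)
  count : phrases [] [] (S ↾ (st k + (q * suc k + e))) ≡ ph k + q + pos e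
  count = begin
    phrases [] [] (S ↾ (st k + (q * suc k + e)))
      ≡⟨ cong (λ m → phrases [] [] (S ↾ m)) (+-assoc (st k) _ e) ⟨
    phrases [] [] (S ↾ (boundary k q + e))
      ≡⟨ cong (phrases [] []) (↾-+ S (boundary k q) e) ⟩
    phrases [] [] (S ↾ boundary k q ++ win S (boundary k q) e)
      ≡⟨ phrases-boundary k q _ (<⇒≤ q<) ⟩
    ph k + q + phrases (dict k q) [] (win S (boundary k q) e)
      ≡⟨ cong (ph k + q +_) (phrases-partial (dict k q) (suc k) [] (win S (boundary k q) e) (subst (_< suc k) (sym (length-win S _ e)) e<)
           (λ w 0< lt → dict-complete k q w 0< (s≤s⁻¹ lt))) ⟩
    ph k + q + pos (length (win S (boundary k q) e))
      ≡⟨ cong (λ l → ph k + q + pos l) (length-win S _ e) ⟩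
    ph k + q + pos e  ∎
    where open ≡-Reasoning
  bound : ∀ e → e < suc k → boundary k q + e ≤ codeLength 1 (ph k + q + pos e)
  bound zero    _  = subst₂ _≤_ (sym (+-identityʳ _)) (cong (codeLength 1) (sym (+-identityʳ (ph k + q)))) (codeLength-lower k q)
  bound (suc e) e< = subst (boundary k q + suc e ≤_) (cong (codeLength 1) (+-comm 1 (ph k + q)))
    (+-mono-≤ (codeLength-lower k q) (≤-trans (<⇒≤ e<) (codeword-lower k q)))

-- Counting occurrences

count : (ℕ → Bool) → ℕ → ℕ
count f zero    = 0
count f (suc n) = count f n + bit (f n)

bit≤1 : ∀ b → bit b ≤ 1
bit≤1 b = s≤s⁻¹ (bit<2 b)

bit-mono : ∀ {a b} → (a ≡ true → b ≡ true) → bit a ≤ bit b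
bit-mono {false}     _   = z≤n
bit-mono {true}  {b} imp = ≤-reflexive (cong bit (sym (imp refl)))

count-≤ : ∀ f n → count f n ≤ n
count-≤ f zero    = z≤n
count-≤ f (suc n) = ≤-trans (+-mono-≤ (count-≤ f n) (bit≤1 (f n))) (≤-reflexive (+-comm n 1))

count-+ : ∀ f a b → count f (a + b) ≡ count f a + count (from f a) b
count-+ f a zero    = trans (cong (count f) (+-identityʳ a)) (sym (+-identityʳ _))
count-+ f a (suc b) = trans (cong (count f) (+-suc a b))
  (trans (cong (_+ bit (f (a + b))) (count-+ f a b)) (+-assoc (count f a) _ _))

count-mono : ∀ {f g} n → (∀ e → e < n → f e ≡ true → g e ≡ true) → count f n ≤ count g n
count-mono zero    imp = z≤n
count-mono (suc n) imp = +-mono-≤ (count-mono n (λ e e< → imp e (m<n⇒m<1+n e<))) (bit-mono (imp n ≤-refl))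

count-mono-length : ∀ f {m n} → m ≤ n → count f m ≤ count f n
count-mono-length f {m} m≤n with m≤n⇒∃[o]m+o≡n m≤n
... | o , refl = ≤-trans (m≤m+n _ _) (≤-reflexive (sym (count-+ f m o)))

count-∨ : ∀ {f g h} n → (∀ e → e < n → f e ≡ true → g e ≡ true ⊎ h e ≡ true) → count f n ≤ count g n + count h n
count-∨ zero imp = z≤n
count-∨ {f} {g} {h} (suc n) imp = ≤-trans
  (+-mono-≤ (count-∨ n (λ e e< → imp e (m<n⇒m<1+n e<))) (bits (f n) (g n) (h n) (imp n ≤-refl)))
  (≤-reflexive (rearrange (count g n) (count h n) (bit (g n)) (bit (h n))))
  where
  bits : ∀ a b c → (a ≡ true → b ≡ true ⊎ c ≡ true) → bit a ≤ bit b + bit c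
  bits false b c imp = z≤n
  bits true  b c imp with imp refl
  ... | inj₁ refl = s≤s z≤n
  ... | inj₂ refl = m≤n+m 1 (bit b)
  rearrange : ∀ a b c d → a + b + (c + d) ≡ a + c + (b + d)
  rearrange = solve-∀

count-zero : ∀ f n → (∀ i → i < n → f i ≡ true → ⊥) → count f n ≡ 0
count-zero f zero    none = refl
count-zero f (suc n) none rewrite count-zero f n (λ i i< → none i (m<n⇒m<1+n i<)) with f n in eq
... | true  = ⊥-elim (none n ≤-refl eq)
... | false = refl

count-unique : ∀ f n → (∀ i j → i < n → j < n → f i ≡ true → f j ≡ true → i ≡ j) → count f n ≤ 1
count-unique f zero    uniq = z≤n
count-unique f (suc n) uniq with f n in eq
... | false = ≤-trans (≤-reflexive (+-identityʳ _))
      (count-unique f n (λ i j i< j< → uniq i j (m<n⇒m<1+n i<) (m<n⇒m<1+n j<)))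
... | true  = ≤-reflexive (cong (_+ 1) (count-zero f n
      (λ i i< fi → <⇒≢ i< (uniq i n (m<n⇒m<1+n i<) ≤-refl fi eq))))

count-blocks : ∀ f a b β → (∀ i → i < a → count (from f (i * b)) b ≤ β) → count f (a * b) ≤ a * β
count-blocks f zero    b β bound = z≤n
count-blocks f (suc a) b β bound = begin
  count f (b + a * b)                           ≡⟨ cong (count f) (+-comm b (a * b)) ⟩
  count f (a * b + b)                           ≡⟨ count-+ f (a * b) b ⟩
  count f (a * b) + count (from f (a * b)) b    ≤⟨ +-mono-≤ (count-blocks f a b β (λ i i< → bound i (m<n⇒m<1+n i<))) (bound a ≤-refl) ⟩
  a * β + β                                     ≡⟨ +-comm (a * β) β ⟩
  suc a * β                                     ∎
  where open ≤-Reasoning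

-- An occurrence overlapping the end of a segment need not come from the cycle; the last `L`
-- starting places are simply all counted.
count-but-last : ∀ {f g} n L → (∀ o → o + L ≤ n → f o ≡ true → g o ≡ true) → count f n ≤ count g n + L
count-but-last {f} {g} n L imp with L ≤? n
... | no L≰n = ≤-trans (count-≤ f n) (≤-trans (<⇒≤ (≰⇒> L≰n)) (m≤n+m L _))
... | yes L≤n with m≤n⇒∃[o]m+o≡n L≤n
...   | o , refl = begin
  count f (L + o)                     ≡⟨ cong (count f) (+-comm L o) ⟩
  count f (o + L)                     ≡⟨ count-+ f o L ⟩
  count f o + count (from f o) L      ≤⟨ +-mono-≤ (count-mono o (λ e e< → imp e (≤-trans (+-monoˡ-≤ L (<⇒≤ e<)) (≤-reflexive (+-comm o L)))))
                                           (count-≤ _ L) ⟩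
  count g o + L                       ≤⟨ +-monoˡ-≤ L (count-mono-length g (m≤n+m o L)) ⟩
  count g (L + o) + L                 ∎
  where open ≤-Reasoning

at : Bits → (ℕ → Bool) → ℕ → Bool
at []      f i = true
at (b ∷ w) f i = ⌊ b BP.≟ f i ⌋ ∧ at w f (suc i)

at⇒win : ∀ w {f} i → at w f i ≡ true → win f i (length w) ≡ w
at⇒win []      i eq = refl
at⇒win (b ∷ w) {f} i eq with b BP.≟ f i
... | yes refl = cong (f i ∷_) (at⇒win w (suc i) eq)

win⇒at : ∀ w {f} i → win f i (length w) ≡ w → at w f i ≡ true
win⇒at []      i eq = refl
win⇒at (b ∷ w) {f} i eq with b BP.≟ f i
... | yes _ = win⇒at w (suc i) (proj₂ (∷-injective eq))
... | no b≢ = ⊥-elim (b≢ (sym (proj₁ (∷-injective eq))))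

at-∷ʳ : ∀ w {f} i → at w f i ≡ true → at (w ∷ʳ f (i + length w)) f i ≡ true
at-∷ʳ w {f} i eq = win⇒at (w ∷ʳ f (i + length w)) i (trans (cong (win f i) (trans (length-++ w) (+-comm (length w) 1)))
  (trans (win-∷ʳ f i (length w)) (cong (_∷ʳ f (i + length w)) (at⇒win w i eq))))

at-agree : ∀ w {f g} i j → Agree (length w) (from f i) (from g j) → at w f i ≡ true → at w g j ≡ true
at-agree w i j ag eq = win⇒at w j (trans (sym (win-cong i j (length w) ag)) (at⇒win w i eq))

isPrefix-at : ∀ w f i m → isPrefix w (win f i m) ≡ true → at w f i ≡ true × length w ≤ m
isPrefix-at []      f i m       eq = refl , z≤n
isPrefix-at (b ∷ w) f i (suc m) eq with b BP.≟ f i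
... | yes _ = let (p , q) = isPrefix-at w f (suc i) m eq in p , s≤s q

at-isPrefix : ∀ w f i m → at w f i ≡ true → length w ≤ m → isPrefix w (win f i m) ≡ true
at-isPrefix []      f i m       eq le = refl
at-isPrefix (b ∷ w) f i (suc m) eq le with b BP.≟ f i
... | yes _ = at-isPrefix w f (suc i) m eq (s≤s⁻¹ le)

if-bit : ∀ b → (if b then 1 else 0) ≡ bit b
if-bit true  = refl
if-bit false = refl

occ-step : ∀ w f a m → occ w (win f a (suc m)) ≡ bit (isPrefix w (win f a (suc m))) + occ w (win f (suc a) m)
occ-step w f a m = cong (_+ occ w (win f (suc a) m)) (if-bit (isPrefix w (win f a (suc m))))

occ-count : ∀ w f a m → occ w (win f a m) ≤ count (from (at w f) a) (suc m)
occ-count w f a zero    = ≤-trans (≤-reflexive (if-bit (isPrefix w []))) (bit-mono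
  (λ eq → subst (λ i → at w f i ≡ true) (sym (+-identityʳ a)) (proj₁ (isPrefix-at w f a 0 eq))))
occ-count w f a (suc m) = begin
  occ w (win f a (suc m))                                             ≡⟨ occ-step w f a m ⟩
  bit (isPrefix w (win f a (suc m))) + occ w (win f (suc a) m)
    ≤⟨ +-mono-≤ (bit-mono (λ eq → subst (λ i → at w f i ≡ true) (sym (+-identityʳ a)) (proj₁ (isPrefix-at w f a (suc m) eq))))
                (occ-count w f (suc a) m) ⟩
  bit (at w f (a + 0)) + count (from (at w f) (suc a)) (suc m)
    ≤⟨ +-monoʳ-≤ (bit (at w f (a + 0))) (count-mono (suc m) (λ e _ → subst (λ i → at w f i ≡ true) (sym (+-suc a e)))) ⟩
  bit (at w f (a + 0)) + count (from (from (at w f) a) 1) (suc m)     ≡⟨ count-+ (from (at w f) a) 1 (suc m) ⟨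
  count (from (at w f) a) (suc (suc m))                               ∎
  where open ≤-Reasoning

occ-none : ∀ w f a m → (∀ h → h + length w ≤ m → at w f (a + h) ≡ true → ⊥) → occ w (win f a m) ≡ 0
occ-none w f a zero none with isPrefix w [] in eq
... | false = refl
... | true  = let (p , q) = isPrefix-at w f a 0 eq in
      ⊥-elim (none 0 q (subst (λ i → at w f i ≡ true) (sym (+-identityʳ a)) p))
occ-none w f a (suc m) none with isPrefix w (win f a (suc m)) in eq
... | true  = let (p , q) = isPrefix-at w f a (suc m) eq in
      ⊥-elim (none 0 q (subst (λ i → at w f i ≡ true) (sym (+-identityʳ a)) p))
... | false = occ-none w f (suc a) m (λ h le p → none (suc h) (s≤s le)
      (subst (λ i → at w f i ≡ true) (sym (+-suc a h)) p))

occ-drop : ∀ w f a j m → occ w (win f (a + j) m) ≤ occ w (win f a (j + m))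
occ-drop w f a zero    m = ≤-reflexive (cong (λ b → occ w (win f b m)) (+-identityʳ a))
occ-drop w f a (suc j) m = ≤-trans (≤-reflexive (cong (λ b → occ w (win f b m)) (+-suc a j)))
  (≤-trans (occ-drop w f (suc a) j m) (m≤n+m _ _))

occ-skip : ∀ w f a j m → 0 < j → at w f a ≡ true → length w ≤ j + m →
  suc (occ w (win f (a + j) m)) ≤ occ w (win f a (j + m))
occ-skip w f a (suc j) m _ eq le = begin
  suc (occ w (win f (a + suc j) m))      ≡⟨ cong (λ i → suc (occ w (win f i m))) (+-suc a j) ⟩
  suc (occ w (win f (suc a + j) m))      ≤⟨ s≤s (occ-drop w f (suc a) j m) ⟩
  suc (occ w (win f (suc a) (j + m)))    ≡⟨ cong (λ b → bit b + occ w (win f (suc a) (j + m))) (at-isPrefix w f a (suc (j + m)) eq le) ⟨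
  bit (isPrefix w (win f a (suc (j + m)))) + occ w (win f (suc a) (j + m))
                                         ≡⟨ occ-step w f a (j + m) ⟨
  occ w (win f a (suc j + m))            ∎
  where open ≤-Reasoning

-- Places at distance N > 0 are distinct, and the bound on `length w` lets even the last occurrence
-- fit.
occ-progression : ∀ K w f a N m → 0 < N → length w ≤ N + m →
  (∀ j → j < K → at w f (a + j * N) ≡ true) → K ≤ occ w (win f a (K * N + m))
occ-progression zero    w f a N m N>0 le all = z≤n
occ-progression (suc K) w f a N m N>0 le all = begin
  suc K                                             ≤⟨ s≤s (occ-progression K w f (a + N) N m N>0 le
                                                         (λ j j< → subst (λ i → at w f i ≡ true) (sym (+-assoc a N _)) (all (suc j) (s≤s j<)))) ⟩
  suc (occ w (win f (a + N) (K * N + m)))           ≤⟨ occ-skip w f a N (K * N + m) N>0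
                                                         (subst (λ i → at w f i ≡ true) (+-identityʳ a) (all 0 (s≤s z≤n)))
                                                         (≤-trans le (+-monoʳ-≤ N (m≤n+m m (K * N)))) ⟩
  occ w (win f a (N + (K * N + m)))                 ≡⟨ cong (λ l → occ w (win f a l)) (+-assoc N (K * N) m) ⟨
  occ w (win f a (suc K * N + m))                   ∎
  where open ≤-Reasoning

-- Every occurrence except one at the very beginning is preceded by a digit. This additivity later
-- turns upper bounds into lower ones.
occ-∷ : ∀ w x → occ w x ≡ bit (isPrefix w x) + (occ (false ∷ w) x + occ (true ∷ w) x)
occ-∷ w []      = trans (if-bit (isPrefix w [])) (sym (+-identityʳ _))
occ-∷ w (false ∷ x) = cong₂ _+_ (if-bit (isPrefix w (false ∷ x)))
  (trans (occ-∷ w x) (trans (cong (_+ (occ (false ∷ w) x + occ (true ∷ w) x)) (sym (if-bit (isPrefix w x)))) (sym (+-assoc _ (occ (false ∷ w) x) (occ (true ∷ w) x)))))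
occ-∷ w (true ∷ x) = cong₂ _+_ (if-bit (isPrefix w (true ∷ x)))
  (trans (occ-∷ w x) (trans (cong (_+ (occ (false ∷ w) x + occ (true ∷ w) x)) (sym (if-bit (isPrefix w x)))) (rearrange _ (occ (false ∷ w) x) (occ (true ∷ w) x))))
  where
  rearrange : ∀ a b c → a + (b + c) ≡ b + (a + c)
  rearrange = solve-∀

-- Induction on the number j of missing digits: a word of length at least n has one place per turn
-- at most, and a shorter word splits into its two extensions.
cycle-count : ∀ {n N} (c : Cycle n N) j w a → n ≤ j + length w → count (from (at w (Cycle.d c)) a) N ≤ 2 ^ j
cycle-count {n} {N} c zero w a n≤ = count-unique _ N (λ i j i< j< p q → ≈⇒≡ i< j< (≈-cancel-+ a (Cycle.inj c _ _
  (λ e e< → win-agree (a + i) (a + j) (length w) (trans (at⇒win w (a + i) p) (sym (at⇒win w (a + j) q))) e (≤-trans e< n≤)))))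
cycle-count {n} {N} c (suc j) w a n≤ = ≤-trans (count-∨ N extend)
  (≤-trans (+-mono-≤ (half false) (half true)) (≤-reflexive (cong (2 ^ j +_) (sym (+-identityʳ (2 ^ j))))))
  where
  half : ∀ b → count (from (at (w ∷ʳ b) (Cycle.d c)) a) N ≤ 2 ^ j
  half b = cycle-count c j (w ∷ʳ b) a (≤-trans n≤ (≤-reflexive (trans (sym (+-suc j (length w)))
    (cong (j +_) (sym (trans (length-++ w) (+-comm (length w) 1)))))))
  extend : ∀ e → e < N → at w (Cycle.d c) (a + e) ≡ true →
    at (w ∷ʳ false) (Cycle.d c) (a + e) ≡ true ⊎ at (w ∷ʳ true) (Cycle.d c) (a + e) ≡ true
  extend e _ eq with Cycle.d c (a + e + length w) | at-∷ʳ w {Cycle.d c} (a + e) eq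
  ... | false | p = inj₁ p
  ... | true  | p = inj₂ p

-- Occurrences of a word in segments, blocks and prefixes

per-pass : ℕ → ℕ → ℕ
-- Truncated subtraction gives 1 for words longer than n, which have at most one place per turn as
-- well.
per-pass L k = 2 ^ (suc k ∸ L)

segment-count : ∀ k w r P → r < Lv.g k → P * Lv.N k ≤ Z k →
  count (from (at w S) (st k + r * Z k)) (P * Lv.N k) ≤ P * per-pass (length w) k + length w
segment-count k w r P r<g PN≤ = ≤-trans (count-but-last (P * Lv.N k) (length w) inside)
  (+-monoˡ-≤ (length w) (count-blocks (from (at w (Lv.d k)) r) P (Lv.N k) (per-pass (length w) k) pass))
  where
  inside : ∀ o → o + length w ≤ P * Lv.N k → at w S (st k + r * Z k + o) ≡ true → at w (Lv.d k) (r + o) ≡ true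
  inside o o+ = at-agree w _ _ (λ e e< → trans (cong S (reassoc (st k) (r * Z k) o e))
    (trans (S-segment k r (o + e) r<g (≤-trans (+-monoʳ-< o e<) (≤-trans o+ PN≤))) (cong (Lv.d k) (shuffle o e r))))
    where
    reassoc : ∀ s z o e → s + z + o + e ≡ s + (z + (o + e))
    reassoc = solve-∀
    shuffle : ∀ o e r → o + e + r ≡ r + o + e
    shuffle = solve-∀
  pass : ∀ i → i < P → count (from (from (at w (Lv.d k)) r) (i * Lv.N k)) (Lv.N k) ≤ per-pass (length w) k
  pass i _ = ≤-trans (count-mono (Lv.N k) (λ e _ → subst (λ x → at w (Lv.d k) x ≡ true) (sym (+-assoc r (i * Lv.N k) e))))
    (cycle-count (Lv.cycle k) _ w (r + i * Lv.N k) (≤-trans (m≤n+m∸n (suc k) (length w)) (≤-reflexive (+-comm (length w) _))))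

segments-count : ∀ k w r → r ≤ Lv.g k →
  count (from (at w S) (st k)) (r * Z k) ≤ r * (Lv.m k * per-pass (length w) k + length w)
segments-count k w r r≤g = count-blocks _ r (Z k) _ (λ i i< → ≤-trans
  (count-mono (Z k) (λ e _ → subst (λ x → at w S x ≡ true) (sym (+-assoc (st k) (i * Z k) e))))
  (segment-count k w i (Lv.m k) (≤-trans i< r≤g) ≤-refl))

g≤n : ∀ k → Lv.g k ≤ suc k
g≤n k = ≤-trans (m≤m² (Lv.g k)) (Lv.g²≤n k)

len≤gZ+n : ∀ k → len k ≤ Lv.g k * Z k + suc k
len≤gZ+n k with len-cases k
... | inj₁ eq = ≤-trans (≤-reflexive eq) (m≤m+n _ _)
... | inj₂ eq = ≤-reflexive eq

full-count : ∀ k w Q → Lv.g k * Z k ≤ Q → Q ≤ len k →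
  count (from (at w S) (st k)) Q ≤ suc k * per-pass (length w) k + (suc k * length w + suc k)
full-count k w Q ≥gZ ≤len with m≤n⇒∃[o]m+o≡n ≥gZ
... | o , refl = begin
  count f (g * Z k + o)                                ≡⟨ count-+ f (g * Z k) o ⟩
  count f (g * Z k) + count (from f (g * Z k)) o       ≤⟨ +-mono-≤ (segments-count k w g ≤-refl) (count-≤ _ o) ⟩
  g * (Lv.m k * p + L) + o                             ≤⟨ +-monoʳ-≤ _ (+-cancelˡ-≤ (g * Z k) o (suc k) (≤-trans ≤len (len≤gZ+n k))) ⟩
  g * (Lv.m k * p + L) + suc k                         ≡⟨ expand g (Lv.m k) p L (suc k) ⟩
  g * Lv.m k * p + (g * L + suc k)                     ≡⟨ cong (λ n → n * p + (g * L + suc k)) (Lv.n≡gm k) ⟨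
  suc k * p + (g * L + suc k)                          ≤⟨ +-monoʳ-≤ (suc k * p) (+-monoˡ-≤ (suc k) (*-monoˡ-≤ L (g≤n k))) ⟩
  suc k * p + (suc k * L + suc k)                      ∎
  where
  open ≤-Reasoning
  f : ℕ → Bool
  f = from (at w S) (st k)
  g p L : ℕ
  g = Lv.g k
  L = length w
  p = per-pass L k
  expand : ∀ g m p L n → g * (m * p + L) + n ≡ g * m * p + (g * L + n)
  expand = solve-∀

-- `P` is a number of completed turns. A turn that has begun is charged in full, hence `suc P`; past
-- the last segment all n turns are complete.
partial-count : ∀ k w Q → Q ≤ len k → Σ ℕ λ P → P * Lv.N k ≤ Q ×
  count (from (at w S) (st k)) Q ≤ suc P * per-pass (length w) k + (suc k * length w + suc k)
partial-count k w Q Q≤ with Q <? Lv.g k * Z k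
... | no Q≮ = suc k , ≤-trans (≤-reflexive (sym (gZ≡nN k))) (≮⇒≥ Q≮) ,
      ≤-trans (full-count k w Q (≮⇒≥ Q≮) Q≤) (+-monoˡ-≤ _ (*-monoˡ-≤ (per-pass (length w) k) (n≤1+n (suc k))))
... | yes Q< with divide Q (Z k)
...   | r , o , o<Z , refl with divide o (Lv.N k)
...     | i , e , e<N , refl = r * Lv.m k + i , below , (begin
  count f (r * Z k + (i * N + e))                              ≡⟨ count-+ f (r * Z k) (i * N + e) ⟩
  count f (r * Z k) + count (from f (r * Z k)) (i * N + e)
    ≤⟨ +-mono-≤ (segments-count k w r (<⇒≤ r<g)) (≤-trans
         (count-mono (i * N + e) (λ x _ → subst (λ y → at w S y ≡ true) (sym (+-assoc (st k) (r * Z k) x))))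
         (≤-trans (count-mono-length _ (≤-trans (+-monoʳ-≤ (i * N) (<⇒≤ e<N)) (≤-reflexive (+-comm (i * N) N))))
           (segment-count k w r (suc i) r<g (*-monoˡ-≤ N i<m)))) ⟩
  r * (Lv.m k * p + L) + (suc i * p + L)                       ≡⟨ expand r (Lv.m k) p L i ⟩
  suc (r * Lv.m k + i) * p + suc r * L                         ≤⟨ +-monoʳ-≤ (suc (r * Lv.m k + i) * p)
                                                                    (≤-trans (*-monoˡ-≤ L (≤-trans r<g (g≤n k))) (m≤m+n _ (suc k))) ⟩
  suc (r * Lv.m k + i) * p + (suc k * L + suc k)               ∎)
  where
  open ≤-Reasoning
  f : ℕ → Bool
  f = from (at w S) (st k)
  N p L : ℕ
  N = Lv.N k
  L = length w
  p = per-pass L k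
  r<g : r < Lv.g k
  r<g = *+<⁻¹ {o = i * N + e} Q<
  i<m : i < Lv.m k
  i<m = *+<⁻¹ {o = e} o<Z
  expand : ∀ r m p L i → r * (m * p + L) + (suc i * p + L) ≡ suc (r * m + i) * p + suc r * L
  expand = solve-∀
  below : (r * Lv.m k + i) * N ≤ r * Z k + (i * N + e)
  below = slack e (eq r (Lv.m k) i N e)
    where
    eq : ∀ r m i N e → (r * m + i) * N + e ≡ r * (m * N) + (i * N + e)
    eq = solve-∀

levelBound : ℕ → ℕ → ℕ
levelBound L k = suc k * per-pass L k + (suc k * L + suc k)

prefixBound : ℕ → ℕ → ℕ
prefixBound L zero    = 0
prefixBound L (suc k) = prefixBound L k + levelBound L k

prefix-count : ∀ w k → count (at w S) (st k) ≤ prefixBound (length w) k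
prefix-count w zero    = z≤n
prefix-count w (suc k) = ≤-trans (≤-reflexive (count-+ (at w S) (st k) (len k)))
  (+-mono-≤ (prefix-count w k) (full-count k w (len k) (gZ≤len k) ≤-refl))

occ-S : ∀ w M → occ w (S ↾ M) ≤ suc (count (at w S) M)
occ-S w M = begin
  occ w (S ↾ M)                          ≡⟨ cong (occ w) (↾-win S M) ⟩
  occ w (win S 0 M)                      ≤⟨ occ-count w S 0 M ⟩
  count (at w S) M + bit (at w S M)      ≤⟨ +-monoʳ-≤ (count (at w S) M) (bit≤1 _) ⟩
  count (at w S) M + 1                   ≡⟨ +-comm _ 1 ⟩
  suc (count (at w S) M)                 ∎
  where open ≤-Reasoning

prefixBound-short : ∀ k j → prefixBound k j ≤ j * levelBound k j
prefixBound-short k zero    = z≤n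
prefixBound-short k (suc j) = ≤-trans (+-mono-≤ (≤-trans (prefixBound-short k j) (*-monoʳ-≤ j grow)) grow)
  (≤-reflexive (+-comm (j * levelBound k (suc j)) _))
  where
  grow : levelBound k j ≤ levelBound k (suc j)
  grow = +-mono-≤ (*-mono-≤ (n≤1+n (suc j)) (^-monoʳ-≤ 2 (∸-monoˡ-≤ k (n≤1+n (suc j)))))
    (+-mono-≤ (*-monoˡ-≤ k (n≤1+n (suc j))) (n≤1+n (suc j)))

-- A word two digits shorter than the largest order n has at most four places per turn. The places
-- lost at the ends of up to n segments per block, summed over n blocks, make the bound cubic.
occ-long : ∀ w k M → length w ≡ k → M ≤ st (suc (suc k)) → occ w (S ↾ M) ≤ 7 * (suc (suc k) ^ 3)
occ-long w k M refl M≤ = begin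
  occ w (S ↾ M)                              ≤⟨ occ-S w M ⟩
  suc (count (at w S) M)                     ≤⟨ s≤s (count-mono-length (at w S) M≤) ⟩
  suc (count (at w S) (st n))                ≤⟨ s≤s (prefix-count w n) ⟩
  suc (prefixBound k n)                      ≤⟨ s≤s (+-mono-≤ (prefixBound-short k (suc k)) ≤-refl) ⟩
  suc (suc k * levelBound k (suc k) + levelBound k (suc k))
                                             ≡⟨ cong (λ p → suc (suc k * (n * p + (n * k + n)) + (n * p + (n * k + n)))) four ⟩
  suc (suc k * (n * 4 + (n * k + n)) + (n * 4 + (n * k + n)))
                                             ≤⟨ slack _ (poly k) ⟩
  7 * (n ^ 3)                                ∎
  where
  open ≤-Reasoning
  n : ℕ
  n = suc (suc k)
  four : per-pass k (suc k) ≡ 4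
  four = cong (2 ^_) (m+n∸n≡m 2 k)
  poly : ∀ k → suc (suc k * (suc (suc k) * 4 + (suc (suc k) * k + suc (suc k))) +
                    (suc (suc k) * 4 + (suc (suc k) * k + suc (suc k)))) + (6 * k * k * k + 33 * k * k + 60 * k + 35)
                 ≡ 7 * (suc (suc k) * (suc (suc k) * (suc (suc k) * 1)))
  poly = solve-∀

2^L*per-pass : ∀ L k → 2 ^ L * per-pass L k ≤ 2 ^ suc k + 2 ^ L
2^L*per-pass L k with L ≤? suc k
... | yes L≤ = ≤-trans (≤-reflexive (trans (sym (^-distribˡ-+-* 2 L (suc k ∸ L))) (cong (2 ^_) (m+[n∸m]≡n L≤)))) (m≤m+n _ _)
... | no L≰ = ≤-trans (≤-reflexive (trans (cong (λ x → 2 ^ L * 2 ^ x) (m≤n⇒m∸n≡0 (<⇒≤ (≰⇒> L≰)))) (*-identityʳ (2 ^ L))))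
      (m≤n+m (2 ^ L) _)

-- Multiplication by 2^L turns the bound per turn into 2ⁿ and thus the main term of a block into
-- `len k`; the rest is quadratic in k for fixed L.
prefixBound-scaled : ∀ L k → 2 ^ L * prefixBound L k ≤ st k + 2 ^ L * ((L + 2) * (k * k))
prefixBound-scaled L zero    = ≤-reflexive (trans (*-zeroʳ (2 ^ L)) (sym (trans (cong (2 ^ L *_) (*-zeroʳ (L + 2))) (*-zeroʳ (2 ^ L)))))
prefixBound-scaled L (suc k) = begin
  2 ^ L * (prefixBound L k + (suc k * per-pass L k + (suc k * L + suc k)))
    ≡⟨ expand (2 ^ L) (prefixBound L k) (suc k) (per-pass L k) L ⟩
  2 ^ L * prefixBound L k + suc k * (2 ^ L * per-pass L k) + 2 ^ L * (suc k * L + suc k)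
    ≤⟨ +-monoˡ-≤ _ (+-mono-≤ (prefixBound-scaled L k) (*-monoʳ-≤ (suc k) (2^L*per-pass L k))) ⟩
  st k + 2 ^ L * ((L + 2) * (k * k)) + suc k * (2 ^ suc k + 2 ^ L) + 2 ^ L * (suc k * L + suc k)
    ≤⟨ slack (2 ^ L * ((L + 2) * k)) (collect (st k) (2 ^ L) L k (2 ^ suc k)) ⟩
  st k + suc k * 2 ^ suc k + 2 ^ L * ((L + 2) * (suc k * suc k))  ∎
  where
  open ≤-Reasoning
  expand : ∀ a b n p L → a * (b + (n * p + (n * L + n))) ≡ a * b + n * (a * p) + a * (n * L + n)
  expand = solve-∀
  collect : ∀ s a L k t → s + a * ((L + 2) * (k * k)) + suc k * (t + a) + a * (suc k * L + suc k) + a * ((L + 2) * k)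
    ≡ s + suc k * t + a * ((L + 2) * (suc k * suc k))
  collect = solve-∀

2^n≤1+N : ∀ k → 2 ^ suc k ≤ suc (Lv.N k)
2^n≤1+N k with Lv.size k
... | inj₁ N≡       = ≤-trans (≤-reflexive (sym N≡)) (n≤1+n _)
... | inj₂ (sN , _) = ≤-reflexive (sym sN)

passes≤2n : ∀ k P Q → Q ≤ len k → P * Lv.N k ≤ Q → P ≤ 2 * suc k
passes≤2n k P Q Q≤ PN≤ = *-cancelʳ-≤ P (2 * suc k) (Lv.N k) (begin
  P * Lv.N k               ≤⟨ ≤-trans PN≤ Q≤ ⟩
  suc k * 2 ^ suc k        ≤⟨ *-monoʳ-≤ (suc k) (2^n≤1+N k) ⟩
  suc k * suc (Lv.N k)     ≤⟨ *-monoʳ-≤ (suc k) (+-monoˡ-≤ (Lv.N k) (≤-trans (s≤s z≤n) (Lv.2≤N k))) ⟩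
  suc k * (Lv.N k + Lv.N k) ≡⟨ double (suc k) (Lv.N k) ⟩
  2 * suc k * Lv.N k       ∎)
  where
  open ≤-Reasoning
  double : ∀ n N → n * (N + N) ≡ 2 * n * N
  double = solve-∀

-- The excess over the prefix length is 2ⁿ for the unfinished turn plus boundary and rounding losses
-- quadratic in n; the prefix has at least k 2ᵏ digits.
occ-upper : ∀ w k Q → Q ≤ len k → 2 ^ length w * occ w (S ↾ (st k + Q)) ≤
  (st k + Q) + 2 ^ suc k + 2 ^ length w * ((2 * length w + 9) * (suc k * suc k))
occ-upper w k Q Q≤ with partial-count k w Q Q≤
... | P , PN≤ , partial = begin
  a * occ w (S ↾ (st k + Q))
    ≤⟨ *-monoʳ-≤ a (occ-S w (st k + Q)) ⟩
  a * suc (count (at w S) (st k + Q))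
    ≡⟨ cong (λ c → a * suc c) (count-+ (at w S) (st k) Q) ⟩
  a * suc (count (at w S) (st k) + count (from (at w S) (st k)) Q)
    ≤⟨ *-monoʳ-≤ a (s≤s (+-mono-≤ (prefix-count w k) partial)) ⟩
  a * suc (prefixBound L k + (suc P * p + (n * L + n)))
    ≡⟨ expand a (prefixBound L k) P p n L ⟩
  a * prefixBound L k + suc P * (a * p) + a * suc (n * L + n)
    ≤⟨ +-monoˡ-≤ _ (+-mono-≤ (prefixBound-scaled L k) (*-monoʳ-≤ (suc P) (2^L*per-pass L k))) ⟩
  st k + a * ((L + 2) * (k * k)) + suc P * (2 ^ n + a) + a * suc (n * L + n)
    ≡⟨ regroup (st k) a L k P (2 ^ n) n ⟩
  st k + P * 2 ^ n + (2 ^ n + a * ((L + 2) * (k * k) + suc P + suc (n * L + n)))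
    ≤⟨ +-monoˡ-≤ _ (+-monoʳ-≤ (st k) (≤-trans (*-monoʳ-≤ P (2^n≤1+N k)) (≤-trans (≤-reflexive (*-suc P (Lv.N k))) (+-monoʳ-≤ P PN≤)))) ⟩
  st k + (P + Q) + (2 ^ n + a * ((L + 2) * (k * k) + suc P + suc (n * L + n)))
    ≡⟨ regroup′ (st k) P Q (2 ^ n) _ ⟩
  (st k + Q) + 2 ^ n + (P + a * ((L + 2) * (k * k) + suc P + suc (n * L + n)))
    ≤⟨ +-monoʳ-≤ ((st k + Q) + 2 ^ n) (≤-trans (+-monoˡ-≤ _ (m≤n*m P a {{m^n≢0 2 L}}))
         (≤-trans (≤-reflexive (sym (*-distribˡ-+ a P _))) (*-monoʳ-≤ a
           (≤-trans (+-mono-≤ P≤ (+-monoˡ-≤ _ (+-monoʳ-≤ ((L + 2) * (k * k)) (s≤s P≤)))) (slack _ (final k L)))))) ⟩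
  (st k + Q) + 2 ^ n + a * ((2 * L + 9) * (n * n))  ∎
  where
  open ≤-Reasoning
  L a p n : ℕ
  L = length w
  a = 2 ^ L
  p = per-pass L k
  n = suc k
  P≤ : P ≤ 2 * n
  P≤ = passes≤2n k P Q Q≤ PN≤
  expand : ∀ a b P p n L → a * suc (b + (suc P * p + (n * L + n))) ≡ a * b + suc P * (a * p) + a * suc (n * L + n)
  expand = solve-∀
  regroup : ∀ s a L k P t n → s + a * ((L + 2) * (k * k)) + suc P * (t + a) + a * suc (n * L + n)
    ≡ s + P * t + (t + a * ((L + 2) * (k * k) + suc P + suc (n * L + n)))
  regroup = solve-∀
  regroup′ : ∀ s P Q t x → s + (P + Q) + (t + x) ≡ (s + Q) + t + (P + x)
  regroup′ = solve-∀
  final : ∀ k L → 2 * suc k + ((L + 2) * (k * k) + suc (2 * suc k) + suc (suc k * L + suc k))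
    + (L * k * k + 3 * L * k + L + 7 * k * k + 13 * k + 2) ≡ (2 * L + 9) * (suc k * suc k)
  final = solve-∀

-- Limits of fractions

frac-toℚᵘ : ∀ a b → toℚᵘ (frac a (suc b)) ℚᵘ.≃ mkℚᵘ (ℤ.+ a) b
frac-toℚᵘ a b = ℚP.toℚᵘ-fromℚᵘ (mkℚᵘ (ℤ.+ a) b)

frac-≤ : ∀ a b c d → a * suc d ≤ c * suc b → frac a (suc b) ℚ.≤ frac c (suc d)
frac-≤ a b c d le = ℚP.toℚᵘ-cancel-≤ (ℚᵘP.≤-respˡ-≃ (ℚᵘP.≃-sym (frac-toℚᵘ a b))
  (ℚᵘP.≤-respʳ-≃ (ℚᵘP.≃-sym (frac-toℚᵘ c d))
    (ℚᵘ.*≤* (subst₂ ℤ._≤_ (ℤP.pos-* a (suc d)) (ℤP.pos-* c (suc b)) (ℤ.+≤+ le)))))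

frac-≤⁻¹ : ∀ a b c d → frac a (suc b) ℚ.≤ frac c (suc d) → a * suc d ≤ c * suc b
frac-≤⁻¹ a b c d le with ℚᵘP.≤-respˡ-≃ (frac-toℚᵘ a b) (ℚᵘP.≤-respʳ-≃ (frac-toℚᵘ c d) (ℚP.toℚᵘ-mono-≤ le))
... | ℚᵘ.*≤* le′ = ℤP.drop‿+≤+ (subst₂ ℤ._≤_ (sym (ℤP.pos-* a (suc d))) (sym (ℤP.pos-* c (suc b))) le′)

frac-* : ∀ a b c d → frac a (suc b) ℚ.* frac c (suc d) ≡ frac (a * c) (suc b * suc d)
frac-* a b c d = ℚP.toℚᵘ-injective (begin
  toℚᵘ (frac a (suc b) ℚ.* frac c (suc d))             ≈⟨ ℚP.toℚᵘ-homo-* (frac a (suc b)) (frac c (suc d)) ⟩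
  toℚᵘ (frac a (suc b)) ℚᵘ.* toℚᵘ (frac c (suc d))     ≈⟨ ℚᵘP.*-cong (frac-toℚᵘ a b) (frac-toℚᵘ c d) ⟩
  mkℚᵘ (ℤ.+ a ℤ.* ℤ.+ c) (d + b * suc d)               ≡⟨ cong (λ z → mkℚᵘ z (d + b * suc d)) (ℤP.pos-* a c) ⟨
  mkℚᵘ (ℤ.+ (a * c)) (d + b * suc d)                   ≈⟨ frac-toℚᵘ (a * c) (d + b * suc d) ⟨
  toℚᵘ (frac (a * c) (suc b * suc d))                  ∎)
  where open ℚᵘP.≃-Reasoning

frac-+ : ∀ a b c d → frac a (suc b) ℚ.+ frac c (suc d) ≡ frac (a * suc d + c * suc b) (suc b * suc d)
frac-+ a b c d = ℚP.toℚᵘ-injective (begin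
  toℚᵘ (frac a (suc b) ℚ.+ frac c (suc d))             ≈⟨ ℚP.toℚᵘ-homo-+ (frac a (suc b)) (frac c (suc d)) ⟩
  toℚᵘ (frac a (suc b)) ℚᵘ.+ toℚᵘ (frac c (suc d))     ≈⟨ ℚᵘP.+-cong (frac-toℚᵘ a b) (frac-toℚᵘ c d) ⟩
  mkℚᵘ (ℤ.+ a ℤ.* ℤ.+ suc d ℤ.+ ℤ.+ c ℤ.* ℤ.+ suc b) (d + b * suc d)
    ≡⟨ cong (λ z → mkℚᵘ z (d + b * suc d)) (cong₂ ℤ._+_ (ℤP.pos-* a (suc d)) (ℤP.pos-* c (suc b))) ⟨
  mkℚᵘ (ℤ.+ (a * suc d + c * suc b)) (d + b * suc d)   ≈⟨ frac-toℚᵘ (a * suc d + c * suc b) (d + b * suc d) ⟨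
  toℚᵘ (frac (a * suc d + c * suc b) (suc b * suc d))  ∎)
  where open ℚᵘP.≃-Reasoning

-- A positive rational is at least the reciprocal of its denominator. So all limits reduce to
-- inequalities between naturals with tolerance 1/(E + 1).
unit-below : ∀ ε → 0ℚ ℚ.< ε → Σ ℕ λ E → frac 1 (suc E) ℚ.≤ ε
unit-below ε@(mkℚ (ℤ.+ suc p) d _) _ = d , ℚP.toℚᵘ-cancel-≤ (ℚᵘP.≤-respˡ-≃ (ℚᵘP.≃-sym (frac-toℚᵘ 1 d))
  (ℚᵘ.*≤* (ℤP.*-monoʳ-≤-nonNeg (ℤ.+ suc d) (ℤ.+≤+ {1} {suc p} (s≤s z≤n)))))
unit-below (mkℚ (ℤ.+ zero) d _)  (ℚ.*<* (ℤ.+<+ ()))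
unit-below (mkℚ ℤ.-[1+ p ] d _)  (ℚ.*<* ())

shift-≤ : ∀ {p q r} → p ℚ.≤ q ℚ.+ r → p ℚ.- q ℚ.≤ r
shift-≤ {p} {q} {r} le = begin
  p ℚ.- q              ≤⟨ ℚP.+-monoˡ-≤ (ℚ.- q) le ⟩
  q ℚ.+ r ℚ.- q        ≡⟨ cong (ℚ._- q) (ℚP.+-comm q r) ⟩
  r ℚ.+ q ℚ.- q        ≡⟨ ℚP.+-assoc r q (ℚ.- q) ⟩
  r ℚ.+ (q ℚ.- q)      ≡⟨ cong (r ℚ.+_) (ℚP.+-inverseʳ q) ⟩
  r ℚ.+ 0ℚ             ≡⟨ ℚP.+-identityʳ r ⟩
  r                    ∎
  where open ℚP.≤-Reasoning

∣-∣-≤ : ∀ {p q r} → p ℚ.≤ q ℚ.+ r → q ℚ.≤ p ℚ.+ r → ℚ.∣ p ℚ.- q ∣ ℚ.≤ r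
∣-∣-≤ {p} {q} {r} le ge with ℚP.∣p∣≡p∨∣p∣≡-p (p ℚ.- q)
... | inj₁ eq = ℚP.≤-trans (ℚP.≤-reflexive eq) (shift-≤ le)
... | inj₂ eq = ℚP.≤-trans (ℚP.≤-reflexive (trans eq flip)) (shift-≤ ge)
  where
  flip : ℚ.- (p ℚ.- q) ≡ q ℚ.- p
  flip = trans (ℚP.neg-distrib-+ p (ℚ.- q)) (trans (cong (ℚ.- p ℚ.+_) (⁻¹-involutive q)) (ℚP.+-comm (ℚ.- p) q))

-- Convergence of f m / m to 1, with tolerance 1/(E + 1) and denominators cleared.
EventuallyNear : (ℕ → ℕ) → Set
EventuallyNear f = ∀ E → Σ ℕ λ M → ∀ m → M ≤ m → suc E * f m ≤ suc E * m + m × suc E * m ≤ suc E * f m + m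

limit-frac : ∀ (f : ℕ → ℕ) d → EventuallyNear (λ m → suc d * f m) → Limit (λ m → frac (f m) m) (frac 1 (suc d))
limit-frac f d near ε ε>0 with unit-below ε ε>0
... | E , E≤ε with near E
... | M , close = suc M , bound
  where
  bound : ∀ m → suc M ≤ m → ℚ.∣ frac (f m) m ℚ.- frac 1 (suc d) ∣ ℚ.≤ ε
  bound (suc m) lt = ℚP.≤-trans (∣-∣-≤ {frac (f (suc m)) (suc m)} {frac 1 (suc d)} {frac 1 (suc E)}
    (subst (frac (f (suc m)) (suc m) ℚ.≤_) (sym (frac-+ 1 d 1 E)) (frac-≤ (f (suc m)) m (1 * suc E + 1 * suc d) (E + d * suc E) above))
    (subst (frac 1 (suc d) ℚ.≤_) (sym (frac-+ (f (suc m)) m 1 E)) (frac-≤ 1 d (f (suc m) * suc E + 1 * suc m) (E + m * suc E) below))) E≤ε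
    where
    open ≤-Reasoning
    c : suc E * (suc d * f (suc m)) ≤ suc E * suc m + suc m × suc E * suc m ≤ suc E * (suc d * f (suc m)) + suc m
    c = close (suc m) (≤-trans (n≤1+n M) lt)
    above : f (suc m) * (suc d * suc E) ≤ (1 * suc E + 1 * suc d) * suc m
    above = begin
      f (suc m) * (suc d * suc E)      ≡⟨ commute (f (suc m)) (suc d) (suc E) ⟩
      suc E * (suc d * f (suc m))      ≤⟨ proj₁ c ⟩
      suc E * suc m + suc m            ≤⟨ slack (d * suc m) (eq E m d) ⟩
      (1 * suc E + 1 * suc d) * suc m  ∎
      where
      commute : ∀ a b c → a * (b * c) ≡ c * (b * a)
      commute = solve-∀
      eq : ∀ E m d → suc E * suc m + suc m + d * suc m ≡ (1 * suc E + 1 * suc d) * suc m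
      eq = solve-∀
    below : 1 * (suc m * suc E) ≤ (f (suc m) * suc E + 1 * suc m) * suc d
    below = begin
      1 * (suc m * suc E)                            ≡⟨ trans (*-identityˡ (suc m * suc E)) (*-comm (suc m) (suc E)) ⟩
      suc E * suc m                                  ≤⟨ proj₂ c ⟩
      suc E * (suc d * f (suc m)) + suc m            ≤⟨ slack (d * suc m) (eq E m d (f (suc m))) ⟩
      (f (suc m) * suc E + 1 * suc m) * suc d        ∎
      where
      eq : ∀ E m d x → suc E * (suc d * x) + suc m + d * suc m ≡ (x * suc E + 1 * suc m) * suc d
      eq = solve-∀

limsup-zero : ∀ (f : ℕ → ℕ) → (∀ E → Σ ℕ λ M → ∀ m → M ≤ m → suc E * f m ≤ m) → LimsupEq (λ m → frac (f m) m) 0ℚ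
limsup-zero f small = above , λ ε ε>0 N → N , ≤-refl , below ε ε>0 N
  where
  above : (ε : ℚ) → 0ℚ ℚ.< ε → Σ ℕ λ N → (n : ℕ) → N ≤ n → frac (f n) n ℚ.≤ 0ℚ ℚ.+ ε
  above ε ε>0 with unit-below ε ε>0
  ... | E , E≤ε with small E
  ... | M , close = suc M , bound
    where
    bound : ∀ n → suc M ≤ n → frac (f n) n ℚ.≤ 0ℚ ℚ.+ ε
    bound (suc n) lt = ℚP.≤-trans (frac-≤ (f (suc n)) n 1 E (≤-trans (≤-reflexive (*-comm (f (suc n)) (suc E)))
      (≤-trans (close (suc n) (≤-trans (n≤1+n M) lt)) (≤-reflexive (sym (*-identityˡ (suc n)))))))
      (ℚP.≤-trans E≤ε (ℚP.≤-reflexive (sym (ℚP.+-identityˡ ε))))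
  frac≥0 : ∀ a n → 0ℚ ℚ.≤ frac a n
  frac≥0 a zero    = ℚP.≤-refl
  frac≥0 a (suc n) = frac-≤ 0 0 a n z≤n
  below : ∀ ε → 0ℚ ℚ.< ε → ∀ N → 0ℚ ℚ.- ε ℚ.≤ frac (f N) N
  below ε ε>0 N = ℚP.≤-trans (shift-≤ {0ℚ} {ε} {0ℚ} (ℚP.≤-trans (ℚP.<⇒≤ ε>0) (ℚP.≤-reflexive (sym (ℚP.+-identityʳ ε)))))
    (frac≥0 (f N) N)

liminf-one : ∀ (f : ℕ → ℕ) → (∀ m → m ≤ f m) →
  (∀ E N → Σ ℕ λ m → N ≤ m × suc E * f m ≤ suc E * m + m) → LiminfEq (λ m → frac (f m) m) 1ℚ
liminf-one f above often = lower , upper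
  where
  lower : (ε : ℚ) → 0ℚ ℚ.< ε → Σ ℕ λ N → (n : ℕ) → N ≤ n → 1ℚ ℚ.- ε ℚ.≤ frac (f n) n
  lower ε ε>0 = 1 , bound
    where
    bound : ∀ n → 1 ≤ n → 1ℚ ℚ.- ε ℚ.≤ frac (f n) n
    bound (suc n) _ = ℚP.≤-trans (shift-≤ {1ℚ} {ε} {1ℚ} (ℚP.≤-trans (ℚP.≤-reflexive (sym (ℚP.+-identityˡ 1ℚ)))
      (ℚP.+-monoˡ-≤ 1ℚ (ℚP.<⇒≤ ε>0)))) (frac-≤ 1 0 (f (suc n)) n (subst₂ _≤_ (sym (*-identityˡ (suc n)))
        (sym (*-identityʳ (f (suc n)))) (above (suc n))))
  upper : (ε : ℚ) → 0ℚ ℚ.< ε → (N : ℕ) → Σ ℕ λ n → N ≤ n × frac (f n) n ℚ.≤ 1ℚ ℚ.+ ε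
  upper ε ε>0 N with unit-below ε ε>0
  ... | E , E≤ε with often E (suc N)
  ... | suc m , N≤ , le = suc m , ≤-trans (n≤1+n N) N≤ , ℚP.≤-trans
    (subst (frac (f (suc m)) (suc m) ℚ.≤_) (sym (frac-+ 1 0 1 E)) (frac-≤ (f (suc m)) m (1 * suc E + 1 * 1) (E + 0 * suc E) close)) (ℚP.+-monoʳ-≤ 1ℚ E≤ε)
    where
    close : f (suc m) * (1 * suc E) ≤ (1 * suc E + 1 * 1) * suc m
    close = ≤-trans (≤-reflexive (trans (cong (f (suc m) *_) (*-identityˡ (suc E))) (*-comm (f (suc m)) (suc E))))
      (≤-trans le (≤-reflexive (eq E m)))
      where
      eq : ∀ E m → suc E * suc m + suc m ≡ (1 * suc E + 1 * 1) * suc m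
      eq = solve-∀

-- Normality and the Lempel–Ziv ratio

-- With j = k / 4, three of the four factors 2ʲ swallow the cube and the fourth the constant: k + 1
-- ≤ 4 · 2ʲ leaves 4³ c ≤ 2ʲ to be shown, for which k ≥ 4 · 64 c suffices.
cube-below-2^ : ∀ c k → c * 256 ≤ k → c * suc k ^ 3 ≤ 2 ^ k
cube-below-2^ c k 256c≤k with divide k 4
... | j , r , r<4 , refl = begin
  c * suc (j * 4 + r) ^ 3            ≤⟨ *-monoʳ-≤ c (^-monoˡ-≤ 3 sk≤) ⟩
  c * (4 * 2 ^ j) ^ 3                ≡⟨ expand c (2 ^ j) ⟩
  c * 64 * (2 ^ j * (2 ^ j * 2 ^ j)) ≤⟨ *-monoˡ-≤ _ (<⇒≤ (≤-<-trans 64c≤j (n<2^n j))) ⟩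
  2 ^ j * (2 ^ j * (2 ^ j * 2 ^ j))  ≡⟨ cong (λ x → 2 ^ j * (2 ^ j * (2 ^ j * x))) (*-identityʳ (2 ^ j)) ⟨
  (2 ^ j) ^ 4                        ≡⟨ ^-*-assoc 2 j 4 ⟩
  2 ^ (j * 4)                        ≤⟨ ^-monoʳ-≤ 2 (m≤m+n (j * 4) r) ⟩
  2 ^ (j * 4 + r)                    ∎
  where
  open ≤-Reasoning
  sk≤ : suc (j * 4 + r) ≤ 4 * 2 ^ j
  sk≤ = begin
    suc (j * 4 + r)  ≤⟨ +-monoʳ-< (j * 4) r<4 ⟩
    j * 4 + 4        ≡⟨ eq j ⟩
    4 * suc j        ≤⟨ *-monoʳ-≤ 4 (n<2^n j) ⟩
    4 * 2 ^ j        ∎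
    where
    eq : ∀ j → j * 4 + 4 ≡ 4 * suc j
    eq = solve-∀
  64c≤j : c * 64 ≤ j
  64c≤j = s≤s⁻¹ (*-cancelʳ-< 4 (c * 64) (suc j) (begin-strict
    c * 64 * 4       ≡⟨ *-assoc c 64 4 ⟩
    c * 256          ≤⟨ 256c≤k ⟩
    j * 4 + r        <⟨ +-monoʳ-< (j * 4) r<4 ⟩
    j * 4 + 4        ≡⟨ +-comm (j * 4) 4 ⟩
    suc j * 4        ∎))
  expand : ∀ c x → c * ((4 * x) * ((4 * x) * ((4 * x) * 1))) ≡ c * 64 * (x * (x * x))
  expand = solve-∀

k2^k≤st : ∀ k → k * 2 ^ k ≤ st k
k2^k≤st zero    = z≤n
k2^k≤st (suc k) = m≤n+m (len k) (st k)

k≤st : ∀ k → k ≤ st k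
k≤st k = ≤-trans (m≤m*n k (2 ^ k) {{m^n≢0 2 k}}) (k2^k≤st k)

beyond : ∀ K {k q} → q < len k → st K ≤ st k + q → K ≤ k
beyond K {k} {q} q< le = ≮⇒≥ λ k<K → <⇒≱ (≤-trans (+-monoʳ-< (st k) q<) (st-mono k<K)) le

ρ-lz : ρ-eq lzLength S 1ℚ
ρ-lz = liminf-one (λ m → lzLength (S ↾ m)) lz-lower often
  where
  often : ∀ E N → Σ ℕ λ m → N ≤ m × suc E * lzLength (S ↾ m) ≤ suc E * m + m
  often E N = st k , ≤-trans (m≤m+n N _) (k≤st k) , (begin
    suc E * lzLength (S ↾ st k)          ≤⟨ *-monoʳ-≤ (suc E) (lz-upper k) ⟩
    suc E * (st k + ph k * 2)            ≡⟨ *-distribˡ-+ (suc E) (st k) (ph k * 2) ⟩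
    suc E * st k + suc E * (ph k * 2)    ≤⟨ +-monoʳ-≤ (suc E * st k) excess ⟩
    suc E * st k + st k                  ∎)
    where
    open ≤-Reasoning
    k : ℕ
    -- The excess is two bits for each of fewer than 2 · 2ᵏ phrases, so at most 4 · 2ᵏ, against
    -- `st k` of at least k 2ᵏ.
    k = N + 4 * suc E
    excess : suc E * (ph k * 2) ≤ st k
    excess = begin
      suc E * (ph k * 2)         ≤⟨ *-monoʳ-≤ (suc E) (*-monoˡ-≤ 2 (≤-trans (m≤n+m (ph k) 2) (≤-reflexive (ph-2^ k)))) ⟩
      suc E * (2 * 2 ^ k * 2)    ≡⟨ eq (suc E) (2 ^ k) ⟩
      4 * suc E * 2 ^ k          ≤⟨ *-monoˡ-≤ (2 ^ k) (m≤n+m (4 * suc E) N) ⟩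
      k * 2 ^ k                  ≤⟨ k2^k≤st k ⟩
      st k                       ∎
      where
      eq : ∀ E x → E * (2 * x * 2) ≡ 4 * E * x
      eq = solve-∀

scaledOcc : Bits → ℕ → ℕ
scaledOcc w m = 2 ^ length w * occ w (S ↾ m)

EventuallyBelow EventuallyAbove : (ℕ → ℕ) → Set
EventuallyBelow f = ∀ E → Σ ℕ λ M → ∀ m → M ≤ m → suc E * f m ≤ suc E * m + m
EventuallyAbove f = ∀ E → Σ ℕ λ M → ∀ m → M ≤ m → suc E * m ≤ suc E * f m + m

occ-below : ∀ w → EventuallyBelow (scaledOcc w)
occ-below w E = st K , bound
  where
  c K : ℕ
  c = suc E * (2 ^ length w * (2 * length w + 9))
  K = suc (2 * suc E) + c * 256
  bound : ∀ m → st K ≤ m → suc E * scaledOcc w m ≤ suc E * m + m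
  bound m st≤m with locate m
  ... | position k q q< refl = begin
    suc E * scaledOcc w (st k + q)
      ≤⟨ *-monoʳ-≤ (suc E) (occ-upper w k q (<⇒≤ q<)) ⟩
    suc E * ((st k + q) + 2 * 2 ^ k + 2 ^ length w * ((2 * length w + 9) * (suc k * suc k)))
      ≡⟨ expand (suc E) (st k + q) (2 ^ k) (2 ^ length w) (2 * length w + 9) (suc k * suc k) ⟩
    suc E * (st k + q) + (2 * suc E * 2 ^ k + c * (suc k * suc k))
      ≤⟨ +-monoʳ-≤ (suc E * (st k + q)) (begin
           2 * suc E * 2 ^ k + c * (suc k * suc k)  ≤⟨ +-monoʳ-≤ (2 * suc E * 2 ^ k) (*-monoʳ-≤ c square≤cube) ⟩
           2 * suc E * 2 ^ k + c * suc k ^ 3        ≤⟨ +-monoʳ-≤ (2 * suc E * 2 ^ k) (cube-below-2^ c k (≤-trans (m≤n+m (c * 256) _) K≤k)) ⟩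
           2 * suc E * 2 ^ k + 2 ^ k                ≡⟨ +-comm _ (2 ^ k) ⟩
           suc (2 * suc E) * 2 ^ k                  ≤⟨ *-monoˡ-≤ (2 ^ k) (≤-trans (m≤m+n _ (c * 256)) K≤k) ⟩
           k * 2 ^ k                                ≤⟨ ≤-trans (k2^k≤st k) (m≤m+n (st k) q) ⟩
           st k + q                                 ∎) ⟩
    suc E * (st k + q) + (st k + q)  ∎
    where
    open ≤-Reasoning
    K≤k : K ≤ k
    K≤k = beyond K q< st≤m
    square≤cube : suc k * suc k ≤ suc k ^ 3
    square≤cube = *-monoʳ-≤ (suc k) (m≤m*n (suc k) (suc k * 1))
    expand : ∀ e m t a d n → e * (m + 2 * t + a * (d * n)) ≡ e * m + (2 * e * t + e * (a * d) * n)
    expand = solve-∀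

occ-[] : ∀ x → occ [] x ≡ suc (length x)
occ-[] []      = refl
occ-[] (a ∷ x) = cong suc (occ-[] x)

length-↾ : ∀ f m → length (f ↾ m) ≡ m
length-↾ f m = trans (cong length (↾-win f m)) (length-win f 0 m)

occ-split : ∀ b w x → occ w x ≤ suc (occ (b ∷ w) x + occ (not b ∷ w) x)
occ-split b w x = ≤-trans (≤-reflexive (occ-∷ w x)) (+-mono-≤ (bit≤1 (isPrefix w x)) (≤-reflexive (order b)))
  where
  order : ∀ b → occ (false ∷ w) x + occ (true ∷ w) x ≡ occ (b ∷ w) x + occ (not b ∷ w) x
  order false = refl
  order true  = +-comm (occ (false ∷ w) x) _

-- Lower bounds come from upper ones: every occurrence of w but one extends to the left by b or by
-- its complement, and the share of the complement is bounded above.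
occ-above : ∀ w → EventuallyAbove (scaledOcc w)
occ-above [] E = 0 , λ m _ → ≤-trans (*-monoʳ-≤ (suc E) (≤-trans (n≤1+n m) (≤-reflexive (sym (trans (+-identityʳ _)
  (trans (occ-[] (S ↾ m)) (cong suc (length-↾ S m)))))))) (m≤m+n _ m)
-- At precision 4 (E + 1) the bound for w enters twice and that for the sister word once, which is
-- three quarters of the allowed error; the boundary term 8 (E + 1) 2^(length w) takes the last
-- quarter.
occ-above (b ∷ w) E with occ-above w (3 + 4 * E) | occ-below (not b ∷ w) (3 + 4 * E)
... | M₁ , above | M₂ , below = M₁ + M₂ + 8 * suc E * 2 ^ length w , bound
  where
  bound : ∀ m → M₁ + M₂ + 8 * suc E * 2 ^ length w ≤ m → suc E * m ≤ suc E * scaledOcc (b ∷ w) m + m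
  bound m le = *-cancelˡ-≤ 4 (+-cancelʳ-≤ (F * m + 2 * (F * X) + F * Y) _ _ (begin
    4 * (suc E * m) + (F * m + 2 * (F * X) + F * Y)
      ≡⟨ eq₁ E m X Y ⟩
    2 * (F * m) + F * (2 * X) + F * Y
      ≤⟨ +-mono-≤ (+-mono-≤ (*-monoʳ-≤ 2 (above m M₁≤)) (*-monoʳ-≤ F halves)) (below m M₂≤) ⟩
    2 * (F * X + m) + F * (2 * a + (O + Y)) + (F * m + m)
      ≡⟨ eq₂ E m X Y O a ⟩
    4 * (suc E * O) + 3 * m + 8 * suc E * a + (F * m + 2 * (F * X) + F * Y)
      ≤⟨ +-monoˡ-≤ _ (≤-trans (+-monoʳ-≤ (4 * (suc E * O) + 3 * m) a≤) (≤-reflexive (eq₃ E m O))) ⟩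
    4 * (suc E * O + m) + (F * m + 2 * (F * X) + F * Y)  ∎))
    where
    open ≤-Reasoning
    F X Y O a : ℕ
    F = suc (3 + 4 * E)
    X = scaledOcc w m
    Y = scaledOcc (not b ∷ w) m
    O = scaledOcc (b ∷ w) m
    a = 2 ^ length w
    M₁≤ : M₁ ≤ m
    M₁≤ = ≤-trans (≤-trans (m≤m+n M₁ M₂) (m≤m+n _ _)) le
    M₂≤ : M₂ ≤ m
    M₂≤ = ≤-trans (≤-trans (m≤n+m M₂ M₁) (m≤m+n _ _)) le
    a≤ : 8 * suc E * a ≤ m
    a≤ = ≤-trans (m≤n+m _ (M₁ + M₂)) le
    halves : 2 * X ≤ 2 * a + (O + Y)
    halves = ≤-trans (*-monoʳ-≤ 2 (*-monoʳ-≤ a (occ-split b w (S ↾ m))))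
      (≤-reflexive (eq a (occ (b ∷ w) (S ↾ m)) (occ (not b ∷ w) (S ↾ m))))
      where
      eq : ∀ a o y → 2 * (a * suc (o + y)) ≡ 2 * a + (2 * a * o + 2 * a * y)
      eq = solve-∀
    eq₁ : ∀ E m X Y → 4 * (suc E * m) + (suc (3 + 4 * E) * m + 2 * (suc (3 + 4 * E) * X) + suc (3 + 4 * E) * Y)
      ≡ 2 * (suc (3 + 4 * E) * m) + suc (3 + 4 * E) * (2 * X) + suc (3 + 4 * E) * Y
    eq₁ = solve-∀
    eq₂ : ∀ E m X Y O a → 2 * (suc (3 + 4 * E) * X + m) + suc (3 + 4 * E) * (2 * a + (O + Y)) + (suc (3 + 4 * E) * m + m)
      ≡ 4 * (suc E * O) + 3 * m + 8 * suc E * a + (suc (3 + 4 * E) * m + 2 * (suc (3 + 4 * E) * X) + suc (3 + 4 * E) * Y)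
    eq₂ = solve-∀
    eq₃ : ∀ E m O → 4 * (suc E * O) + 3 * m + m ≡ 4 * (suc E * O + m)
    eq₃ = solve-∀

S-normal : Normal S
S-normal w = subst (λ a → Limit (λ n → frac (occ w (S ↾ n)) n) (frac 1 a)) sa
  (limit-frac (λ m → occ w (S ↾ m)) d near)
  where
  d : ℕ
  d = pred (2 ^ length w)
  sa : suc d ≡ 2 ^ length w
  sa = suc-pred (2 ^ length w) {{m^n≢0 2 (length w)}}
  near : EventuallyNear (λ m → suc d * occ w (S ↾ m))
  near E with occ-below w E | occ-above w E
  ... | M₁ , below | M₂ , above = M₁ + M₂ , λ m le → subst (λ a →
    suc E * (a * occ w (S ↾ m)) ≤ suc E * m + m × suc E * m ≤ suc E * (a * occ w (S ↾ m)) + m) (sym sa)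
    (below m (≤-trans (m≤m+n M₁ M₂) le) , above m (≤-trans (m≤n+m M₂ M₁) le))

-- Probabilities emitted by PPM*

∧-true : ∀ {a b} → a ∧ b ≡ true → a ≡ true × b ≡ true
∧-true {true} {true} _ = refl , refl

<ᵇ-true : ∀ {m n} → m < n → (m <ᵇ n) ≡ true
<ᵇ-true {m} {n} lt with m <ᵇ n | <⇒<ᵇ lt
... | true | _ = refl

<ᵇ-true⁻¹ : ∀ {m n} → (m <ᵇ n) ≡ true → m < n
<ᵇ-true⁻¹ {m} {n} eq = <ᵇ⇒< m n (subst Data.Bool.T (sym eq) _)

isPrefix-∷ʳ : ∀ c b x → isPrefix (c ∷ʳ b) x ≡ true → isPrefix c x ≡ true
isPrefix-∷ʳ []      b x       eq = refl
isPrefix-∷ʳ (a ∷ c) b (z ∷ x) eq with a BP.≟ z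
... | yes _ = isPrefix-∷ʳ c b x eq

isPrefix-exclusive : ∀ c x → isPrefix (c ∷ʳ false) x ≡ true → isPrefix (c ∷ʳ true) x ≡ true → ⊥
isPrefix-exclusive []      (false ∷ x) p ()
isPrefix-exclusive []      (true ∷ x)  () q
isPrefix-exclusive (a ∷ c) (z ∷ x)     p q with a BP.≟ z
... | yes _ = isPrefix-exclusive c x p q

-- Only an inequality, because an occurrence of `c` at the very end of `x` has no successor.
cnt-sum : ∀ c x → cnt c false x + cnt c true x ≤ occ c x
cnt-sum c x = go x
  where
  bits : ∀ x → bit (isPrefix (c ∷ʳ false) x) + bit (isPrefix (c ∷ʳ true) x) ≤ bit (isPrefix c x)
  bits x with isPrefix (c ∷ʳ false) x in p | isPrefix (c ∷ʳ true) x in q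
  ... | true  | true  = ⊥-elim (isPrefix-exclusive c x p q)
  ... | true  | false = ≤-reflexive (cong bit (sym (isPrefix-∷ʳ c false x p)))
  ... | false | true  = ≤-reflexive (cong bit (sym (isPrefix-∷ʳ c true x q)))
  ... | false | false = z≤n
  go : ∀ x → occ (c ∷ʳ false) x + occ (c ∷ʳ true) x ≤ occ c x
  go []      = subst₂ _≤_ (cong₂ _+_ (sym (if-bit (isPrefix (c ∷ʳ false) []))) (sym (if-bit (isPrefix (c ∷ʳ true) []))))
    (sym (if-bit (isPrefix c []))) (bits [])
  go (a ∷ x) = begin
    (if isPrefix (c ∷ʳ false) (a ∷ x) then 1 else 0) + f + ((if isPrefix (c ∷ʳ true) (a ∷ x) then 1 else 0) + t)
      ≡⟨ cong₂ (λ i j → i + f + (j + t)) (if-bit (isPrefix (c ∷ʳ false) (a ∷ x))) (if-bit (isPrefix (c ∷ʳ true) (a ∷ x))) ⟩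
    i + f + (j + t)                              ≡⟨ rearrange i f j t ⟩
    i + j + (f + t)                              ≤⟨ +-mono-≤ (bits (a ∷ x)) (go x) ⟩
    bit (isPrefix c (a ∷ x)) + occ c x           ≡⟨ cong (_+ occ c x) (if-bit (isPrefix c (a ∷ x))) ⟨
    occ c (a ∷ x)                                ∎
    where
    open ≤-Reasoning
    f t i j : ℕ
    f = occ (c ∷ʳ false) x
    t = occ (c ∷ʳ true) x
    i = bit (isPrefix (c ∷ʳ false) (a ∷ x))
    j = bit (isPrefix (c ∷ʳ true) (a ∷ x))
    rearrange : ∀ i f j t → i + f + (j + t) ≡ i + j + (f + t)
    rearrange = solve-∀

cnt-≤ : ∀ c b x → cnt c b x ≤ occ c x
cnt-≤ c false x = ≤-trans (m≤m+n _ _) (cnt-sum c x)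
cnt-≤ c true  x = ≤-trans (m≤n+m _ _) (cnt-sum c x)

occ-tail : ∀ b w x → occ (b ∷ w) x ≤ occ w x
occ-tail b w x = ≤-trans (≤-trans (part b) (m≤n+m _ (bit (isPrefix w x)))) (≤-reflexive (sym (occ-∷ w x)))
  where
  part : ∀ b → occ (b ∷ w) x ≤ occ (false ∷ w) x + occ (true ∷ w) x
  part false = m≤m+n _ _
  part true  = m≤n+m _ _

occ-suffix : ∀ u w x → occ (u ++ w) x ≤ occ w x
occ-suffix []      w x = ≤-refl
occ-suffix (b ∷ u) w x = ≤-trans (occ-tail b (u ++ w) x) (occ-suffix u w x)

suffix-suffix : ∀ {k ℓ} x → k ≤ ℓ → ℓ ≤ length x → Σ Bits λ u → suffix ℓ x ≡ u ++ suffix k x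
suffix-suffix {k} {ℓ} x k≤ℓ ℓ≤ = take (ℓ ∸ k) y , (begin
  y                                                     ≡⟨ take++drop≡id (ℓ ∸ k) y ⟨
  take (ℓ ∸ k) y ++ drop (ℓ ∸ k) (drop (length x ∸ ℓ) x) ≡⟨ cong (take (ℓ ∸ k) y ++_) (drop-drop (length x ∸ ℓ) (ℓ ∸ k) x) ⟩
  take (ℓ ∸ k) y ++ drop (length x ∸ ℓ + (ℓ ∸ k)) x     ≡⟨ cong (λ n → take (ℓ ∸ k) y ++ drop n x) offset ⟩
  take (ℓ ∸ k) y ++ suffix k x                          ∎)
  where
  open ≡-Reasoning
  y : Bits
  y = suffix ℓ x
  offset : length x ∸ ℓ + (ℓ ∸ k) ≡ length x ∸ k
  offset = trans (sym (+-∸-assoc (length x ∸ ℓ) k≤ℓ)) (cong (_∸ k) (m∸n+n≡m ℓ≤))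

occ-suffix-mono : ∀ {k ℓ} x → k ≤ ℓ → ℓ ≤ length x → occ (suffix ℓ x) x ≤ occ (suffix k x) x
occ-suffix-mono {k} x k≤ℓ ℓ≤ with suffix-suffix x k≤ℓ ℓ≤
... | u , eq = ≤-trans (≤-reflexive (cong (λ c → occ c x) eq)) (occ-suffix u (suffix k x) x)

cnt-suffix-mono : ∀ {k ℓ} b x → k ≤ ℓ → ℓ ≤ length x → cnt (suffix ℓ x) b x ≤ cnt (suffix k x) b x
cnt-suffix-mono {k} b x k≤ℓ ℓ≤ with suffix-suffix x k≤ℓ ℓ≤
... | u , eq = ≤-trans (≤-reflexive (cong (λ c → occ c x) (trans (cong (_∷ʳ b) eq) (++-assoc u (suffix k x) (b ∷ [])))))
      (occ-suffix u (suffix k x ∷ʳ b) x)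

dropLast-∷ʳ : ∀ a c → Σ Bool λ z → a ∷ c ≡ dropLast (a ∷ c) ∷ʳ z
dropLast-∷ʳ a []      = a , refl
dropLast-∷ʳ a (b ∷ c) with dropLast-∷ʳ b c
... | z , eq = z , cong (a ∷_) eq

-- Two continuations meet both conditions of the model: there is a prediction, and dropping the last
-- bit cannot lower the number of occurrences below two.
inModel-intro : ∀ c x → 2 ≤ cnt c false x + cnt c true x → inModel c x ≡ true
inModel-intro []      x le = refl
inModel-intro (a ∷ c) x le with dropLast-∷ʳ a c
... | z , eq = cong₂ _∧_ (<ᵇ-true (s≤s (≤-trans (s≤s z≤n) le))) (<ᵇ-true (≤-trans le (≤-trans (cnt-sum (a ∷ c) x)
      (≤-trans (≤-reflexive (cong (λ w → occ w x) eq)) (cnt-≤ (dropLast (a ∷ c)) z x)))))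

inModel-cnt : ∀ c x → inModel c x ≡ true → length c ≡ 0 ⊎ 1 ≤ cnt c false x + cnt c true x
inModel-cnt []      x _  = inj₁ refl
inModel-cnt (a ∷ c) x eq = inj₂ (s≤s⁻¹ (<ᵇ-true⁻¹ (proj₁ (∧-true eq))))

filterᵇ-∈⁺ : ∀ p {k} L → k ∈ L → p k ≡ true → k ∈ filterᵇ p L
filterᵇ-∈⁺ p (j ∷ L) (here refl) pk rewrite pk = here refl
filterᵇ-∈⁺ p (j ∷ L) (there k∈)  pk with p j
... | true  = there (filterᵇ-∈⁺ p L k∈ pk)
... | false = filterᵇ-∈⁺ p L k∈ pk

filterᵇ-∈⁻ : ∀ p {k} L → k ∈ filterᵇ p L → k ∈ L × p k ≡ true
filterᵇ-∈⁻ p (j ∷ L) k∈ with p j in eq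
filterᵇ-∈⁻ p (j ∷ L) (here refl) | true = here refl , eq
filterᵇ-∈⁻ p (j ∷ L) (there k∈)  | true = let (q , r) = filterᵇ-∈⁻ p L k∈ in there q , r
... | false = let (q , r) = filterᵇ-∈⁻ p L k∈ in there q , r

Ascending : List ℕ → Set
Ascending = AllPairs _<_

filterᵇ-ascending : ∀ p {L} → Ascending L → Ascending (filterᵇ p L)
filterᵇ-ascending p {[]}    []         = []
filterᵇ-ascending p {j ∷ L} (j< ∷ asc) with p j
... | true  = All.tabulate (λ k∈ → All.lookup j< (proj₁ (filterᵇ-∈⁻ p L k∈))) ∷ filterᵇ-ascending p asc
... | false = filterᵇ-ascending p asc

ascending-head : ∀ {j L k} → Ascending (j ∷ L) → k ∈ j ∷ L → j ≤ k
ascending-head asc        (here refl) = ≤-refl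
ascending-head (j< ∷ _)   (there k∈)  = <⇒≤ (All.lookup j< k∈)

ascending-last : ∀ L {j k} → Ascending (L ∷ʳ j) → k ∈ L ∷ʳ j → k ≤ j
ascending-last []      asc         (here refl) = ≤-refl
ascending-last (i ∷ L) (i< ∷ asc)  (here refl) = <⇒≤ (All.lookup i< (∈-++⁺ʳ L (here refl)))
ascending-last (i ∷ L) (_ ∷ asc)   (there k∈)  = ascending-last L asc k∈

lastOr-∷ʳ : ∀ d L j → lastOr d (L ∷ʳ j) ≡ j
lastOr-∷ʳ d []      j = refl
lastOr-∷ʳ d (i ∷ L) j = lastOr-∷ʳ i L j

last-largest : ∀ d L {k} → Ascending L → k ∈ L → lastOr d L ∈ L × k ≤ lastOr d L
last-largest d L asc k∈ with initLast L
last-largest d .(L ∷ʳ j) asc k∈ | L ∷ʳ′ j rewrite lastOr-∷ʳ d L j = ∈-++⁺ʳ L (here refl) , ascending-last L asc k∈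

reverse-largest : ∀ L {k} → Ascending L → k ∈ L → Σ ℕ λ j → Σ (List ℕ) λ R → reverse L ≡ j ∷ R × j ∈ L × k ≤ j
reverse-largest L asc k∈ with initLast L
reverse-largest .(L ∷ʳ j) asc k∈ | L ∷ʳ′ j = j , reverse L , reverse-++ L (j ∷ []) , ∈-++⁺ʳ L (here refl) , ascending-last L asc k∈

relevant-ascending : ∀ x → Ascending (relevant x)
relevant-ascending x = filterᵇ-ascending _ (AllPairsP.applyUpTo⁺₁ (λ k → k) (suc (length x)) (λ i<j _ → i<j))

relevant-intro : ∀ x {k} → k ≤ length x → inModel (suffix k x) x ≡ true → k ∈ relevant x
relevant-intro x k≤ = filterᵇ-∈⁺ _ (upTo (suc (length x))) (∈-upTo⁺ (s≤s k≤))

relevant-elim : ∀ x {k} → k ∈ relevant x → k ≤ length x × inModel (suffix k x) x ≡ true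
relevant-elim x k∈ = let (q , r) = filterᵇ-∈⁻ _ (upTo (suc (length x))) k∈ in s≤s⁻¹ (∈-upTo⁻ q) , r

deterministic : Bits → ℕ → Bool
deterministic x k = esc (suffix k x) x ≡ᵇ 1

-- Characterises `startLen` by order instead of by list filtering; minimality makes all shorter
-- relevant contexts nondeterministic.
data Start (x : Bits) : Set where
  shortest : startLen x ∈ relevant x → deterministic x (startLen x) ≡ true →
    (∀ {j} → j ∈ relevant x → deterministic x j ≡ true → startLen x ≤ j) → Start x
  longest  : startLen x ≡ lastOr 0 (relevant x) → (∀ {j} → j ∈ relevant x → deterministic x j ≡ false) → Start x

start : ∀ x → Start x
start x with filterᵇ (deterministic x) (relevant x) in eq
             | filterᵇ-ascending (deterministic x) (relevant-ascending x)
             | (λ {j} → filterᵇ-∈⁻ (deterministic x) {j} (relevant x))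
             | (λ {j} → filterᵇ-∈⁺ (deterministic x) {j} (relevant x))
... | [] | _ | _ | intro = longest start≡ (λ j∈ → BP.¬-not (λ det → case intro j∈ det of λ ()))
  where
  start≡ : startLen x ≡ lastOr 0 (relevant x)
  start≡ rewrite eq = refl
... | k ∷ L | asc | elim | intro = shortest (subst (_∈ relevant x) (sym start≡) (proj₁ (elim (here refl))))
        (subst (λ k → deterministic x k ≡ true) (sym start≡) (proj₂ (elim (here refl))))
        (λ {j} j∈ det → subst (_≤ j) (sym start≡) (ascending-head asc (intro j∈ det)))
  where
  start≡ : startLen x ≡ k
  start≡ rewrite eq = refl

pos-positive : ∀ n → 0 < n → pos n ≡ 1
pos-positive (suc n) _ = refl

pos≤1 : ∀ n → pos n ≤ 1
pos≤1 zero    = z≤n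
pos≤1 (suc n) = ≤-refl

-- The escape count is 0, 1 or 2; a prediction excludes 0 and nondeterminism excludes 1.
nondeterministic-both : ∀ x {k} b → deterministic x k ≡ false → 1 ≤ cnt (suffix k x) false x + cnt (suffix k x) true x →
  0 < cnt (suffix k x) b x
nondeterministic-both x {k} b nd le = both-positive b (cnt (suffix k x) false x) (cnt (suffix k x) true x) refl refl nd le
  where
  both-positive : ∀ b f t → f ≡ cnt (suffix k x) false x → t ≡ cnt (suffix k x) true x →
    (pos f + pos t ≡ᵇ 1) ≡ false → 1 ≤ f + t → 0 < cnt (suffix k x) b x
  both-positive false (suc f) (suc t) eq _  _ _ = ≤-trans (s≤s z≤n) (≤-reflexive eq)
  both-positive true  (suc f) (suc t) _  eq _ _ = ≤-trans (s≤s z≤n) (≤-reflexive eq)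
  both-positive b     zero    zero    _ _ _ ()
  both-positive b     (suc f) zero    _ _ () _
  both-positive b     zero    (suc t) _ _ () _

tot-≤ : ∀ {k ℓ} x → k ≤ ℓ → ℓ ≤ length x → tot (suffix ℓ x) x ≤ occ (suffix k x) x + 2
tot-≤ {k} {ℓ} x k≤ℓ ℓ≤ = +-mono-≤ (≤-trans (cnt-sum (suffix ℓ x) x) (occ-suffix-mono x k≤ℓ ℓ≤)) (+-mono-≤ (pos≤1 (cnt (suffix ℓ x) false x)) (pos≤1 (cnt (suffix ℓ x) true x)))

-- P ≥ X / Y, with denominators cleared.
infix 4 _≥_⟋_
record _≥_⟋_ (P : ℚ) (X Y : ℕ) : Set where
  constructor scaled
  field
    unscale : frac X 1 ℚ.≤ P ℚ.* frac Y 1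

frac-nonNeg : ∀ a → ℚ.NonNegative (frac a 1)
frac-nonNeg a = ℚ.nonNegative (frac-≤ 0 0 a 0 z≤n)

≥⟋-* : ∀ {P Q X X′ Y Y′} → P ≥ X ⟋ Y → Q ≥ X′ ⟋ Y′ → P ℚ.* Q ≥ X * X′ ⟋ Y * Y′
≥⟋-* {P} {Q} {X} {X′} {Y} {Y′} (scaled p) (scaled q) = scaled (begin
  frac (X * X′) 1                                       ≡⟨ frac-* X 0 X′ 0 ⟨
  frac X 1 ℚ.* frac X′ 1                                ≤⟨ ℚP.*-monoˡ-≤-nonNeg (frac X 1) {{frac-nonNeg X}} q ⟩
  frac X 1 ℚ.* (Q ℚ.* frac Y′ 1)                        ≤⟨ ℚP.*-monoʳ-≤-nonNeg (Q ℚ.* frac Y′ 1) {{Q≥0}} p ⟩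
  P ℚ.* frac Y 1 ℚ.* (Q ℚ.* frac Y′ 1)                  ≡⟨ interchange P (frac Y 1) Q (frac Y′ 1) ⟩
  P ℚ.* Q ℚ.* (frac Y 1 ℚ.* frac Y′ 1)                  ≡⟨ cong (P ℚ.* Q ℚ.*_) (frac-* Y 0 Y′ 0) ⟩
  P ℚ.* Q ℚ.* frac (Y * Y′) 1                           ∎)
  where
  open ℚP.≤-Reasoning
  Q≥0 : ℚ.NonNegative (Q ℚ.* frac Y′ 1)
  Q≥0 = ℚ.nonNegative (ℚP.≤-trans (frac-≤ 0 0 X′ 0 z≤n) q)

frac-≥ : ∀ {X Y} c t → 0 < t → X * t ≤ c * Y → frac c t ≥ X ⟋ Y
frac-≥ {X} {Y} c (suc t) _ le = scaled (subst (frac X 1 ℚ.≤_) (sym (frac-* c t Y 0))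
  (frac-≤ X 0 (c * Y) (t * 1) (subst₂ _≤_ (cong (X *_) (sym (*-identityʳ (suc t)))) (sym (*-identityʳ (c * Y))) le)))

prod-single : ∀ {P X Y} → P ≥ X ⟋ Y → prodℚ (P ∷ []) ≥ X ⟋ Y
prod-single {P} {X} {Y} p = subst (_≥ X ⟋ Y) (sym (ℚP.*-identityʳ P)) p

chain-emit : ∀ x b j rest → 0 < cnt (suffix j x) b x →
  emitChain x b (j ∷ rest) ≡ frac (cnt (suffix j x) b x) (tot (suffix j x) x) ∷ []
chain-emit x b j rest c>0 with 0 <ᵇ cnt (suffix j x) b x | <⇒<ᵇ c>0
... | true | _ = refl

chain-escape : ∀ x b j rest → cnt (suffix j x) b x ≡ 0 → 0 < esc (suffix j x) x → 0 < j →
  emitChain x b (j ∷ rest) ≡ frac (esc (suffix j x) x) (tot (suffix j x) x) ∷ emitChain x b rest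
chain-escape x b j@(suc _) rest c≡0 e>0 _ rewrite c≡0 with 0 <ᵇ esc (suffix j x) x | <⇒<ᵇ e>0
... | true | _ = refl

cnt-≤-tot : ∀ c b x → cnt c b x ≤ tot c x
cnt-≤-tot c false x = ≤-trans (m≤m+n _ (cnt c true x)) (m≤m+n _ _)
cnt-≤-tot c true  x = ≤-trans (m≤n+m _ (cnt c false x)) (m≤m+n _ _)

esc-≤-tot : ∀ c x → esc c x ≤ tot c x
esc-≤-tot c x = m≤n+m (esc c x) (cnt c false x + cnt c true x)

esc-positive : ∀ c x → 1 ≤ cnt c false x + cnt c true x → 0 < esc c x
esc-positive c x le with cnt c false x | cnt c true x
... | suc _ | _     = s≤s z≤n
... | zero  | suc _ = s≤s z≤n

-- Contexts of length at most k have seen both bits.  A starting context without bit b is therefore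
-- longer than k and deterministic, and the next relevant context already emits b.
emitted-lower : ∀ x b k W → k ≤ length x → 0 < cnt (suffix k x) false x → 0 < cnt (suffix k x) true x →
  occ (suffix k x) x + 2 ≤ W → prodℚ (emitted x b) ≥ 1 ⟋ W * W
emitted-lower x b k W k≤ f>0 t>0 ≤W = go (start x)
  where
  R : List ℕ
  R = relevant x
  s : ℕ
  s = startLen x
  both-short : ∀ {j} b → j ≤ k → 0 < cnt (suffix j x) b x
  both-short false j≤k = ≤-trans f>0 (cnt-suffix-mono false x j≤k k≤)
  both-short true  j≤k = ≤-trans t>0 (cnt-suffix-mono true x j≤k k≤)
  k∈R : k ∈ R
  k∈R = relevant-intro x k≤ (inModel-intro (suffix k x) x (+-mono-≤ f>0 t>0))
  seen : ∀ {j} → j ∈ R → 1 ≤ cnt (suffix j x) false x + cnt (suffix j x) true x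
  seen {j} j∈ with j ≤? k
  ... | yes j≤k = ≤-trans (both-short false j≤k) (m≤m+n _ _)
  ... | no j≰k with inModel-cnt (suffix j x) x (proj₂ (relevant-elim x j∈))
  ...   | inj₂ le = le
  ...   | inj₁ l≡0 = ⊥-elim (j≰k (≤-trans (≤-reflexive (trans (sym length-suffix) l≡0)) z≤n))
    where
    length-suffix : length (suffix j x) ≡ j
    length-suffix = trans (length-drop (length x ∸ j) x) (m∸[m∸n]≡n (proj₁ (relevant-elim x j∈)))
  both : ∀ {j} → j ∈ R → deterministic x j ≡ false → 0 < cnt (suffix j x) b x
  both {j} j∈ nd = nondeterministic-both x {j} b nd (seen j∈)
  W≤W² : W ≤ W * W
  W≤W² = m≤m² W
  tot≤W : ∀ {j} → k ≤ j → j ∈ R → tot (suffix j x) x ≤ W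
  tot≤W k≤j j∈ = ≤-trans (tot-≤ x k≤j (proj₁ (relevant-elim x j∈))) ≤W
  factor : ∀ {j} c → k ≤ j → j ∈ R → 0 < c → c ≤ tot (suffix j x) x → frac c (tot (suffix j x) x) ≥ 1 ⟋ W
  factor {j} c k≤j j∈ c>0 c≤ = frac-≥ c _ (≤-trans c>0 c≤)
    (≤-trans (≤-reflexive (*-identityˡ _)) (≤-trans (tot≤W k≤j j∈) (m≤n*m W c {{>-nonZero c>0}})))
  factor² : ∀ {j} c → k ≤ j → j ∈ R → 0 < c → c ≤ tot (suffix j x) x → frac c (tot (suffix j x) x) ≥ 1 ⟋ W * W
  factor² {j} c k≤j j∈ c>0 c≤ = frac-≥ c _ (≤-trans c>0 c≤)
    (≤-trans (≤-reflexive (*-identityˡ _)) (≤-trans (≤-trans (tot≤W k≤j j∈) W≤W²) (m≤n*m (W * W) c {{>-nonZero c>0}})))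
  emits : ∀ {j} rest → k ≤ j → j ∈ R → 0 < cnt (suffix j x) b x → prodℚ (emitChain x b (j ∷ rest)) ≥ 1 ⟋ W
  emits {j} rest k≤j j∈ c>0 rewrite chain-emit x b j rest c>0 =
    prod-single {Y = W} (factor (cnt (suffix j x) b x) k≤j j∈ c>0 (cnt-≤-tot (suffix j x) b x))
  emits² : ∀ {j} rest → k ≤ j → j ∈ R → 0 < cnt (suffix j x) b x → prodℚ (emitChain x b (j ∷ rest)) ≥ 1 ⟋ W * W
  emits² {j} rest k≤j j∈ c>0 rewrite chain-emit x b j rest c>0 =
    prod-single {Y = W * W} (factor² (cnt (suffix j x) b x) k≤j j∈ c>0 (cnt-≤-tot (suffix j x) b x))
  shorter : List ℕ
  shorter = reverse (filterᵇ (λ j → j <ᵇ s) R)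
  go : Start x → prodℚ (emitChain x b (s ∷ shorter)) ≥ 1 ⟋ W * W
  go (longest s≡ nd) with last-largest 0 R (relevant-ascending x) k∈R
  ... | l∈ , k≤l = emits² shorter (subst (k ≤_) (sym s≡) k≤l) s∈ (both s∈ (nd s∈))
    where
    s∈ : s ∈ R
    s∈ = subst (_∈ R) (sym s≡) l∈
  go (shortest s∈ det least) with s ≤? k
  ... | yes s≤k = ⊥-elim (both-deterministic (both-short false s≤k) (both-short true s≤k))
    where
    both-deterministic : 0 < cnt (suffix s x) false x → 0 < cnt (suffix s x) true x → ⊥
    both-deterministic p q = case trans (sym det) (cong (_≡ᵇ 1) (cong₂ _+_ (pos-positive (cnt (suffix s x) false x) p) (pos-positive (cnt (suffix s x) true x) q))) of λ ()
  ... | no s≰k with cnt (suffix s x) b x ≟ 0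
  ...   | no c≢0 = emits² shorter (<⇒≤ (≰⇒> s≰k)) s∈ (n≢0⇒n>0 c≢0)
  ...   | yes c≡0 with reverse-largest (filterᵇ (λ j → j <ᵇ s) R) (filterᵇ-ascending _ (relevant-ascending x))
                        (filterᵇ-∈⁺ _ R k∈R (<ᵇ-true (≰⇒> s≰k)))
  -- The escape leads to the longest relevant context below `s`. By minimality of `s` it is not
  -- deterministic, so it has seen both bits and no second escape occurs.
  ...     | j , rest , rev≡ , j∈ , k≤j = subst (λ l → prodℚ l ≥ 1 ⟋ W * W)
              (sym (trans (chain-escape x b s shorter c≡0 e>0 (≤-trans (s≤s z≤n) (≰⇒> s≰k)))
                (cong (λ r → frac (esc (suffix s x) x) (tot (suffix s x) x) ∷ emitChain x b r) rev≡)))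
              (≥⟋-* {Y = W} {Y′ = W} (factor (esc (suffix s x) x) (<⇒≤ (≰⇒> s≰k)) s∈ e>0 (esc-≤-tot (suffix s x) x))
                (emits rest k≤j j∈R (both j∈R nd)))
    where
    e>0 : 0 < esc (suffix s x) x
    e>0 = esc-positive (suffix s x) x (seen s∈)
    j∈R : j ∈ R
    j∈R = proj₁ (filterᵇ-∈⁻ _ R j∈)
    nd : deterministic x j ≡ false
    nd = BP.¬-not (λ d → <⇒≱ (<ᵇ-true⁻¹ (proj₂ (filterᵇ-∈⁻ _ R j∈))) (least j∈R d))

-- The shortest deterministic context is a suffix of the one of length ℓ, so it too was followed by
-- `b` at least `K` times, and being deterministic never by the other bit. `2 ≤ K` puts the long
-- context into the model.
emitted-deterministic : ∀ x b ℓ K → 2 ≤ K → ℓ ≤ length x → K ≤ cnt (suffix ℓ x) b x → cnt (suffix ℓ x) (not b) x ≡ 0 →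
  prodℚ (emitted x b) ≥ K ⟋ suc K
emitted-deterministic x b ℓ K 2≤K ℓ≤ K≤ none = go (start x)
  where
  s : ℕ
  s = startLen x
  order : ∀ b c → cnt c false x + cnt c true x ≡ cnt c b x + cnt c (not b) x
  order false c = refl
  order true  c = +-comm (cnt c false x) _
  esc-order : ∀ b c → esc c x ≡ pos (cnt c b x) + pos (cnt c (not b) x)
  esc-order false c = refl
  esc-order true  c = +-comm (pos (cnt c false x)) _
  ℓ∈ : ℓ ∈ relevant x
  ℓ∈ = relevant-intro x ℓ≤ (inModel-intro (suffix ℓ x) x
    (≤-trans 2≤K (≤-trans K≤ (≤-trans (m≤m+n _ _) (≤-reflexive (sym (order b (suffix ℓ x))))))))
  det : deterministic x ℓ ≡ true
  det = cong (_≡ᵇ 1) (trans (esc-order b (suffix ℓ x))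
    (cong₂ _+_ (pos-positive (cnt (suffix ℓ x) b x) (≤-trans (≤-trans (s≤s z≤n) 2≤K) K≤)) (cong pos none)))
  shorter : List ℕ
  shorter = reverse (filterᵇ (λ j → j <ᵇ s) (relevant x))
  go : Start x → prodℚ (emitChain x b (s ∷ shorter)) ≥ K ⟋ suc K
  go (longest _ nd) = case trans (sym (nd ℓ∈)) det of λ ()
  go (shortest s∈ s-det least) = subst (λ l → prodℚ l ≥ K ⟋ suc K) (sym (chain-emit x b s shorter c>0))
    (prod-single {Y = suc K} (frac-≥ c _ (≤-trans c>0 (cnt-≤-tot (suffix s x) b x)) (begin
      K * tot (suffix s x) x   ≡⟨ cong (K *_) tot≡ ⟩
      K * suc c                ≡⟨ *-suc K c ⟩
      K + K * c                ≤⟨ +-monoˡ-≤ (K * c) K≤c ⟩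
      c + K * c                ≡⟨ *-comm (suc K) c ⟩
      c * suc K                ∎)))
    where
    open ≤-Reasoning
    c : ℕ
    c = cnt (suffix s x) b x
    K≤c : K ≤ c
    K≤c = ≤-trans K≤ (cnt-suffix-mono b x (least ℓ∈ det) ℓ≤)
    c>0 : 0 < c
    c>0 = ≤-trans (≤-trans (s≤s z≤n) 2≤K) K≤c
    esc≡1 : esc (suffix s x) x ≡ 1
    esc≡1 = ≡ᵇ⇒≡ _ 1 (subst Data.Bool.T (sym s-det) _)
    other : cnt (suffix s x) (not b) x ≡ 0
    other with cnt (suffix s x) (not b) x | trans (sym (esc-order b (suffix s x))) esc≡1
    ... | zero  | _  = refl
    ... | suc _ | eq = case trans (sym (cong (_+ 1) (pos-positive c c>0))) eq of λ ()
    tot≡ : tot (suffix s x) x ≡ suc c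
    tot≡ = trans (cong₂ _+_ (trans (order b (suffix s x)) (trans (cong (c +_) other) (+-identityʳ c))) esc≡1) (+-comm c 1)

-- Deterministic contexts

-- The bit to predict is digit `T` of segment `r`; its context is the 2N digits from `A` on. The
-- margins on the residue `e` keep e + r between 2n and N, away from the residues at which a segment
-- has just begun.
module Context (k r T A e : ℕ) (r<g : r < Lv.g k) (T<Z : T < Z k) (T≡ : T ≡ A + (Lv.N k + Lv.N k))
               (T≈e : T ≈ e [ Lv.N k ]) (2n≤e : suc k + suc k ≤ e) (e+n≤N : e + suc k ≤ Lv.N k) where
  n N : ℕ
  n = suc k
  N = Lv.N k

  2n≤N : n + n ≤ N
  2n≤N = ≤-trans 2n≤e (≤-trans (m≤m+n e n) e+n≤N)

  r<n : r < n
  r<n = ≤-trans r<g (g≤n k)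

  cell : ℕ → ℕ
  cell o = st k + (r * Z k + o)

  cell-d : ∀ o → o < Z k → S (cell o) ≡ Lv.d k (o + r)
  cell-d o o<Z = S-segment k r o r<g o<Z

  cell-+ : ∀ o y → cell o + y ≡ cell (o + y)
  cell-+ o y = eq (st k) (r * Z k) o y
    where
    eq : ∀ s z o y → s + (z + o) + y ≡ s + (z + (o + y))
    eq = solve-∀

  target-offset : ∀ a → a ≤ N + N → Σ ℕ λ c → c + a ≡ T
  target-offset a a≤ = A + (N + N ∸ a) , trans (+-assoc A _ a) (trans (cong (A +_) (m∸n+n≡m a≤)) (sym T≡))

  -- The context cell A … cell (A + 2N - 1) contains 1ⁿ, which is new to block k; so any occurrence of the
  -- context, at h, ends well inside block k.
  module Occurrence (h : ℕ) (h< : h + (N + N) < cell T) (same : ∀ y → y < N + N → S (h + y) ≡ S (cell (A + y))) where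

    -- `(A + r) * pred N` stands for -(A + r) modulo N; so this is how far into the context the run
    -- 1ⁿ begins.
    run-offset : ℕ
    run-offset = (proj₁ (Lv.ones k) + (A + r) * pred N) % N

    run-offset<N : run-offset < N
    run-offset<N = m%n<n _ N

    run-place : A + r + run-offset ≈ proj₁ (Lv.ones k) [ N ]
    run-place = ≈-trans (≈-+ (A + r) (≈-sym (≈-% _ N))) (≈-trans (≈-reflexive (trans
      (eq (A + r) (proj₁ (Lv.ones k)) (pred N)) (cong (λ N → proj₁ (Lv.ones k) + (A + r) * N) (suc-pred N))))
      (≈-sym (≈-+* _ (A + r) N)))
      where
      eq : ∀ D i p → D + (i + D * p) ≡ i + D * suc p
      eq = solve-∀

    run : Agree n (from S (h + run-offset)) (λ _ → true)
    run y y<n = begin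
      S (h + run-offset + y)                ≡⟨ cong S (+-assoc h run-offset y) ⟩
      S (h + (run-offset + y))              ≡⟨ same (run-offset + y) short ⟩
      S (cell (A + (run-offset + y)))       ≡⟨ cell-d _ (<-trans (+-monoʳ-< A short) (subst (_< Z k) T≡ T<Z)) ⟩
      Lv.d k (A + (run-offset + y) + r)     ≡⟨ cong (Lv.d k) (eq A run-offset y r) ⟩
      Lv.d k (A + r + run-offset + y)       ≡⟨ from-≈ (Lv.per k) run-place y ⟩
      Lv.d k (proj₁ (Lv.ones k) + y)        ≡⟨ proj₂ (Lv.ones k) y y<n ⟩
      true                                  ∎
      where
      open ≡-Reasoning
      short : run-offset + y < N + N
      short = +-mono-< run-offset<N (≤-trans y<n (≤-trans (m≤m+n n n) 2n≤N))
      eq : ∀ A j y r → A + (j + y) + r ≡ A + r + j + y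
      eq = solve-∀

    st≤ : st k ≤ h + run-offset
    st≤ = ≮⇒≥ λ lt → no-early-ones k (h + run-offset) lt run

    -- `a` counts back from the end of the context. The n digits from there on are read from the
    -- same cycle in two places, which injectivity makes congruent.
    window : ∀ a c c′ ρ → a ≤ N + N → n ≤ a → c + a ≡ T → c′ + n ≤ Z k → ρ < Lv.g k →
      h + (N + N) ≡ st k + (ρ * Z k + c′) + a → c′ + ρ ≈ c + r [ N ]
    window a c c′ ρ a≤ n≤a c+a≡T c′+n≤Z ρ<g h≡ = Lv.inj k _ _ λ y y<n → begin
      Lv.d k (c′ + ρ + y)                ≡⟨ cong (Lv.d k) (eq c′ ρ y) ⟩
      Lv.d k (c′ + y + ρ)                ≡⟨ S-segment k ρ (c′ + y) ρ<g (≤-trans (+-monoʳ-< c′ y<n) c′+n≤Z) ⟨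
      S (st k + (ρ * Z k + (c′ + y)))    ≡⟨ cong S (eq′ (st k) (ρ * Z k) c′ y) ⟩
      S (st k + (ρ * Z k + c′) + y)      ≡⟨ cong (λ p → S (p + y)) place ⟩
      S (h + (N + N ∸ a) + y)            ≡⟨ cong S (+-assoc h (N + N ∸ a) y) ⟩
      S (h + (N + N ∸ a + y))            ≡⟨ same (N + N ∸ a + y) (≤-trans (+-monoʳ-< (N + N ∸ a) (≤-trans y<n n≤a)) (≤-reflexive (m∸n+n≡m a≤))) ⟩
      S (cell (A + (N + N ∸ a + y)))     ≡⟨ cong (S ∘ cell) (trans (sym (+-assoc A _ y)) (cong (_+ y) c≡)) ⟩
      S (cell (c + y))                   ≡⟨ cell-d (c + y) (<-trans (+-monoʳ-< c (≤-trans y<n n≤a)) (subst (_< Z k) (sym c+a≡T) T<Z)) ⟩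
      Lv.d k (c + y + r)                 ≡⟨ cong (Lv.d k) (eq c r y) ⟨
      Lv.d k (c + r + y)                 ∎
      where
      open ≡-Reasoning
      eq : ∀ c ρ y → c + ρ + y ≡ c + y + ρ
      eq = solve-∀
      eq′ : ∀ s z c y → s + (z + (c + y)) ≡ s + (z + c) + y
      eq′ = solve-∀
      place : st k + (ρ * Z k + c′) ≡ h + (N + N ∸ a)
      place = +-cancelʳ-≡ a _ _ (trans (sym h≡) (trans (cong (h +_) (sym (m∸n+n≡m a≤))) (sym (+-assoc h _ a))))
      c≡ : A + (N + N ∸ a) ≡ c
      c≡ = +-cancelʳ-≡ a _ _ (trans (+-assoc A _ a) (trans (cong (A +_) (m∸n+n≡m a≤)) (trans (sym T≡) (sym c+a≡T))))

    q : ℕ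
    q = h + (N + N) ∸ st k

    -- The run 1ⁿ starts in the first N of the 2N digits and not before block k, so N digits of the
    -- block precede the end. This rules out the beginning of segment 0.
    N≤q : N ≤ q
    N≤q = +-cancelˡ-≤ (st k) N q (begin
      st k + N                    ≤⟨ +-monoˡ-≤ N st≤ ⟩
      h + run-offset + N          ≤⟨ +-monoˡ-≤ N (+-monoʳ-≤ h (<⇒≤ run-offset<N)) ⟩
      h + N + N                   ≡⟨ +-assoc h N N ⟩
      h + (N + N)                 ≡⟨ m+[n∸m]≡n st≤end ⟨
      st k + q                    ∎)
      where
      open ≤-Reasoning
      st≤end : st k ≤ h + (N + N)
      st≤end = ≤-trans st≤ (+-monoʳ-≤ h (≤-trans (<⇒≤ run-offset<N) (m≤m+n N N)))

    end≡ : h + (N + N) ≡ st k + q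
    end≡ = sym (m+[n∸m]≡n (≤-trans st≤ (+-monoʳ-≤ h (≤-trans (<⇒≤ run-offset<N) (m≤m+n N N)))))

    q< : q < Lv.g k * Z k
    q< = ≤-trans (+-cancelˡ-< (st k) q (r * Z k + T) (subst (_< cell T) end≡ h<)) (<⇒≤ (*+< r<g T<Z))

    n≤2N : n ≤ N + N
    n≤2N = ≤-trans (m≤m+n n n) (≤-trans 2n≤N (m≤m+n N N))

    2n≤2N : n + n ≤ N + N
    2n≤2N = ≤-trans 2n≤N (m≤m+n N N)

    -- Within one segment the last n bits determine the next one.
    inside : ∀ ρ f → ρ < Lv.g k → f + n < Z k → q ≡ ρ * Z k + (f + n) → S (h + (N + N)) ≡ S (cell T)
    inside ρ f ρ<g f+n<Z q≡ = case target-offset n n≤2N of λ (c , c+n≡T) → begin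
      S (h + (N + N))                    ≡⟨ cong S (trans end≡ (cong (st k +_) q≡)) ⟩
      S (st k + (ρ * Z k + (f + n)))     ≡⟨ S-segment k ρ (f + n) ρ<g f+n<Z ⟩
      Lv.d k (f + n + ρ)                 ≡⟨ per-≈ (Lv.per k) (subst₂ (_≈_[ N ]) (eq n f ρ) (trans (eq n c r) (cong (_+ r) c+n≡T))
                                              (≈-+ n (window n c f ρ n≤2N ≤-refl c+n≡T (<⇒≤ f+n<Z) ρ<g place))) ⟩
      Lv.d k (T + r)                     ≡⟨ cell-d T T<Z ⟨
      S (cell T)                         ∎
      where
      open ≡-Reasoning
      eq : ∀ n f ρ → n + (f + ρ) ≡ f + n + ρ
      eq = solve-∀
      place : h + (N + N) ≡ st k + (ρ * Z k + f) + n
      place = trans end≡ (trans (cong (st k +_) q≡) (eq′ (st k) (ρ * Z k) f n))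
        where
        eq′ : ∀ s z f n → s + (z + (f + n)) ≡ s + (z + f) + n
        eq′ = solve-∀

    -- If segment ρ + 1 had just begun, the end of the context would have residue less than 2n.
    across : ∀ ρ f → suc ρ < Lv.g k → f < n → q ≡ suc ρ * Z k + f → ⊥
    across ρ f sρ<g f<n q≡ = case target-offset (n + n) 2n≤2N of λ (c , c+2n≡T) →
      <⇒≱ f+ρ<2n (subst (n + n ≤_) (sym (f+ρ≡e+r c c+2n≡T)) (≤-trans 2n≤e (m≤m+n e r)))
      where
      f+ρ<2n : f + ρ < n + n
      f+ρ<2n = +-mono-< f<n (≤-trans (<-trans (n<1+n ρ) sρ<g) (g≤n k))
      -- The skip lies within the last n digits before the end; therefore the comparison is made 2n
      -- digits back, where a whole window still fits into segment `ρ`.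
      c′ : ℕ
      c′ = Z k ∸ (n + n) + f
      2n≤Z : n + n ≤ Z k
      2n≤Z = ≤-trans 2n≤N (N≤Z k)
      c′+2n : c′ + (n + n) ≡ Z k + f
      c′+2n = trans (+-assoc (Z k ∸ (n + n)) f (n + n)) (trans (cong (Z k ∸ (n + n) +_) (+-comm f (n + n)))
        (trans (sym (+-assoc (Z k ∸ (n + n)) (n + n) f)) (cong (_+ f) (m∸n+n≡m 2n≤Z))))
      c′+n≤Z : c′ + n ≤ Z k
      c′+n≤Z = +-cancelʳ-≤ n _ _ (≤-trans (≤-reflexive (trans (+-assoc c′ n n) c′+2n)) (+-monoʳ-≤ (Z k) (<⇒≤ f<n)))
      place : h + (N + N) ≡ st k + (ρ * Z k + c′) + (n + n)
      place = trans end≡ (trans (cong (st k +_) (trans q≡ (trans (eq (Z k) (ρ * Z k) f) (cong (ρ * Z k +_) (sym c′+2n)))))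
        (eq′ (st k) (ρ * Z k) c′ (n + n)))
        where
        eq : ∀ Z z f → Z + z + f ≡ z + (Z + f)
        eq = solve-∀
        eq′ : ∀ s z c a → s + (z + (c + a)) ≡ s + (z + c) + a
        eq′ = solve-∀
      -- Counting on 2n digits from that window, as if nothing were skipped, gives Z + f + ρ, hence
      -- f + ρ, on one side and T + r, hence e + r, on the other.
      f+ρ≡e+r : ∀ c → c + (n + n) ≡ T → f + ρ ≡ e + r
      f+ρ≡e+r c c+2n≡T = ≈⇒≡ (≤-trans f+ρ<2n 2n≤N) (≤-trans (+-monoʳ-< e r<n) e+n≤N) (
        ≈-trans (≈-+* (f + ρ) (Lv.m k) N) (≈-trans (≈-reflexive (trans (eq (f + ρ) (Z k))
          (trans (sym (+-assoc (Z k) f ρ)) (trans (cong (_+ ρ) (sym c′+2n)) (eq′ c′ (n + n) ρ)))))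
        (≈-trans (≈-+ (n + n) (window (n + n) c c′ ρ 2n≤2N (m≤m+n n n) c+2n≡T c′+n≤Z (<-trans (n<1+n ρ) sρ<g) place))
        (≈-trans (≈-reflexive (trans (sym (eq′ c (n + n) r)) (trans (cong (_+ r) c+2n≡T) (+-comm T r))))
        (≈-trans (≈-+ r T≈e) (≈-reflexive (+-comm r e)))))))
        where
        eq : ∀ x z → x + z ≡ z + x
        eq = solve-∀
        eq′ : ∀ c a ρ → c + a + ρ ≡ a + (c + ρ)
        eq′ = solve-∀

    predicts : S (h + (N + N)) ≡ S (cell T)
    predicts with divide q (Z k)
    ... | ρ , f , f<Z , q≡ with n ≤? f
    ...   | yes n≤f = inside ρ (f ∸ n) ρ<g (subst (_< Z k) (sym f≡) f<Z) (trans q≡ (cong (ρ * Z k +_) (sym f≡)))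
      where
      f≡ : f ∸ n + n ≡ f
      f≡ = m∸n+n≡m n≤f
      ρ<g : ρ < Lv.g k
      ρ<g = *+<⁻¹ {o = f} (subst (_< Lv.g k * Z k) q≡ q<)
    predicts | zero , f , f<Z , q≡ | no n≰f =
      ⊥-elim (n≰f (≤-trans (≤-trans (m≤m+n n n) 2n≤N) (≤-trans N≤q (≤-reflexive q≡))))
    predicts | suc ρ , f , f<Z , q≡ | no n≰f =
      ⊥-elim (across ρ f (*+<⁻¹ {o = f} (subst (_< Lv.g k * Z k) q≡ q<)) (≰⇒> n≰f) q≡)

drop-length-++ : ∀ (u w : Bits) → drop (length u) (u ++ w) ≡ w
drop-length-++ []      w = refl
drop-length-++ (a ∷ u) w = drop-length-++ u w

suffix-↾ : ∀ f a j → suffix j (f ↾ (a + j)) ≡ win f a j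
suffix-↾ f a j = begin
  drop (length (f ↾ (a + j)) ∸ j) (f ↾ (a + j))  ≡⟨ cong₂ (λ l x → drop (l ∸ j) x) (length-↾ f (a + j)) (↾-+ f a j) ⟩
  drop (a + j ∸ j) (f ↾ a ++ win f a j)          ≡⟨ cong (λ l → drop l (f ↾ a ++ win f a j)) (trans (m+n∸n≡m a j) (sym (length-↾ f a))) ⟩
  drop (length (f ↾ a)) (f ↾ a ++ win f a j)     ≡⟨ drop-length-++ (f ↾ a) (win f a j) ⟩
  win f a j                                      ∎
  where open ≡-Reasoning

occ-win-↾ : ∀ w a m → occ w (win S a m) ≤ occ w (S ↾ (a + m))
occ-win-↾ w a m = ≤-trans (occ-drop w S 0 a m) (≤-reflexive (cong (occ w) (sym (↾-win S (a + m)))))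

-- Bounds for the bits of the sequence itself

emission : ℕ → ℚ
emission M = prodℚ (emitted (S ↾ M) (S M))

-- The context fills the two turns before the target. Its copies starting at residue `e` of turns i
-- to i + K - 1 are all followed by the same bit, by periodicity; that no copy is followed by the
-- other bit is `predicts`.
good-bit : ∀ k r i e K → r < Lv.g k → K + (2 + i) < Lv.m k → suc k + suc k ≤ e → e + suc k ≤ Lv.N k → 2 ≤ K →
  emission (st k + (r * Z k + ((K + (2 + i)) * Lv.N k + e))) ≥ K ⟋ suc K
good-bit k r i e K r<g i<m 2n≤e e+n≤N 2≤K = emitted-deterministic x (S M) (N + N) K 2≤K
  (≤-trans (m≤n+m (N + N) (cell A)) (≤-reflexive (trans (sym M≡) (sym (length-↾ S M)))))
  (subst (λ c → K ≤ cnt c (S M) x) (sym context) often)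
  (subst (λ c → cnt c (not (S M)) x ≡ 0) (sym context) never)
  where
  N T A A₀ M : ℕ
  N = Lv.N k
  T = (K + (2 + i)) * N + e
  A₀ = i * N + e
  A = K * N + A₀
  M = st k + (r * Z k + T)
  x : Bits
  x = S ↾ M
  T≡ : T ≡ A + (N + N)
  T≡ = eq K i N e
    where
    eq : ∀ K i N e → (K + (2 + i)) * N + e ≡ K * N + (i * N + e) + (N + N)
    eq = solve-∀
  T<Z : T < Z k
  T<Z = *+< i<m (≤-trans (m<m+n e (s≤s z≤n)) e+n≤N)
  open Context k r T A e r<g T<Z T≡ (≈-sym (≈-trans (≈-+* e (K + (2 + i)) N) (≈-reflexive (+-comm e _)))) 2n≤e e+n≤N
    using (cell; cell-d; cell-+; module Occurrence)
  M≡ : M ≡ cell A + (N + N)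
  M≡ = trans (cong cell T≡) (sym (cell-+ A (N + N)))
  c : Bits
  c = win S (cell A) (N + N)
  context : suffix (N + N) x ≡ c
  context = trans (cong (λ m → suffix (N + N) (S ↾ m)) M≡) (suffix-↾ S (cell A) (N + N))
  length-c : ∀ b → length (c ∷ʳ b) ≡ suc (N + N)
  length-c b = trans (length-++ c) (trans (+-comm _ 1) (cong suc (length-win S (cell A) (N + N))))
  c∷ʳS : c ∷ʳ S M ≡ win S (cell A) (suc (N + N))
  c∷ʳS = trans (cong (λ m → c ∷ʳ S m) M≡) (sym (win-∷ʳ S (cell A) (N + N)))
  often : K ≤ cnt c (S M) x
  often = ≤-trans (occ-progression K (c ∷ʳ S M) S (cell A₀) N (N + N) (N>0 k)
      (≤-trans (≤-reflexive (length-c (S M))) (+-monoˡ-≤ (N + N) (N>0 k))) repeats)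
    (≤-trans (occ-win-↾ (c ∷ʳ S M) (cell A₀) (K * N + (N + N))) (≤-reflexive (cong (λ m → occ (c ∷ʳ S M) (S ↾ m)) end)))
    where
    end : cell A₀ + (K * N + (N + N)) ≡ M
    end = trans (cell-+ A₀ _) (cong cell (trans (eq A₀ (K * N) N) (sym T≡)))
      where
      eq : ∀ a kN N → a + (kN + (N + N)) ≡ kN + a + (N + N)
      eq = solve-∀
    repeats : ∀ j → j < K → at (c ∷ʳ S M) S (cell A₀ + j * N) ≡ true
    repeats j j<K = win⇒at (c ∷ʳ S M) _ (trans (cong (win S (cell A₀ + j * N)) (length-c (S M)))
      (trans (win-cong _ (cell A) (suc (N + N)) same) (sym c∷ʳS)))
      where
      same : Agree (suc (N + N)) (from S (cell A₀ + j * N)) (from S (cell A))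
      same y y≤ = begin
        S (cell A₀ + j * N + y)         ≡⟨ cong S (trans (+-assoc (cell A₀) _ y) (cell-+ A₀ (j * N + y))) ⟩
        S (cell (A₀ + (j * N + y)))     ≡⟨ cell-d _ (≤-<-trans (+-monoʳ-≤ A₀ (+-monoˡ-≤ y (*-monoˡ-≤ N (<⇒≤ j<K))))
                                             (subst (_< Z k) (eq A₀ (K * N) y) y-fits)) ⟩
        Lv.d k (A₀ + (j * N + y) + r)   ≡⟨ cong (Lv.d k) (eq₁ A₀ (j * N) y r) ⟩
        Lv.d k (A₀ + y + r + j * N)     ≡⟨ per-* (Lv.per k) j (A₀ + y + r) ⟩
        Lv.d k (A₀ + y + r)             ≡⟨ per-* (Lv.per k) K (A₀ + y + r) ⟨
        Lv.d k (A₀ + y + r + K * N)     ≡⟨ cong (Lv.d k) (eq₂ A₀ y r (K * N)) ⟩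
        Lv.d k (A + y + r)              ≡⟨ cell-d (A + y) y-fits ⟨
        S (cell (A + y))                ≡⟨ cong S (cell-+ A y) ⟨
        S (cell A + y)                  ∎
        where
        open ≡-Reasoning
        y-fits : A + y < Z k
        y-fits = ≤-<-trans (+-monoʳ-≤ A (s≤s⁻¹ y≤)) (subst (_< Z k) T≡ T<Z)
        eq : ∀ a kN y → kN + a + y ≡ a + (kN + y)
        eq = solve-∀
        eq₁ : ∀ a j y r → a + (j + y) + r ≡ a + y + r + j
        eq₁ = solve-∀
        eq₂ : ∀ a y r kN → a + y + r + kN ≡ kN + a + y + r
        eq₂ = solve-∀
  never : cnt c (not (S M)) x ≡ 0
  never = trans (cong (occ (c ∷ʳ not (S M))) (↾-win S M)) (occ-none (c ∷ʳ not (S M)) S 0 M λ h le found →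
    let read : win S h (N + N) ∷ʳ S (h + (N + N)) ≡ c ∷ʳ not (S M)
        read = trans (sym (win-∷ʳ S h (N + N))) (trans (cong (win S h) (sym (length-c (not (S M)))))
                 (at⇒win (c ∷ʳ not (S M)) h found))
        (same , wrong) = ∷ʳ-injective (win S h (N + N)) c read
    in BP.not-¬ refl (trans (sym (Occurrence.predicts h
         (≤-trans (≤-reflexive (sym (+-suc h (N + N)))) (subst (λ l → h + l ≤ M) (length-c (not (S M))) le))
         (λ y y< → trans (win-agree h (cell A) (N + N) same y y<) (cong S (cell-+ A y))))) wrong))

word-seen : ∀ k w M → length w ≡ suc k → st (suc k) ≤ M → 0 < occ w (S ↾ M)
word-seen k w M len≡ le with word-is-chunk k w len≡
... | q , q< , w≡ with m≤n⇒∃[o]m+o≡n (≤-trans chunk-end le)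
  where
  chunk-end : boundary k (suc q) ≤ st (suc k)
  chunk-end = +-monoʳ-≤ (st k) (≤-trans (*-monoˡ-≤ (suc k) q<) (≤-reflexive (*-comm (2 ^ suc k) (suc k))))
... | o , refl = ≤-trans (occ-progression 1 w S (boundary k q) (suc k) o (s≤s z≤n)
    (≤-trans (≤-reflexive len≡) (m≤m+n (suc k) o)) here′)
  (≤-trans (occ-win-↾ w (boundary k q) (1 * suc k + o)) (≤-reflexive (cong (λ m → occ w (S ↾ m)) end)))
  where
  end : boundary k q + (1 * suc k + o) ≡ boundary k (suc q) + o
  end = trans (sym (+-assoc (boundary k q) _ o)) (cong (_+ o) (trans (cong (boundary k q +_) (*-identityˡ (suc k))) (sym (next-chunk k q))))
  here′ : ∀ j → j < 1 → at w S (boundary k q + j * suc k) ≡ true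
  here′ zero    _ = win⇒at w _ (trans (cong₂ (win S) (+-identityʳ _) len≡) (trans (S-chunk k q (suc k) q< ≤-refl) (sym w≡)))
  here′ (suc j) (s≤s ())

-- Inside block k + 1 the last k bits, extended by either bit, form a word of length k + 1, and
-- block k contains all of these. So this context has seen both bits, and `occ-long` bounds its
-- count.
any-bit : ∀ k M b W → st (suc k) ≤ M → M ≤ st (suc (suc k)) → 7 * suc (suc k) ^ 3 + 2 ≤ W →
  prodℚ (emitted (S ↾ M) b) ≥ 1 ⟋ W * W
any-bit k M b W st≤ ≤st W≥ with m≤n⇒∃[o]m+o≡n {k} {M} (≤-trans (≤-trans (n≤1+n k) (k≤st (suc k))) st≤)
... | o , k+o≡M = emitted-lower (S ↾ M) b k W (≤-trans k≤M (≤-reflexive (sym (length-↾ S M)))) (seen false) (seen true)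
  (≤-trans (+-monoˡ-≤ 2 (occ-long (suffix k (S ↾ M)) k M length-context ≤st)) W≥)
  where
  k≤M : k ≤ M
  k≤M = ≤-trans (m≤m+n k o) (≤-reflexive k+o≡M)
  length-context : length (suffix k (S ↾ M)) ≡ k
  length-context = trans (length-drop (length (S ↾ M) ∸ k) (S ↾ M))
    (m∸[m∸n]≡n (≤-trans k≤M (≤-reflexive (sym (length-↾ S M)))))
  seen : ∀ b → 0 < cnt (suffix k (S ↾ M)) b (S ↾ M)
  seen b = word-seen k (suffix k (S ↾ M) ∷ʳ b) M
    (trans (length-++ (suffix k (S ↾ M))) (trans (+-comm _ 1) (cong suc length-context))) st≤

-- The code length of PPM*

count-below : ∀ a N → count (_<ᵇ a) N ≤ a
count-below a N with N ≤? a
... | yes N≤a = ≤-trans (count-≤ _ N) N≤a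
... | no N≰a with m≤n⇒∃[o]m+o≡n (<⇒≤ (≰⇒> N≰a))
...   | o , refl = ≤-trans (≤-reflexive (trans (count-+ (_<ᵇ a) a o) (cong (count (_<ᵇ a) a +_)
          (count-zero _ o (λ i _ lt → m+n≮m a i (<ᵇ-true⁻¹ lt)))))) (≤-trans (≤-reflexive (+-identityʳ _)) (count-≤ _ a))

module Bad (K : ℕ) where

  -- The digit e of turn i of a segment is certainly predicted; near the ends of a turn skipped digits interfere.
  ripe : ℕ → ℕ → ℕ → Bool
  ripe k i e = (K + 2 ≤ᵇ i) ∧ (suc k + suc k ≤ᵇ e) ∧ (e + suc k ≤ᵇ Lv.N k)

  badIn : ℕ → ℕ → Bool
  badIn k q = if q <ᵇ Lv.g k * Z k then not (ripe k (q % Z k / Lv.N k) (q % Z k % Lv.N k)) else true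

  bad : ℕ → Bool
  bad p = badIn (proj₁ (loc p)) (proj₂ (loc p))

  bad-block : ∀ k q → q < len k → bad (st k + q) ≡ badIn k q
  bad-block k q q< = cong (λ (j , r) → badIn j r) (loc-st k q q<)

  badIn-segment : ∀ k r i e → r < Lv.g k → i < Lv.m k → e < Lv.N k →
    badIn k (r * Z k + (i * Lv.N k + e)) ≡ not (ripe k i e)
  badIn-segment k r i e r<g i<m e<N with r * Z k + (i * Lv.N k + e) <ᵇ Lv.g k * Z k | <⇒<ᵇ (*+< r<g (*+< i<m e<N))
  ... | true | _ = cong₂ (λ i e → not (ripe k i e))
          (trans (cong (_/ Lv.N k) offset) (trans (+-distrib-/-∣ˡ e (n∣m*n i)) (trans (cong₂ _+_ (m*n/n≡m i (Lv.N k)) (m<n⇒m/n≡0 e<N)) (+-identityʳ i))))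
          (trans (cong (_% Lv.N k) (trans offset (+-comm _ e))) (trans ([m+kn]%n≡m%n e i (Lv.N k)) (m<n⇒m%n≡m e<N)))
    where
    offset : (r * Z k + (i * Lv.N k + e)) % Z k ≡ i * Lv.N k + e
    offset = trans (cong (_% Z k) (+-comm (r * Z k) _)) (trans ([m+kn]%n≡m%n _ r (Z k)) (m<n⇒m%n≡m (*+< i<m e<N)))

  ≤ᵇ-true : ∀ {m n} → m ≤ n → (m ≤ᵇ n) ≡ true
  ≤ᵇ-true {zero}  _  = refl
  ≤ᵇ-true {suc m} le = <ᵇ-true le

  ≤ᵇ-true⁻¹ : ∀ {m n} → (m ≤ᵇ n) ≡ true → m ≤ n
  ≤ᵇ-true⁻¹ {m} {n} eq = ≤ᵇ⇒≤ m n (subst Data.Bool.T (sym eq) _)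

  -- The margins of `ripe` exclude 2n digits at the start of a turn and at most n at its end.
  pass-bad : ∀ k r i → r < Lv.g k → i < Lv.m k → K + 2 ≤ i →
    count (λ e → badIn k (r * Z k + (i * Lv.N k + e))) (Lv.N k) ≤ 3 * suc k
  pass-bad k r i r<g i<m K≤i = ≤-trans (count-but-last (Lv.N k) (suc k) early)
    (≤-trans (+-monoˡ-≤ (suc k) (count-below (suc k + suc k) (Lv.N k))) (≤-reflexive (eq (suc k))))
    where
    eq : ∀ n → n + n + n ≡ 3 * n
    eq = solve-∀
    early : ∀ e → e + suc k ≤ Lv.N k → badIn k (r * Z k + (i * Lv.N k + e)) ≡ true → (e <ᵇ suc k + suc k) ≡ true
    early e e+n≤ isBad = <ᵇ-true {e} {suc k + suc k} (≰⇒> λ 2n≤e → BP.not-¬ refl (trans (sym isBad)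
      (trans (badIn-segment k r i e r<g i<m (≤-trans (m<m+n e (s≤s z≤n)) e+n≤))
        (cong not (cong₂ _∧_ (≤ᵇ-true K≤i) (cong₂ _∧_ (≤ᵇ-true {suc k + suc k} {e} 2n≤e) (≤ᵇ-true e+n≤)))))))

  -- The first K + 2 turns are given up: K of them to supply the repetitions and two to hold the
  -- context.
  segment-bad : ∀ k r → r < Lv.g k → count (from (badIn k) (r * Z k)) (Z k) ≤ (K + 2) * Lv.N k + Lv.m k * (3 * suc k)
  segment-bad k r r<g with Lv.m k ≤? K + 2
  ... | yes m≤ = ≤-trans (count-≤ _ (Z k)) (≤-trans (*-monoˡ-≤ (Lv.N k) m≤) (m≤m+n _ _))
  ... | no m≰ with m≤n⇒∃[o]m+o≡n (<⇒≤ (≰⇒> m≰))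
  ...   | o , m≡ = begin
    count f (Lv.m k * N)                                ≡⟨ cong (λ m → count f (m * N)) m≡ ⟨
    count f ((K + 2 + o) * N)                           ≡⟨ cong (count f) (*-distribʳ-+ N (K + 2) o) ⟩
    count f ((K + 2) * N + o * N)                       ≡⟨ count-+ f ((K + 2) * N) (o * N) ⟩
    count f ((K + 2) * N) + count (from f ((K + 2) * N)) (o * N)
      ≤⟨ +-mono-≤ (count-≤ f _) (count-blocks (from f ((K + 2) * N)) o N (3 * suc k) passes) ⟩
    (K + 2) * N + o * (3 * suc k)                       ≤⟨ +-monoʳ-≤ ((K + 2) * N) (*-monoˡ-≤ (3 * suc k) (≤-trans (m≤n+m o (K + 2)) (≤-reflexive m≡))) ⟩
    (K + 2) * N + Lv.m k * (3 * suc k)                  ∎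
    where
    open ≤-Reasoning
    N : ℕ
    N = Lv.N k
    f : ℕ → Bool
    f = from (badIn k) (r * Z k)
    passes : ∀ i → i < o → count (from (from f ((K + 2) * N)) (i * N)) N ≤ 3 * suc k
    passes i i<o = ≤-trans (count-mono N (λ e _ → subst (λ x → badIn k x ≡ true) (cong (r * Z k +_) (eq K i N e))))
      (pass-bad k r (K + 2 + i) r<g (≤-trans (+-monoʳ-< (K + 2) i<o) (≤-reflexive m≡)) (m≤m+n (K + 2) i))
      where
      eq : ∀ K i N e → (K + 2) * N + (i * N + e) ≡ (K + 2 + i) * N + e
      eq = solve-∀

  block-bad : ∀ k → count (from bad (st k)) (len k) ≤ Lv.g k * (K + 2) * 2 ^ suc k + 4 * (suc k * suc k)
  block-bad k = begin
    count (from bad (st k)) (len k)        ≤⟨ count-mono (len k) (λ q q< → trans (sym (bad-block k q q<))) ⟩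
    count (badIn k) (len k)                ≤⟨ count-mono-length (badIn k) (len≤gZ+n k) ⟩
    count (badIn k) (g * Z k + n)          ≡⟨ count-+ (badIn k) (g * Z k) n ⟩
    count (badIn k) (g * Z k) + count (from (badIn k) (g * Z k)) n
      ≤⟨ +-mono-≤ (count-blocks (badIn k) g (Z k) _ (segment-bad k)) (count-≤ _ n) ⟩
    g * ((K + 2) * Lv.N k + Lv.m k * (3 * n)) + n      ≡⟨ expand g (K + 2) (Lv.N k) (Lv.m k) n ⟩
    g * (K + 2) * Lv.N k + (g * Lv.m k * (3 * n) + n)  ≡⟨ cong (λ x → g * (K + 2) * Lv.N k + (x * (3 * n) + n)) (Lv.n≡gm k) ⟨
    g * (K + 2) * Lv.N k + (n * (3 * n) + n)           ≤⟨ +-mono-≤ (*-monoʳ-≤ (g * (K + 2)) N≤2^n) (slack (n * k) (quadratic k)) ⟩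
    g * (K + 2) * 2 ^ n + 4 * (n * n)                  ∎
    where
    open ≤-Reasoning
    g n : ℕ
    g = Lv.g k
    n = suc k
    N≤2^n : Lv.N k ≤ 2 ^ n
    N≤2^n with Lv.size k
    ... | inj₁ eq       = ≤-reflexive eq
    ... | inj₂ (eq , _) = ≤-trans (n≤1+n _) (≤-reflexive eq)
    expand : ∀ g c N m n → g * (c * N + m * (3 * n)) + n ≡ g * c * N + (g * m * (3 * n) + n)
    expand = solve-∀
    quadratic : ∀ k → suc k * (3 * suc k) + suc k + suc k * k ≡ 4 * (suc k * suc k)
    quadratic = solve-∀

  -- The powers 2ⁿ sum geometrically, so the last block dominates and one bound `γ` for all g is
  -- good enough.
  prefix-bad : ∀ γ k → (∀ j → j < k → Lv.g j ≤ γ) → count bad (st k) ≤ γ * (K + 2) * (2 * 2 ^ k) + 4 * k ^ 3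
  prefix-bad γ zero    _  = z≤n
  prefix-bad γ (suc k) g≤ = begin
    count bad (st k + len k)                            ≡⟨ count-+ bad (st k) (len k) ⟩
    count bad (st k) + count (from bad (st k)) (len k)
      ≤⟨ +-mono-≤ (prefix-bad γ k (λ j j<k → g≤ j (m<n⇒m<1+n j<k)))
           (≤-trans (block-bad k) (+-monoˡ-≤ _ (*-monoˡ-≤ (2 ^ suc k) (*-monoˡ-≤ (K + 2) (g≤ k ≤-refl))))) ⟩
    γ * (K + 2) * (2 * 2 ^ k) + 4 * k ^ 3 + (γ * (K + 2) * (2 * 2 ^ k) + 4 * (suc k * suc k))
      ≤⟨ slack _ (collect (γ * (K + 2)) (2 ^ k) k) ⟩
    γ * (K + 2) * (2 * 2 ^ suc k) + 4 * suc k ^ 3       ∎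
    where
    open ≤-Reasoning
    collect : ∀ c t k → c * (2 * t) + 4 * (k * (k * (k * 1))) + (c * (2 * t) + 4 * (suc k * suc k)) + (8 * (k * k) + 4 * k)
      ≡ c * (2 * (2 * t)) + 4 * (suc k * (suc k * (suc k * 1)))
    collect = solve-∀

  good-emission : ∀ k q → 2 ≤ K → badIn k q ≡ false → emission (st k + q) ≥ K ⟋ suc K
  good-emission k q 2≤K good with q <? Lv.g k * Z k
  ... | no q≮ = case trans (sym good) (tail-bad q (≮⇒≥ q≮)) of λ ()
    where
    tail-bad : ∀ q → Lv.g k * Z k ≤ q → badIn k q ≡ true
    tail-bad q le with q <ᵇ Lv.g k * Z k | <ᵇ⇒< q (Lv.g k * Z k)
    ... | true  | lt = ⊥-elim (<⇒≱ (lt _) le)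
    ... | false | _  = refl
  ... | yes q<gZ with divide q (Z k)
  ...   | r , o , o<Z , refl with divide o (Lv.N k)
  ...     | i , e , e<N , refl = conclude i i<m (trans (sym (badIn-segment k r i e r<g i<m e<N)) good)
    where
    r<g : r < Lv.g k
    r<g = *+<⁻¹ {o = i * Lv.N k + e} q<gZ
    i<m : i < Lv.m k
    i<m = *+<⁻¹ {o = e} o<Z
    conclude : ∀ i → i < Lv.m k → not (ripe k i e) ≡ false →
      emission (st k + (r * Z k + (i * Lv.N k + e))) ≥ K ⟋ suc K
    conclude i i<m nr with ∧-true (BP.not-injective {ripe k i e} {true} nr)
    ... | K≤i , rest with ∧-true {suc k + suc k ≤ᵇ e} {e + suc k ≤ᵇ Lv.N k} rest | m≤n⇒∃[o]m+o≡n (≤ᵇ-true⁻¹ {K + 2} {i} K≤i)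
    ...   | 2n≤e , e+n≤N | i′ , refl = subst (λ i →
              emission (st k + (r * Z k + (i * Lv.N k + e))) ≥ K ⟋ suc K) (sym (+-assoc K 2 i′))
              (good-bit k r i′ e K r<g (subst (_< Lv.m k) (+-assoc K 2 i′) i<m) (≤ᵇ-true⁻¹ {suc k + suc k} {e} 2n≤e) (≤ᵇ-true⁻¹ {e + suc k} {Lv.N k} e+n≤N) 2≤K)

  -- `st 1 ≤ p` excludes block 0, because the bound for arbitrary bits relies on a complete
  -- preceding block.
  factor : ∀ k W p → 2 ≤ K → st 1 ≤ p → p < st (suc k) → 7 * suc k ^ 3 + 2 ≤ W →
    (bad p ≡ true → emission p ≥ 1 ⟋ W * W) ×
    (bad p ≡ false → emission p ≥ K ⟋ suc K)
  factor k W p 2≤K st1≤ p< W≥ with locate p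
  ... | position zero    q q< refl = ⊥-elim (<⇒≱ q< st1≤)
  ... | position (suc j) q q< refl =
      (λ _ → any-bit j (st (suc j) + q) _ W (m≤m+n _ q) (<⇒≤ (+-monoʳ-< (st (suc j)) q<)) enough)
    , λ good → good-emission (suc j) q 2≤K (trans (sym (bad-block (suc j) q q<)) good)
    where
    enough : 7 * suc (suc j) ^ 3 + 2 ≤ W
    enough = ≤-trans (+-monoˡ-≤ 2 (*-monoʳ-≤ 7 (^-monoˡ-≤ 3 (position-< {suc j} {suc k} {q} p<)))) W≥

-- Bernoulli's inequality (1 - 1/(K + 1))ʳ ≥ 1 - r/(K + 1) with denominators cleared.
bernoulli : ∀ K r s → r + s ≡ suc K → suc K ^ r * s ≤ suc K * K ^ r
bernoulli K zero    s refl = ≤-reflexive (trans (+-identityʳ s) (sym (*-identityʳ s)))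
bernoulli K (suc r) s eq   = begin
  suc K * suc K ^ r * s          ≡⟨ rearrange (suc K) (suc K ^ r) s ⟩
  suc K ^ r * (s + K * s)        ≤⟨ *-monoʳ-≤ (suc K ^ r) (+-monoˡ-≤ (K * s) (≤-trans (m≤n+m s r) (≤-reflexive (suc-injective eq)))) ⟩
  suc K ^ r * (K + K * s)        ≡⟨ rearrange′ (suc K ^ r) K s ⟩
  K * (suc K ^ r * suc s)        ≤⟨ *-monoʳ-≤ K (bernoulli K r (suc s) (trans (+-suc r s) eq)) ⟩
  K * (suc K * K ^ r)            ≡⟨ rearrange″ K (suc K) (K ^ r) ⟩
  suc K * (K * K ^ r)            ∎
  where
  open ≤-Reasoning
  rearrange : ∀ k x s → k * x * s ≡ x * (k * s)
  rearrange = solve-∀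
  rearrange′ : ∀ x K s → x * (K + K * s) ≡ K * (x * suc s)
  rearrange′ = solve-∀
  rearrange″ : ∀ a b c → a * (b * c) ≡ b * (a * c)
  rearrange″ = solve-∀

-- (1 + 1/K)ʰ ≤ 2 for K + 1 = 2h.
module Growth (h′ : ℕ) where
  h K : ℕ
  h = suc h′
  K = h′ + h

  short : ∀ r → r ≤ h → suc K ^ r ≤ 2 * K ^ r
  short r r≤h with m≤n⇒∃[o]m+o≡n r≤h
  ... | o , r+o≡h = *-cancelʳ-≤ _ _ h (begin
    suc K ^ r * h          ≤⟨ *-monoʳ-≤ (suc K ^ r) (m≤n+m h o) ⟩
    suc K ^ r * (o + h)    ≤⟨ bernoulli K r (o + h) (trans (sym (+-assoc r o h)) (cong (_+ h) r+o≡h)) ⟩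
    (h + h) * K ^ r        ≡⟨ rearrange h (K ^ r) ⟩
    2 * K ^ r * h          ∎)
    where
    open ≤-Reasoning
    rearrange : ∀ h x → (h + h) * x ≡ 2 * x * h
    rearrange = solve-∀

  -- One bit pays for h predicted digits; the remainder r costs the additional factor 2.
  growth : ∀ c r → r ≤ h → suc K ^ (c * h + r) ≤ 2 ^ suc c * K ^ (c * h + r)
  growth zero    r r≤h = short r r≤h
  growth (suc c) r r≤h = begin
    suc K ^ (h + c * h + r)                          ≡⟨ cong (suc K ^_) (+-assoc h (c * h) r) ⟩
    suc K ^ (h + (c * h + r))                        ≡⟨ ^-distribˡ-+-* (suc K) h (c * h + r) ⟩
    suc K ^ h * suc K ^ (c * h + r)                  ≤⟨ *-mono-≤ (short h ≤-refl) (growth c r r≤h) ⟩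
    2 * K ^ h * (2 ^ suc c * K ^ (c * h + r))        ≡⟨ rearrange (K ^ h) (2 ^ suc c) (K ^ (c * h + r)) ⟩
    2 ^ suc (suc c) * (K ^ h * K ^ (c * h + r))      ≡⟨ cong (2 ^ suc (suc c) *_) (^-distribˡ-+-* K h (c * h + r)) ⟨
    2 ^ suc (suc c) * K ^ (h + (c * h + r))          ≡⟨ cong (λ x → 2 ^ suc (suc c) * K ^ x) (+-assoc h (c * h) r) ⟨
    2 ^ suc (suc c) * K ^ (h + c * h + r)            ∎
    where
    open ≤-Reasoning
    rearrange : ∀ x t y → 2 * x * (t * y) ≡ 2 * t * (x * y)
    rearrange = solve-∀

ppmAux-∷ʳ : ∀ x ys b → ppmAux x (ys ∷ʳ b) ≡ ppmAux x ys ℚ.* prodℚ (emitted (x ++ ys) b)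
ppmAux-∷ʳ x []       b = trans (ℚP.*-identityʳ _) (trans (cong (λ z → prodℚ (emitted z b)) (sym (++-identityʳ x)))
  (sym (ℚP.*-identityˡ _)))
ppmAux-∷ʳ x (a ∷ ys) b = trans (cong (prodℚ (emitted x a) ℚ.*_) (trans (ppmAux-∷ʳ (x ∷ʳ a) ys b)
  (cong (λ z → ppmAux (x ∷ʳ a) ys ℚ.* prodℚ (emitted z b)) (++-assoc x (a ∷ []) ys))))
  (sym (ℚP.*-assoc (prodℚ (emitted x a)) _ _))

1≥K⟋1+K : ∀ K → 1ℚ ≥ K ⟋ suc K
1≥K⟋1+K K = scaled (ℚP.≤-trans (frac-≤ K 0 (suc K) 0 (*-monoˡ-≤ 1 (n≤1+n K))) (ℚP.≤-reflexive (sym (ℚP.*-identityˡ _))))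

2^-cancel-≤ : ∀ m n → 2 ^ m ≤ 2 ^ n → m ≤ n
2^-cancel-≤ m n le = ≮⇒≥ λ n<m → <⇒≱ (^-monoʳ-< 2 (s≤s (s≤s z≤n)) n<m) le

module Cost (code : Bits → ℕ) (isCode : IsPPMStarCode code) (h′ a : ℕ) (st1≤a : st 1 ≤ a) where
  open Growth h′
  open Bad K

  C : ℕ
  C = code (S ↾ a)

  -- Every position is charged K/(K + 1) and a bad one 1/W² on top. Charging bad positions twice
  -- only lowers the bound and keeps the exponent of K equal to j. The first `a` digits enter
  -- through the constant `C` alone.
  accumulate : ∀ k W j → 2 ≤ K → 7 * suc k ^ 3 + 2 ≤ W → a + j ≤ st (suc k) →
    ppmP (S ↾ (a + j)) ≥ K ^ j ⟋ 2 ^ C * (suc K ^ j * (W * W) ^ count (from bad (a)) j)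
  accumulate k W zero    2≤K W≥ le = subst (ppmP (S ↾ (a + 0)) ≥ 1 ⟋_) (sym (*-identityʳ (2 ^ C)))
    (scaled (subst (λ m → frac 1 1 ℚ.≤ ppmP (S ↾ m) ℚ.* frac (2 ^ C) 1) (sym (+-identityʳ (a))) (proj₁ (isCode (S ↾ a)))))
  accumulate k W (suc j) 2≤K W≥ le = subst₂ (λ P X → P ≥ X ⟋ 2 ^ C * (suc K ^ suc j * w ^ (B + bit (bad (a + j)))))
    (sym (trans (cong (λ m → ppmP (S ↾ m)) (+-suc (a) j)) (ppmAux-∷ʳ [] (S ↾ (a + j)) (S (a + j)))))
    (*-comm (K ^ j) K) (step (bad (a + j)) refl)
    where
    p< : a + j < st (suc k)
    p< = ≤-trans (≤-reflexive (sym (+-suc (a) j))) le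
    B w : ℕ
    B = count (from bad (a)) j
    w = W * W
    P Q : ℚ
    P = ppmP (S ↾ (a + j))
    Q = emission (a + j)
    previous : P ≥ K ^ j ⟋ 2 ^ C * (suc K ^ j * w ^ B)
    previous = accumulate k W j 2≤K W≥ (<⇒≤ p<)
    step : ∀ b → bad (a + j) ≡ b → P ℚ.* Q ≥ K ^ j * K ⟋ 2 ^ C * (suc K ^ suc j * w ^ (B + bit b))
    step false good = subst (P ℚ.* Q ≥ K ^ j * K ⟋_)
      (trans (eq (2 ^ C) (suc K) (suc K ^ j) (w ^ B)) (cong (λ b → 2 ^ C * (suc K ^ suc j * w ^ b)) (sym (+-identityʳ B))))
      (≥⟋-* previous (proj₂ (factor k W (a + j) 2≤K (≤-trans st1≤a (m≤m+n a j)) p< W≥) good))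
      where
      eq : ∀ c K x y → c * (x * y) * K ≡ c * (K * x * y)
      eq = solve-∀
    step true isBad = subst₂ (λ Q X → P ℚ.* Q ≥ K ^ j * X ⟋ 2 ^ C * (suc K ^ suc j * w ^ (B + 1))) (ℚP.*-identityʳ Q) (*-identityˡ K)
      (subst (P ℚ.* (Q ℚ.* 1ℚ) ≥ K ^ j * (1 * K) ⟋_)
        (trans (eq (2 ^ C) (suc K) (suc K ^ j) (w ^ B) w) (cong (λ b → 2 ^ C * (suc K ^ suc j * w ^ b)) (+-comm 1 B)))
        (≥⟋-* previous (≥⟋-* (proj₁ (factor k W (a + j) 2≤K (≤-trans st1≤a (m≤m+n a j)) p< W≥) isBad) (1≥K⟋1+K K))))
      where
      eq : ∀ c K x y w → c * (x * y) * (w * K) ≡ c * (K * x * (w * y))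
      eq = solve-∀

  code-scaled : ∀ y X Y → ppmP y ≥ X ⟋ Y → X * 2 ^ code y ≤ 4 * Y
  code-scaled y X Y (scaled le) = subst₂ _≤_ (*-identityʳ _) (*-identityʳ _) (frac-≤⁻¹ (X * 2 ^ code y) 0 (4 * Y) 0 (begin
    frac (X * 2 ^ code y) 1                          ≡⟨ frac-* X 0 (2 ^ code y) 0 ⟨
    frac X 1 ℚ.* t                                   ≤⟨ ℚP.*-monoʳ-≤-nonNeg t {{frac-nonNeg (2 ^ code y)}} le ⟩
    ppmP y ℚ.* frac Y 1 ℚ.* t                        ≡⟨ ℚP.*-assoc (ppmP y) (frac Y 1) t ⟩
    ppmP y ℚ.* (frac Y 1 ℚ.* t)                      ≡⟨ cong (ppmP y ℚ.*_) (ℚP.*-comm (frac Y 1) t) ⟩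
    ppmP y ℚ.* (t ℚ.* frac Y 1)                      ≡⟨ ℚP.*-assoc (ppmP y) t (frac Y 1) ⟨
    ppmP y ℚ.* t ℚ.* frac Y 1                        ≤⟨ ℚP.*-monoʳ-≤-nonNeg (frac Y 1) {{frac-nonNeg Y}} (proj₂ (isCode y)) ⟩
    frac 4 1 ℚ.* frac Y 1                            ≡⟨ frac-* 4 0 Y 0 ⟩
    frac (4 * Y) 1                                   ∎))
    where
    open ℚP.≤-Reasoning
    t : ℚ
    t = frac (2 ^ code y) 1

  -- Logarithm of `accumulate`. The summand 3 collects the factor 4 granted to the arithmetic code
  -- and the factor 2 lost by rounding j / h.
  code-bound : ∀ k t j → 2 ≤ K → 7 * suc k ^ 3 + 2 ≤ 2 ^ t → a + j ≤ st (suc k) →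
    code (S ↾ (a + j)) ≤ 3 + C + j / h + (t + t) * count (from bad (a)) j
  code-bound k t j 2≤K t≥ le = 2^-cancel-≤ _ _ (*-cancelˡ-≤ (K ^ j) {{m^n≢0 K j {{>-nonZero (≤-trans (s≤s z≤n) 2≤K)}}}} (begin
    K ^ j * 2 ^ code (S ↾ (a + j))
      ≤⟨ code-scaled (S ↾ (a + j)) (K ^ j) _ (accumulate k (2 ^ t) j 2≤K t≥ le) ⟩
    4 * (2 ^ C * (suc K ^ j * (2 ^ t * 2 ^ t) ^ B))
      ≤⟨ *-monoʳ-≤ 4 (*-monoʳ-≤ (2 ^ C) (*-mono-≤ grown (≤-reflexive powers))) ⟩
    4 * (2 ^ C * (2 ^ suc (j / h) * K ^ j * 2 ^ ((t + t) * B)))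
      ≡⟨ rearrange (2 ^ C) (2 ^ (j / h)) (K ^ j) (2 ^ ((t + t) * B)) ⟩
    K ^ j * (8 * 2 ^ C * 2 ^ (j / h) * 2 ^ ((t + t) * B))
      ≡⟨ cong (K ^ j *_) (trans (cong (_* 2 ^ ((t + t) * B)) (trans (cong (_* 2 ^ (j / h)) (sym (^-distribˡ-+-* 2 3 C)))
           (sym (^-distribˡ-+-* 2 (3 + C) (j / h))))) (sym (^-distribˡ-+-* 2 (3 + C + j / h) _))) ⟩
    K ^ j * 2 ^ (3 + C + j / h + (t + t) * B)  ∎))
    where
    open ≤-Reasoning
    B : ℕ
    B = count (from bad (a)) j
    j≡ : j / h * h + j % h ≡ j
    j≡ = trans (+-comm _ (j % h)) (sym (m≡m%n+[m/n]*n j h))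
    grown : suc K ^ j ≤ 2 ^ suc (j / h) * K ^ j
    grown = subst (λ i → suc K ^ i ≤ 2 ^ suc (j / h) * K ^ i) j≡ (growth (j / h) (j % h) (<⇒≤ (m%n<n j h)))
    powers : (2 ^ t * 2 ^ t) ^ B ≡ 2 ^ ((t + t) * B)
    powers = trans (cong (_^ B) (sym (^-distribˡ-+-* 2 t t))) (^-*-assoc 2 (t + t) B)
    rearrange : ∀ c d k b → 4 * (c * (2 * d * k * b)) ≡ k * (8 * c * d * b)
    rearrange = solve-∀

-- Base 4 lets one number μ measure both quantities that matter: log n is about 2μ, and 2^μ is √n up
-- to a constant factor.
log₄ : ∀ n → Σ ℕ λ μ → 4 ^ μ ≤ suc n × suc n < 4 ^ suc μ
log₄ zero = 0 , s≤s z≤n , s≤s (s≤s z≤n)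
log₄ (suc n) with log₄ n
... | μ , lower , upper with suc (suc n) <? 4 ^ suc μ
...   | yes lt = μ , ≤-trans lower (n≤1+n _) , lt
...   | no ≮ = suc μ , ≮⇒≥ ≮ , ≤-<-trans upper (^-monoʳ-< 4 (s≤s (s≤s z≤n)) (n<1+n (suc μ)))

4^≡ : ∀ μ → 4 ^ μ ≡ 2 ^ μ * 2 ^ μ
4^≡ μ = trans (^-*-assoc 2 2 μ) (trans (cong (2 ^_) (eq μ)) (^-distribˡ-+-* 2 μ μ))
  where
  eq : ∀ μ → 2 * μ ≡ μ + μ
  eq = solve-∀

square-cancel-≤ : ∀ g γ → g * g < γ * γ → g ≤ γ
square-cancel-≤ g γ lt = ≮⇒≥ λ γ<g → <⇒≱ lt (*-mono-≤ (<⇒≤ γ<g) (<⇒≤ γ<g))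

cube-bound : ∀ n μ → n < 4 ^ suc μ → 7 * n ^ 3 + 2 ≤ 2 ^ (10 * suc μ)
cube-bound n μ n< = begin
  7 * n ^ 3 + 2                    ≤⟨ +-monoˡ-≤ 2 (*-monoʳ-≤ 7 (^-monoˡ-≤ 3 (<⇒≤ n<))) ⟩
  7 * x ^ 3 + 2                    ≤⟨ +-monoʳ-≤ (7 * x ^ 3) (*-monoʳ-≤ 2 (m^n>0 x {{m^n≢0 4 (suc μ)}} 3)) ⟩
  7 * x ^ 3 + 2 * x ^ 3            ≡⟨ *-distribʳ-+ (x ^ 3) 7 2 ⟨
  9 * x ^ 3                        ≤⟨ *-monoˡ-≤ (x ^ 3) (m≤m+n 9 7) ⟩
  2 ^ 4 * x ^ 3                    ≤⟨ *-mono-≤ (^-monoʳ-≤ 2 (*-monoʳ-≤ 4 {1} {suc μ} (s≤s z≤n))) (≤-reflexive x³) ⟩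
  2 ^ (4 * suc μ) * 2 ^ (6 * suc μ) ≡⟨ ^-distribˡ-+-* 2 (4 * suc μ) (6 * suc μ) ⟨
  2 ^ (4 * suc μ + 6 * suc μ)      ≡⟨ cong (2 ^_) (*-distribʳ-+ (suc μ) 4 6) ⟨
  2 ^ (10 * suc μ)                 ∎
  where
  open ≤-Reasoning
  x : ℕ
  x = 4 ^ suc μ
  x³ : x ^ 3 ≡ 2 ^ (6 * suc μ)
  x³ = trans (cong (_^ 3) (^-*-assoc 2 2 (suc μ))) (trans (^-*-assoc 2 (2 * suc μ) 3) (cong (2 ^_) (eq μ)))
    where
    eq : ∀ μ → 2 * suc μ * 3 ≡ 6 * suc μ
    eq = solve-∀

module Tail (code : Bits → ℕ) (isCode : IsPPMStarCode code) (E h′ a c : ℕ) (4E≡h : 4 * suc E ≡ suc h′)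
            (2≤K : 2 ≤ h′ + suc h′) (c≡ : suc (suc E * (4 * (h′ + suc h′) + 9) * 160) ≡ c) (st1≤a : st 1 ≤ a)
            (κ q j : ℕ) (q< : q < len κ) (κ-large : 4 ^ (c * 256) ≤ κ) (κ≥ : 4 * 256 ≤ κ) (M≡ : a + j ≡ st κ + q) where
  open Growth h′
  open Bad K
  open Cost code isCode h′ a st1≤a using (C; code-bound)

  M μ γ B : ℕ
  M = st κ + q
  μ = proj₁ (log₄ κ)
  γ = 2 ^ suc μ
  B = count (from bad a) j

  lower : 4 ^ μ ≤ suc κ
  lower = proj₁ (proj₂ (log₄ κ))

  upper : suc κ < 4 ^ suc μ
  upper = proj₂ (proj₂ (log₄ κ))

  M≤ : a + j ≤ st (suc κ)
  M≤ = ≤-trans (≤-reflexive M≡) (+-monoʳ-≤ (st κ) (<⇒≤ q<))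

  μ-large : c * 256 ≤ μ
  μ-large = ≮⇒≥ λ μ< → <⇒≱ (<-≤-trans upper (^-monoʳ-≤ 4 μ<)) (≤-trans κ-large (n≤1+n κ))

  g≤γ : ∀ i → i < suc κ → Lv.g i ≤ γ
  g≤γ i i< = square-cancel-≤ (Lv.g i) γ (≤-<-trans (Lv.g²≤n i) (≤-<-trans i< (subst (suc κ <_) (4^≡ (suc μ)) upper)))

  -- 4K + 9 is 4 (K + 2) + 1; the last 1 absorbs 4 (κ + 1)³, which is at most 2^κ.
  B≤ : B ≤ γ * (4 * K + 9) * 2 ^ κ
  B≤ = begin
    B                                                     ≤⟨ m≤n+m B (count bad a) ⟩
    count bad a + B                                       ≡⟨ count-+ bad a j ⟨
    count bad (a + j)                                     ≤⟨ count-mono-length bad M≤ ⟩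
    count bad (st (suc κ))                                ≤⟨ prefix-bad γ (suc κ) g≤γ ⟩
    γ * (K + 2) * (2 * 2 ^ suc κ) + 4 * suc κ ^ 3
      ≤⟨ +-monoʳ-≤ (γ * (K + 2) * (2 * 2 ^ suc κ)) (≤-trans (cube-below-2^ 4 κ κ≥) (m≤n*m (2 ^ κ) γ {{m^n≢0 2 (suc μ)}})) ⟩
    γ * (K + 2) * (2 * 2 ^ suc κ) + γ * 2 ^ κ             ≡⟨ collect γ K (2 ^ κ) ⟩
    γ * (4 * K + 9) * 2 ^ κ                               ∎
    where
    open ≤-Reasoning
    collect : ∀ γ K x → γ * (K + 2) * (2 * (2 * x)) + γ * x ≡ γ * (4 * K + 9) * x
    collect = solve-∀

  -- About 2^μ 2^κ bad digits cost O(μ) each, in a prefix of at least κ 2^κ digits with κ at least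
  -- about 4^μ. The 160 is 4 · 20 · 2.
  bad-cost : 4 * suc E * ((10 * suc μ + 10 * suc μ) * B) ≤ M
  bad-cost = begin
    4 * suc E * ((10 * suc μ + 10 * suc μ) * B)
      ≤⟨ *-monoʳ-≤ (4 * suc E) (*-monoʳ-≤ (10 * suc μ + 10 * suc μ) B≤) ⟩
    4 * suc E * ((10 * suc μ + 10 * suc μ) * (γ * (4 * K + 9) * 2 ^ κ))
      ≡⟨ regroup (suc E) (suc μ) (2 ^ μ) (4 * K + 9) (2 ^ κ) ⟩
    suc E * (4 * K + 9) * 160 * (suc μ * 2 ^ μ) * 2 ^ κ   ≤⟨ *-monoˡ-≤ (2 ^ κ) (s≤s⁻¹ small) ⟩
    κ * 2 ^ κ                                             ≤⟨ ≤-trans (k2^k≤st κ) (m≤m+n (st κ) q) ⟩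
    M                                                     ∎
    where
    open ≤-Reasoning
    regroup : ∀ E m p K x → 4 * E * ((10 * m + 10 * m) * (2 * p * K * x)) ≡ E * K * 160 * (m * p) * x
    regroup = solve-∀
    -- The successor built into `c` turns the bound κ + 1 supplied by `log₄` into the bound κ.
    small : suc (suc E * (4 * K + 9) * 160 * (suc μ * 2 ^ μ)) ≤ suc κ
    small = begin
      suc (suc E * (4 * K + 9) * 160 * (suc μ * 2 ^ μ))
        ≤⟨ +-monoˡ-≤ _ (*-mono-≤ {1} {suc μ} {1} (s≤s z≤n) (m^n>0 2 μ)) ⟩
      suc (suc E * (4 * K + 9) * 160) * (suc μ * 2 ^ μ)   ≡⟨ cong (_* (suc μ * 2 ^ μ)) c≡ ⟩
      c * (suc μ * 2 ^ μ)                  ≡⟨ *-assoc c (suc μ) (2 ^ μ) ⟨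
      c * suc μ * 2 ^ μ                    ≤⟨ *-monoˡ-≤ (2 ^ μ) (≤-trans (*-monoʳ-≤ c (m≤m*n (suc μ) (suc μ * (suc μ * 1))))
                                                (cube-below-2^ c μ μ-large)) ⟩
      2 ^ μ * 2 ^ μ                        ≡⟨ 4^≡ μ ⟨
      4 ^ μ                                ≤⟨ lower ⟩
      suc κ                                ∎

  good-cost : 4 * suc E * (j / h) ≤ M
  good-cost = begin
    4 * suc E * (j / h)       ≡⟨ cong (_* (j / h)) 4E≡h ⟩
    h * (j / h)               ≡⟨ *-comm h (j / h) ⟩
    j / h * h                 ≤⟨ m/n*n≤m j h ⟩
    j                         ≤⟨ m≤n+m j a ⟩
    a + j                     ≡⟨ M≡ ⟩
    M                         ∎
    where open ≤-Reasoning

  -- Initial, predicted and bad digits each get a quarter of the budget; one quarter is left over.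
  total : 4 * suc E * (3 + C) ≤ M → suc E * code (S ↾ M) ≤ M
  total start-cost = *-cancelˡ-≤ 4 (begin
    4 * (suc E * code (S ↾ M))                              ≡⟨ *-assoc 4 (suc E) (code (S ↾ M)) ⟨
    4 * suc E * code (S ↾ M)                                ≡⟨ cong (λ m → 4 * suc E * code (S ↾ m)) M≡ ⟨
    4 * suc E * code (S ↾ (a + j))
      ≤⟨ *-monoʳ-≤ (4 * suc E) (code-bound κ (10 * suc μ) j 2≤K (cube-bound (suc κ) μ upper) M≤) ⟩
    4 * suc E * (3 + C + j / h + (10 * suc μ + 10 * suc μ) * B)
      ≡⟨ expand (4 * suc E) (3 + C) (j / h) ((10 * suc μ + 10 * suc μ) * B) ⟩
    4 * suc E * (3 + C) + 4 * suc E * (j / h) + 4 * suc E * ((10 * suc μ + 10 * suc μ) * B)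
      ≤⟨ +-mono-≤ (+-mono-≤ start-cost good-cost) bad-cost ⟩
    M + M + M                                               ≤⟨ slack M (eq M) ⟩
    4 * M                                                   ∎)
    where
    open ≤-Reasoning
    expand : ∀ e a b c → e * (a + b + c) ≡ e * a + e * b + e * c
    expand = solve-∀
    eq : ∀ M → M + M + M + M ≡ 4 * M
    eq = solve-∀

ppm-small : ∀ code → IsPPMStarCode code → ∀ E → Σ ℕ λ M₀ → ∀ M → M₀ ≤ M → suc E * code (S ↾ M) ≤ M
-- h = 4 (E + 1), so that predicted digits at one bit per h use a quarter of the ratio 1/(E + 1).
ppm-small code isCode E = threshold (3 + 4 * E) (*-suc 4 E) (s≤s (s≤s z≤n)) _ refl (st 1) ≤-refl
  where
  threshold : ∀ h′ → 4 * suc E ≡ suc h′ → 2 ≤ h′ + suc h′ → ∀ c → suc (suc E * (4 * (h′ + suc h′) + 9) * 160) ≡ c →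
    ∀ a → st 1 ≤ a → Σ ℕ λ M₀ → ∀ M → M₀ ≤ M → suc E * code (S ↾ M) ≤ M
  threshold h′ 4E≡h 2≤K c c≡ a st1≤a = st κ₀ + (a + start-cost) , bound
    where
    κ₀ start-cost : ℕ
    -- The first summand makes μ reach 256 c, the second makes κ reach 4 · 256: the thresholds of
    -- the two uses of `cube-below-2^`.
    κ₀ = 4 ^ (c * 256) + 4 * 256
    start-cost = 4 * suc E * (3 + code (S ↾ a))
    bound : ∀ M → st κ₀ + (a + start-cost) ≤ M → suc E * code (S ↾ M) ≤ M
    bound M le with locate M
    ... | position κ q q< refl with m≤n⇒∃[o]m+o≡n {a} {st κ + q} (≤-trans (≤-trans (m≤m+n a start-cost) (m≤n+m _ (st κ₀))) le)
    ...   | j , M≡ = Tail.total code isCode E h′ a c 4E≡h 2≤K c≡ st1≤a κ q j q<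
              (≤-trans (m≤m+n _ (4 * 256)) κ₀≤κ) (≤-trans (m≤n+m (4 * 256) (4 ^ (c * 256))) κ₀≤κ) M≡
              (≤-trans (≤-trans (m≤n+m start-cost a) (m≤n+m _ (st κ₀))) le)
      where
      κ₀≤κ : κ₀ ≤ κ
      κ₀≤κ = beyond κ₀ q< (≤-trans (m≤m+n (st κ₀) _) le)

theorem4 : Σ Seq λ S →
    Normal S ×
    ((T : Bits → ℕ) → IsPPMStarCode T → R-eq T S 0ℚ) ×
    ρ-eq (λ x → length (LZ x)) S 1ℚ
theorem4 = S , S-normal , (λ T isCode → limsup-zero (λ m → T (S ↾ m)) (ppm-small T isCode)) , ρ-lz
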